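{- Let $\boldsymbol{k}=(k_1,\ldots,k_r)$ be a non-empty index with $\mathrm{wt}(\boldsymbol{k})=k$. Then the following equality holds in $\mathfrak{H}^1[[t]]$: $$w^{\star}_{\mathrm{CSF},\widehat{\mathcal{S}}}(\boldsymbol{k})=w^\star_{\mathrm{CSF}}(\boldsymbol{k})+(-1)^{k+1}\sum_{\boldsymbol{l}=(l_1,\ldots,l_r)\in\mathbb{Z}^r_{\ge0}}\ \prod_{j=1}^r\binom{k_j+l_j-1}{l_j}\,w^{\star}_{\mathrm{CSF}}(\overline{\boldsymbol{k}+\boldsymbol{l}})\,t^{l_1+\cdots+l_r},$$ where $\overline{\boldsymbol{k}+\boldsymbol{l}}=(k_r+l_r,\ldots,k_1+l_1)$.
   Context: An index is a tuple $\boldsymbol{k}=(k_1,\dots,k_r)$ of positive integers ($r\ge0$; $r=0$ is the empty index $\varnothing$); $\mathrm{wt}(\boldsymbol{k})=k_1+\cdots+k_r$. Let $\mathfrak{H}=\mathbb{Q}\langle x,y\rangle$ and $\mathfrak{H}^1=\mathbb{Q}+y\mathfrak{H}$. The shuffle product $\mathrm{sh}$ on $\mathfrak{H}$ (extended $t$-linearly and coefficientwise to $\mathfrak{H}[[t]]$) is the $\mathbb{Q}$-bilinear product with $w\,\mathrm{sh}\,1=1\,\mathrm{sh}\,w=w$ and $w_1u_1\,\mathrm{sh}\,w_2u_2=(w_1\,\mathrm{sh}\,w_2u_2)u_1+(w_1u_1\,\mathrm{sh}\,w_2)u_2$ for $u_1,u_2\in\{x,y\}$. Empty sums are $0$; for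 $i=r$ the string $k_{i+1},\dots,k_r$ is empty, and for $i=1$ the string $k_1,\dots,k_{i-1}$ is empty. A 2-poset is a finite poset $X$ with a label map $\delta_X:X\to\{x,y\}$. Put $W(X)=\sum_f \delta_X(f^{ -1}(1))\cdots\delta_X(f^{ -1}(\#X))\in\mathfrak{H}$, summed over all bijections $f:X\to\{1,\dots,\#X\}$ such that $p<q$ implies $f(p)<f(q)$ ($W(\varnothing)=1$). For $\boldsymbol{k}=(k_1,\dots,k_r)$, let $X^\star(\boldsymbol{k})$ be the 2-poset with elements $p_{i,m}$ ($1\le i\le r$, $1\le m\le k_i$), with order generated by $p_{i,1}<p_{i,2}<\cdots<p_{i,k_i}$ for each $i$ and $p_{i,1}<p_{i+1,k_{i+1}}$ for $1\le i\le r-1$, and with $p_{i,1}$ labelled $y$ and $p_{i,m}$ ($m\ge2$) labelled $x$. Put $w^\star(\boldsymbol{k})=W(X^\star(\boldsymbol{k}))\in\mathfrak{H}^1$, and $$w^\star_{\widehat{\mathcal{S}}}(\boldsymbol{k})=\sum_{i=0}^{r}(-1)^{k_{i+1}+\cdots+k_r}\,w^{\star}(k_1,\ldots,k_i)\ \mathrm{sh}\sum_{l_{i+1},\ldots,l_r\ge0}\ \prod_{j=i+1}^r\binom{k_j+l_j-1}{l_j}\,w^{\star}(k_r+l_r,\ldots,k_{i+1}+l_{i+1})\,t^{l_{i+1}+\cdots+l_r}\in\mathfrak{H}^1[[t]].$$ For a non-empty index $\boldsymbol{k}=(k_1,\dots,k_r)$ of weight $k$ set \begin{align*} w^{\star}_{\mathrm{CSF}}(\boldsymbol{k})&=\sum_{i=1}^r\sum_{j=0}^{k_i-2}w^{\star}(j+1,k_{i+1},\ldots,k_r,k_1,\ldots,k_{i-1},k_i-j)-k\,w^{\star}(k+1),\\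 w^{\star}_{\mathrm{CSF},\widehat{\mathcal{S}}}(\boldsymbol{k})&=\sum_{i=1}^r\sum_{j=0}^{k_i-2}w^{\star}_{\widehat{\mathcal{S}}}(j+1,k_{i+1},\ldots,k_r,k_1,\ldots,k_{i-1},k_i-j)\\ &\quad-\sum_{i=1}^r\sum_{j=0}^\infty w^{\star}_{\widehat{\mathcal{S}}}(j+1,k_{i+1},\ldots,k_r,k_1,\ldots,k_i)\,t^j-k\,w^{\star}_{\widehat{\mathcal{S}}}(k+1). \end{align*} -}

module Defs where

open import Data.Bool.Base using (if_then_else_)
open import Data.Fin.Base as Fin using (Fin; toℕ)
import Data.Fin.Properties as Fin
open import Data.Fin.Induction using (>-wellFounded)
open import Data.Integer.Base as ℤ using (+_; -1ℤ)
open import Data.List.Base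
  using (List; []; _∷_; [_]; _++_; map; concatMap; filter; length; lookup;
         take; drop; upTo; allFin; reverse; zipWith)
open import Data.List.Membership.Propositional using (_∈_)
open import Data.List.Membership.Propositional.Properties
  using (∈-allFin; ∈-map⁺; ∈-map⁻; ∈-concatMap⁺)
open import Data.List.Properties using (≡-dec)
import Data.List.Relation.Unary.All as All
import Data.List.Relation.Unary.All.Properties as All
import Data.List.Relation.Unary.Any as Any
import Data.List.Relation.Unary.AllPairs as AllPairs
import Data.List.Relation.Unary.AllPairs.Properties as AllPairs
open import Data.List.Relation.Unary.Unique.Propositional using (Unique)
import Data.List.Relation.Unary.Unique.Propositional.Properties as Unique
open import Data.Nat.Base using (ℕ; zero; suc; _+_; _∸_; _≡ᵇ_)
open import Data.Nat.ListAction using (sum; product)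
import Data.Nat.Properties as ℕ
open import Data.Nat.Combinatorics using (_C_)
open import Data.Product.Base using (Σ; ∃; _×_; _,_; proj₂)
import Data.Product.Properties as Product
open import Data.Rational.Base as ℚ using (ℚ; 0ℚ; 1ℚ)
open import Data.Sum.Base using (_⊎_; inj₁; inj₂)
open import Function.Base using (flip)
open import Induction.WellFounded using (Acc; acc; WellFounded)
open import Level using (0ℓ)
open import Axiom.UniquenessOfIdentityProofs using (module Decidable⇒UIP)
open import Relation.Binary.Construct.Closure.Transitive as ⁺ using (TransClosure; _∷_)
open import Relation.Binary.Core using (Rel)
open import Relation.Binary.Definitions using (Decidable; DecidableEquality)
open import Relation.Binary.PropositionalEquality
  using (_≡_; _≢_; refl; sym; isEquivalence; resp₂)
open import Relation.Binary.Structures using (IsDecStrictPartialOrder)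
open import Relation.Nullary.Decidable
  using (Dec; yes; no; does; map′; _×-dec_; _⊎-dec_; _→-dec_)
open import Relation.Nullary.Negation using (¬_)
import Relation.Unary as U

------------------------------------------------------------------------
-- Words and the algebra ℍ = ℚ⟨x,y⟩

data Letter : Set where
  x y : Letter

_≟ᴸ_ : DecidableEquality Letter
x ≟ᴸ x = yes refl
x ≟ᴸ y = no λ ()
y ≟ᴸ x = no λ ()
y ≟ᴸ y = yes refl

-- A word u₁u₂⋯uₙ is stored with its LAST letter at the head, as the list
-- uₙ ∷ ⋯ ∷ u₁ ∷ [], because the shuffle product recurses on last letters.
-- Thus u ∷ w is the word w followed by the letter u, and w ++ [ u ] is the
-- letter u followed by the word w.

Word : Set
Word = List Letter

_≟ᵂ_ : DecidableEquality Word
_≟ᵂ_ = ≡-dec _≟ᴸ_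

-- A formal ℚ-linear combination of words.  A word may occur several times,
-- so elements are compared by their coefficients.

ℍ : Set
ℍ = List (ℚ × Word)

coeff : ℍ → Word → ℚ
coeff []            w = 0ℚ
coeff ((c , v) ∷ p) w = (if does (v ≟ᵂ w) then c else 0ℚ) ℚ.+ coeff p w

infix 4 _≈_
_≈_ : Rel ℍ 0ℓ
p ≈ q = ∀ w → coeff p w ≡ coeff q w

-- ℍ¹ = ℚ + yℍ: no word whose first letter is x occurs.

infix 4 _∈ℍ¹
_∈ℍ¹ : ℍ → Set
p ∈ℍ¹ = ∀ w → coeff p (w ++ [ x ]) ≡ 0ℚ

infixl 6 _⊕_ _⊖_
infixr 7 _⊛_

_⊕_ : ℍ → ℍ → ℍ
_⊕_ = _++_

_⊛_ : ℚ → ℍ → ℍ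
c ⊛ p = map (λ (d , w) → (c ℚ.* d , w)) p

_⊖_ : ℍ → ℍ → ℍ
p ⊖ q = p ⊕ (ℚ.- 1ℚ) ⊛ q

∑ : {A : Set} → List A → (A → ℍ) → ℍ
∑ as f = concatMap f as

infixr 5 ∑
syntax ∑ as (λ a → p) = ∑[ a ∈ as ] p

word : Word → ℍ
word w = [ (1ℚ , w) ]

infixl 7 _·ℍ_
_·ℍ_ : ℍ → Letter → ℍ
p ·ℍ u = map (λ (c , w) → (c , u ∷ w)) p

infixl 7 _shʷ_ _sh_

_shʷ_ : Word → Word → ℍ
[]        shʷ v         = word v
w@(_ ∷ _) shʷ []        = word w
(u₁ ∷ w₁) shʷ (u₂ ∷ w₂) = (w₁ shʷ (u₂ ∷ w₂)) ·ℍ u₁ ⊕ ((u₁ ∷ w₁) shʷ w₂) ·ℍ u₂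

_sh_ : ℍ → ℍ → ℍ
p sh q = ∑[ (c , w) ∈ p ] ∑[ (d , v) ∈ q ] ((c ℚ.* d) ⊛ (w shʷ v))

fromℕ : ℕ → ℚ
fromℕ n = + n ℚ./ 1

sign : ℕ → ℚ
sign n = (-1ℤ ℤ.^ n) ℚ./ 1

------------------------------------------------------------------------
-- Power series: f : ℍ⟦t⟧ is ∑ₙ (f n) tⁿ

ℍ⟦t⟧ : Set
ℍ⟦t⟧ = ℕ → ℍ

const : ℍ → ℍ⟦t⟧
const p zero    = p
const p (suc _) = []

infixl 6 _⊕ᵗ_ _⊖ᵗ_
infixr 7 _⊛ᵗ_
infixl 7 _shᵗ_

_⊕ᵗ_ _⊖ᵗ_ _shᵗ_ : ℍ⟦t⟧ → ℍ⟦t⟧ → ℍ⟦t⟧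
(f ⊕ᵗ g) n = f n ⊕ g n
(f ⊖ᵗ g) n = f n ⊖ g n
(f shᵗ g) n = ∑[ m ∈ upTo (suc n) ] f m sh g (n ∸ m)

_⊛ᵗ_ : ℚ → ℍ⟦t⟧ → ℍ⟦t⟧
(c ⊛ᵗ f) n = c ⊛ f n

∑ᵗ : {A : Set} → List A → (A → ℍ⟦t⟧) → ℍ⟦t⟧
∑ᵗ as f n = ∑[ a ∈ as ] f a n

infixr 5 ∑ᵗ
syntax ∑ᵗ as (λ a → f) = ∑ᵗ[ a ∈ as ] f

-- ∑_{j ≥ 0} f_j t^j, each f_j being itself a power series.

∑tʲ : (ℕ → ℍ⟦t⟧) → ℍ⟦t⟧
∑tʲ f n = ∑[ j ∈ upTo (suc n) ] f j (n ∸ j)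

infixr 5 ∑tʲ
syntax ∑tʲ (λ j → f) = ∑tʲ[ j ] f

-- All (l₁,…,lᵣ) ∈ ℕʳ with l₁ + ⋯ + lᵣ = n, each exactly once.

tuplesOfSum : (r n : ℕ) → List (List ℕ)
tuplesOfSum zero    zero    = [ [] ]
tuplesOfSum zero    (suc n) = []
tuplesOfSum (suc r) n       =
  concatMap (λ l → map (l ∷_) (tuplesOfSum r (n ∸ l))) (upTo (suc n))

-- ∑_{l ∈ ℕʳ} p(l) t^{l₁ + ⋯ + lᵣ}.

∑tˡ : (r : ℕ) → (List ℕ → ℍ) → ℍ⟦t⟧
∑tˡ r p n = ∑[ l ∈ tuplesOfSum r n ] p l

infixr 5 ∑tˡ
syntax ∑tˡ r (λ l → p) = ∑tˡ[ l ∈ℕ^ r ] p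

infix 4 _≈ᵗ_ _≈ℍ¹⟦t⟧_ _∈ℍ¹⟦t⟧

_≈ᵗ_ : Rel ℍ⟦t⟧ 0ℓ
f ≈ᵗ g = ∀ n → f n ≈ g n

_∈ℍ¹⟦t⟧ : ℍ⟦t⟧ → Set
f ∈ℍ¹⟦t⟧ = ∀ n → f n ∈ℍ¹

_≈ℍ¹⟦t⟧_ : Rel ℍ⟦t⟧ 0ℓ
f ≈ℍ¹⟦t⟧ g = f ∈ℍ¹⟦t⟧ × g ∈ℍ¹⟦t⟧ × f ≈ᵗ g

------------------------------------------------------------------------
-- 2-posets

record 2-Poset : Set₁ where
  infix 4 _<_
  field
    Carrier                 : Set
    _<_                     : Rel Carrier 0ℓ
    isDecStrictPartialOrder : IsDecStrictPartialOrder _≡_ _<_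
    elements                : List Carrier
    elements-unique         : Unique elements
    elements-complete       : ∀ p → p ∈ elements
    δ                       : Carrier → Letter

  open IsDecStrictPartialOrder isDecStrictPartialOrder public using (_<?_)

insertions : {A : Set} → A → List A → List (List A)
insertions a []       = [ [ a ] ]
insertions a (b ∷ bs) = (a ∷ b ∷ bs) ∷ map (b ∷_) (insertions a bs)

orderings : {A : Set} → List A → List (List A)
orderings []       = [ [] ]
orderings (a ∷ as) = concatMap (insertions a) (orderings as)

-- A bijection f : X → {1,…,#X} is encoded by the listing f⁻¹(1), …, f⁻¹(#X)
-- of X; as `elements` has no repetitions, `orderings elements` contains each
-- such listing exactly once.

module _ (X : 2-Poset) where
  open 2-Poset X

  OrderPreserving : List Carrier → Set
  OrderPreserving ps =
    ∀ (a b : Fin (length ps)) → lookup ps a < lookup ps b → a Fin.< b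

  orderPreserving? : U.Decidable OrderPreserving
  orderPreserving? ps = Fin.all? λ a → Fin.all? λ b →
    (lookup ps a <? lookup ps b) →-dec (a Fin.<? b)

  W : ℍ
  W = ∑[ ps ∈ filter orderPreserving? (orderings elements) ]
        word (reverse (map δ ps))

------------------------------------------------------------------------
-- The 2-poset X⋆(k)

-- Entries are not required to be positive here; positivity is a hypothesis
-- wherever it matters.

Index : Set
Index = List ℕ

wt : Index → ℕ
wt = sum

module _ (ks : Index) where

  -- (i , m), with both components counted from 0, is p_{i+1,m+1}.

  Point : Set
  Point = Σ (Fin (length ks)) λ i → Fin (lookup ks i)

  data _⋖_ : Rel Point 0ℓ where
    chain : ∀ {i} {m m′ : Fin (lookup ks i)} →
            toℕ m′ ≡ suc (toℕ m) → (i , m) ⋖ (i , m′)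
    link  : ∀ {i i′} {m : Fin (lookup ks i)} {m′ : Fin (lookup ks i′)} →
            toℕ i′ ≡ suc (toℕ i) → toℕ m ≡ 0 → suc (toℕ m′) ≡ lookup ks i′ →
            (i , m) ⋖ (i′ , m′)

  _<⋆_ : Rel Point 0ℓ
  _<⋆_ = TransClosure _⋖_

  _≟⋆_ : DecidableEquality Point
  _≟⋆_ = Product.≡-dec Fin._≟_ Fin._≟_

  _⋖?_ : Decidable _⋖_
  (i , m) ⋖? (i′ , m′) = map′ to from
    (((i Fin.≟ i′) ×-dec (toℕ m′ ℕ.≟ suc (toℕ m))) ⊎-dec
     ((toℕ i′ ℕ.≟ suc (toℕ i)) ×-dec (toℕ m ℕ.≟ 0) ×-dec
      (suc (toℕ m′) ℕ.≟ lookup ks i′)))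
    where
    Unfolded : Rel Point 0ℓ
    Unfolded (i , m) (i′ , m′) =
      (i ≡ i′ × toℕ m′ ≡ suc (toℕ m)) ⊎
      (toℕ i′ ≡ suc (toℕ i) × toℕ m ≡ 0 × suc (toℕ m′) ≡ lookup ks i′)

    to : ∀ {p q} → Unfolded p q → p ⋖ q
    to (inj₁ (refl , e))  = chain e
    to (inj₂ (a , b , c)) = link a b c

    from : ∀ {p q} → p ⋖ q → Unfolded p q
    from (chain e)    = inj₁ (refl , e)
    from (link a b c) = inj₂ (a , b , c)

  ⋖-noetherian : WellFounded (flip _⋖_)
  ⋖-noetherian (i , m) = go (>-wellFounded i) (>-wellFounded m)
    where
    go   : ∀ {i m} → Acc Fin._>_ i → Acc Fin._>_ m → Acc (flip _⋖_) (i , m)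
    step : ∀ {i m q} → Acc Fin._>_ i → Acc Fin._>_ m → (i , m) ⋖ q → Acc (flip _⋖_) q

    go a b = acc (step a b)

    step a        (acc ss) (chain e)    = go a (ss (ℕ.≤-reflexive (sym e)))
    step (acc rs) _        (link e _ _) =
      go (rs (ℕ.≤-reflexive (sym e))) (>-wellFounded _)

  <⋆-irrefl : ∀ {p q} → p ≡ q → ¬ p <⋆ q
  <⋆-irrefl refl = go (⋖-noetherian _)
    where
    go : ∀ {p} → Acc (flip _⋖_) p → ¬ p <⋆ p
    go (acc rs) ⁺.[ r ]  = go (rs r) ⁺.[ r ]
    go (acc rs) (r ∷ r⁺) = go (rs r) (r⁺ ⁺.∷ʳ r)

  _<⋆?_ : Decidable _<⋆_
  p <⋆? q = go (⋖-noetherian p)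
    where
    Via : Point → Point → Set
    Via p s = p ⋖ s × (s ≡ q ⊎ s <⋆ q)

    go : ∀ {p} → Acc (flip _⋖_) p → Dec (p <⋆ q)
    go {p} (acc rs) = map′ to from (Fin.any? λ i → Fin.any? λ m → via? (i , m))
      where
      via? : ∀ s → Dec (Via p s)
      via? s with p ⋖? s
      ... | no ¬r = no λ (r , _) → ¬r r
      ... | yes r = map′ (r ,_) proj₂ ((s ≟⋆ q) ⊎-dec go (rs r))

      to : (∃ λ i → ∃ λ m → Via p (i , m)) → p <⋆ q
      to (_ , _ , r , inj₁ refl) = ⁺.[ r ]
      to (_ , _ , r , inj₂ r⁺)   = r ∷ r⁺

      from : p <⋆ q → ∃ λ i → ∃ λ m → Via p (i , m)
      from ⁺.[ r ]  = _ , _ , r , inj₁ refl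
      from (r ∷ r⁺) = _ , _ , r , inj₂ r⁺

  <⋆-isDecStrictPartialOrder : IsDecStrictPartialOrder _≡_ _<⋆_
  <⋆-isDecStrictPartialOrder = record
    { isStrictPartialOrder = record
        { isEquivalence = isEquivalence
        ; irrefl        = <⋆-irrefl
        ; trans         = ⁺.transitive _⋖_
        ; <-resp-≈      = resp₂ _<⋆_
        }
    ; _≟_  = _≟⋆_
    ; _<?_ = _<⋆?_
    }

  row : ∀ i → List Point
  row i = map (i ,_) (allFin (lookup ks i))

  points : List Point
  points = concatMap row (allFin (length ks))

  points-complete : ∀ p → p ∈ points
  points-complete (i , m) = ∈-concatMap⁺ row
    (Any.map (λ { refl → ∈-map⁺ (i ,_) (∈-allFin m) }) (∈-allFin i))

  points-unique : Unique points
  points-unique = Unique.concat⁺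
    (All.map⁺ (All.universal
      (λ i → Unique.map⁺ (Product.,-injectiveʳ-UIP (Decidable⇒UIP.≡-irrelevant Fin._≟_)) (Unique.allFin⁺ _))
      (allFin _)))
    (AllPairs.map⁺ (AllPairs.map disjoint (Unique.allFin⁺ _)))
    where
    disjoint : ∀ {i j} → i ≢ j → ∀ {p} → ¬ (p ∈ row i × p ∈ row j)
    disjoint i≢j (p∈i , p∈j) with ∈-map⁻ _ p∈i | ∈-map⁻ _ p∈j
    ... | _ , _ , refl | _ , _ , refl = i≢j refl

  label : Point → Letter
  label (_ , m) = if toℕ m ≡ᵇ 0 then y else x

X⋆ : Index → 2-Poset
X⋆ ks = record
  { Carrier                 = Point ks
  ; _<_                     = _<⋆_ ks
  ; isDecStrictPartialOrder = <⋆-isDecStrictPartialOrder ks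
  ; elements                = points ks
  ; elements-unique         = points-unique ks
  ; elements-complete       = points-complete ks
  ; δ                       = label ks
  }

w⋆ : Index → ℍ
w⋆ ks = W (X⋆ ks)

------------------------------------------------------------------------
-- Indices shifted by l, and the elements built from w⋆

_+ⁱ_ : Index → List ℕ → Index
_+ⁱ_ = zipWith _+_

binomials : Index → List ℕ → ℕ
binomials ks ls = product (zipWith (λ k l → (k + l ∸ 1) C l) ks ls)

w⋆Ŝ : Index → ℍ⟦t⟧
w⋆Ŝ ks = ∑ᵗ[ i ∈ upTo (suc (length ks)) ]
  sign (wt (drop i ks)) ⊛ᵗ
    (const (w⋆ (take i ks)) shᵗ
      (∑tˡ[ ls ∈ℕ^ length (drop i ks) ]
        fromℕ (binomials (drop i ks) ls) ⊛ w⋆ (reverse (drop i ks +ⁱ ls))))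

-- With i counted from 0:
--   before ks i = k₁,…,kᵢ,  through ks i = k₁,…,kᵢ₊₁,  after ks i = kᵢ₊₂,…,kᵣ

module _ (ks : Index) (i : Fin (length ks)) where

  before through after : Index
  before  = take (toℕ i) ks
  through = take (suc (toℕ i)) ks
  after   = drop (suc (toℕ i)) ks

w⋆CSF : Index → ℍ
w⋆CSF ks =
  (∑[ i ∈ allFin (length ks) ] ∑[ j ∈ upTo (lookup ks i ∸ 1) ]
    w⋆ (suc j ∷ after ks i ++ before ks i ++ [ lookup ks i ∸ j ]))
  ⊖ fromℕ (wt ks) ⊛ w⋆ [ suc (wt ks) ]

w⋆CSFŜ : Index → ℍ⟦t⟧
w⋆CSFŜ ks =
  (∑ᵗ[ i ∈ allFin (length ks) ] ∑ᵗ[ j ∈ upTo (lookup ks i ∸ 1) ]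
    w⋆Ŝ (suc j ∷ after ks i ++ before ks i ++ [ lookup ks i ∸ j ]))
  ⊖ᵗ (∑ᵗ[ i ∈ allFin (length ks) ] ∑tʲ[ j ]
    w⋆Ŝ (suc j ∷ after ks i ++ through ks i))
  ⊖ᵗ fromℕ (wt ks) ⊛ᵗ w⋆Ŝ [ suc (wt ks) ]

-- In the shuffle algebra, cutting every link p_{i,1} < p_{i+1,k_{i+1}} of X⋆(k)
-- ("no relation" minus the reversed relation) writes w⋆(k) as a signed sum of
-- shuffle products of words y x^{a-1} y x^{b-1} ⋯, and the sum over l with its
-- binomials only replaces y x^{k-1} by y x^{k-1} (1 - tx)^{-k} in these words.
-- In the i-th cyclic summand, the terms of w⋆_Ŝ whose splitting is proper are
-- products α y x^j sh β y x^{m-1} (1 - tx)^{-m} with m = k_i - j.  The Leibniz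
-- rule for last letters makes their alternating sum over j telescope into two
-- tree-shaped 2-posets, a chain with two zigzag arms, and these cancel between
-- consecutive rotations of k. What is left over are the two extreme splittings,
-- which give the right-hand side after a Vandermonde convolution.

module Submission where

open import Defs
open import Algebra.Bundles using (CommutativeRing; RawRing)
import Algebra.Construct.Pointwise as Pointwise
open import Algebra.Properties.AbelianGroup using (⁻¹-∙-comm)
import Algebra.Properties.CommutativeMonoid.Mult as CMult
open import Algebra.Properties.CommutativeSemigroup using (interchange)
import Algebra.Properties.Ring as RingProperties
import Algebra.Properties.Semiring.Mult as Mult
import Algebra.Solver.Ring
open import Algebra.Solver.Ring.AlmostCommutativeRing
  using (AlmostCommutativeRing; _-Raw-AlmostCommutative⟶_; fromCommutativeRing)
open import Data.Bool.Base using (Bool; T; _∧_; false; if_then_else_; not; true)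
open import Data.Bool.Properties using (T-∧)
open import Data.Fin.Base as Fin using (Fin; suc; toℕ; zero)
import Data.Fin.Properties as Fin
open import Data.Integer.Base as ℤ using (-1ℤ; 1ℤ)
import Data.Integer.Properties as ℤ
open import Data.List.Base
  using (List; []; [_]; _++_; _∷_; allFin; applyUpTo; concat; concatMap; drop; filter;
         head; last; length; lookup; map; replicate; reverse; tabulate; take; upTo)
open import Data.List.Membership.Propositional using (_∈_; _∉_)
open import Data.List.Membership.Propositional.Properties using (∈-++⁺ʳ; ∈-++⁺ˡ; ∈-lookup)
import Data.List.Properties as List
open import Data.List.Relation.Binary.Permutation.Propositional
  using (_↭_; prep; swap; ↭-refl; ↭-sym; ↭-trans; ↭⇒↭ₛ)
open import Data.List.Relation.Binary.Permutation.Propositional.Properties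
  using (++-comm; ++⁺ʳ; All-resp-↭; ↭-reverse; ∈-resp-↭)
import Data.List.Relation.Binary.Permutation.Setoid.Properties as PermutationSetoid
open import Data.List.Relation.Unary.All as All using (All; []; _∷_)
import Data.List.Relation.Unary.All.Properties as All
open import Data.List.Relation.Unary.AllPairs using ([]; _∷_)
open import Data.List.Relation.Unary.Any as Any using (here; there)
open import Data.List.Relation.Unary.Any.Properties using (lookup-index)
open import Data.List.Relation.Unary.Unique.Propositional using (Unique)
open import Data.Maybe.Base using (Maybe; just; nothing)
open import Data.Nat.Base as ℕ using (NonZero; _≡ᵇ_; pred; suc; zero; ℕ)
open import Data.Nat.Combinatorics using (_C_; nCk+nC[k+1]≡[n+1]C[k+1]; nCn≡1)
open import Data.Nat.ListAction.Properties using (sum-++; sum-↭)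
import Data.Nat.Properties as ℕ
open import Data.Product.Base using (_,_; _×_; proj₁; proj₂; Σ)
open import Data.Rational.Base as ℚ using (0ℚ; 1ℚ; ℚ)
import Data.Rational.Properties as ℚ
open import Data.Rational.Unnormalised.Base as ℚᵘ using (*≡*; mkℚᵘ)
import Data.Rational.Unnormalised.Properties as ℚᵘ
open import Data.Sum.Base using (_⊎_; inj₁; inj₂)
open import Data.Unit.Base using (tt; ⊤)
open import Function.Base using (_∘_; id)
open import Function.Bundles using (mk⇔; module Equivalence)
open import Level using (0ℓ)
open import Relation.Binary.Construct.Closure.Transitive as ⁺ using (_∷_)
open import Relation.Binary.Definitions using (DecidableEquality)
open import Relation.Binary.PropositionalEquality as ≡ using (_≡_; _≢_)
open import Relation.Nullary.Decidable using (T?; does; does-⇔; no; yes)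
open import Relation.Nullary.Negation using (contradiction)
open import Relation.Unary using (Decidable)
open import Algebra.Properties.CommutativeSemigroup ℕ.+-commutativeSemigroup
  using (x∙yz≈y∙xz)

-- Ring normalisation with the coefficients kept as formal differences
-- (m , n) = m − n, so that cancellation is decidable over any ring.

-- Two obstacles shape the proof. The sums over l and over j are infinite; instead of rearranging
-- them termwise, both sides of an identity are shown to satisfy one recurrence f = r + t f′ with
-- the same r, and `coinduction` identifies them. Hence the operators carrying t come with lemmas
-- that unfold their lowest term. For y x^{k-1} (1 - tx)^(-k) the unfolding is Pascal's rule, which
-- splits off a letter x with or without a factor t; this is what lets the Leibniz rule telescope.
-- Secondly, cutting a link either separates two columns or stacks them into one, so the next column
-- meets an arbitrary word. The cut sums `G` and `G₂` are therefore recursions over lists of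
-- operators with an arbitrary root operator, and an identity for two words lifts to two zigzags by
-- linearity in the root. The 2-posets enter only through `⟦w⋆⟧`; the cyclic identity itself rests
-- on the laws of `Shuffle⟦t⟧`. These are realised on all functions from words to ℚ, where the
-- product is a recursion and equality is pointwise. Membership in ℍ¹ is tested on the common value
-- of both sides.

module RingSolver (R : CommutativeRing 0ℓ 0ℓ) where
  open CommutativeRing R hiding (zero) renaming (_≈_ to _≋_)
  open Mult semiring renaming (_×_ to _∙_)
  open RingProperties ring using (-‿involutive)
  open import Relation.Binary.Reasoning.Setoid setoid
  open import Algebra.Solver.Ring.NaturalCoefficients.Default commutativeSemiring
    using (_:+_; _:*_; _:=_) renaming (solve to solveℕ)

  reduce : ℕ × ℕ → ℕ × ℕ
  reduce (a , b) = a ℕ.∸ b , b ℕ.∸ a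

  differences : RawRing 0ℓ 0ℓ
  differences = record
    { Carrier = ℕ × ℕ
    ; _≈_     = _≡_
    ; _+_     = λ (a , b) (c , d) → reduce (a ℕ.+ c , b ℕ.+ d)
    ; _*_     = λ (a , b) (c , d) → reduce (a ℕ.* c ℕ.+ b ℕ.* d , a ℕ.* d ℕ.+ b ℕ.* c)
    ; -_      = λ (a , b) → b , a
    ; 0#      = 0 , 0
    ; 1#      = 1 , 0
    }

  ⟦_⟧ : ℕ × ℕ → Carrier
  ⟦ a , b ⟧ = a ∙ 1# - b ∙ 1#

  neg-difference : ∀ u v → - (u - v) ≋ v - u
  neg-difference u v = begin
    - (u - v)     ≈⟨ ⁻¹-∙-comm +-abelianGroup u (- v) ⟨
    - u - - v     ≈⟨ +-congˡ (-‿involutive v) ⟩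
    - u + v       ≈⟨ +-comm (- u) v ⟩
    v - u         ∎

  add-differences : ∀ u v u′ v′ → (u + u′) - (v + v′) ≋ (u - v) + (u′ - v′)
  add-differences u v u′ v′ = begin
    (u + u′) - (v + v′)     ≈⟨ +-congˡ (⁻¹-∙-comm +-abelianGroup v v′) ⟨
    (u + u′) + (- v - v′)   ≈⟨ solveℕ 4 (λ a b c d → (a :+ b) :+ (c :+ d) := (a :+ c) :+ (b :+ d)) refl u u′ (- v) (- v′) ⟩
    (u - v) + (u′ - v′)     ∎

  multiply-differences : ∀ u v u′ v′ →
    (u * u′ + v * v′) - (u * v′ + v * u′) ≋ (u - v) * (u′ - v′)
  multiply-differences u v u′ v′ = begin
    (u * u′ + v * v′) - (u * v′ + v * u′)
      ≈⟨ add-differences (u * u′) (u * v′) (v * v′) (v * u′) ⟩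
    (u * u′ - u * v′) + (v * v′ - v * u′)
      ≈⟨ +-congˡ (neg-difference (v * u′) (v * v′)) ⟨
    (u * u′ - u * v′) - (v * u′ - v * v′)
      ≈⟨ +-cong (RingProperties.x[y-z]≈xy-xz ring u u′ v′) (-‿cong (RingProperties.x[y-z]≈xy-xz ring v u′ v′)) ⟨
    u * (u′ - v′) - v * (u′ - v′)
      ≈⟨ RingProperties.[y-z]x≈yx-zx ring (u′ - v′) u v ⟨
    (u - v) * (u′ - v′) ∎

  difference-cong : ∀ a b c d → a ℕ.+ d ≡ c ℕ.+ b → ⟦ a , b ⟧ ≋ ⟦ c , d ⟧
  difference-cong a b c d e = begin
    u - v                   ≈⟨ cancel u v d′ ⟨
    (u + d′) - (v + d′)     ≈⟨ +-cong ad≈cb (-‿cong (+-comm v d′)) ⟩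
    (c′ + v) - (d′ + v)     ≈⟨ cancel c′ d′ v ⟩
    c′ - d′                 ∎
    where
    u  = a ∙ 1#
    v  = b ∙ 1#
    c′ = c ∙ 1#
    d′ = d ∙ 1#

    ad≈cb : u + d′ ≋ c′ + v
    ad≈cb = trans (sym (×-homo-+ 1# a d)) (trans (×-congˡ e) (×-homo-+ 1# c b))

    cancel : ∀ p q r → (p + r) - (q + r) ≋ p - q
    cancel p q r = trans (add-differences p q r r)
      (trans (+-congˡ (-‿inverseʳ r)) (+-identityʳ _))

  reduce-correct : ∀ p → ⟦ reduce p ⟧ ≋ ⟦ p ⟧
  reduce-correct (a , b) = difference-cong (a ℕ.∸ b) (b ℕ.∸ a) a b (∸-swap a b)
    where
    ∸-swap : ∀ a b → (a ℕ.∸ b) ℕ.+ b ≡ a ℕ.+ (b ℕ.∸ a)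
    ∸-swap zero    b       = ≡.cong (ℕ._+ b) (ℕ.0∸n≡0 b)
    ∸-swap (suc a) zero    = ≡.refl
    ∸-swap (suc a) (suc b) = ≡.trans (ℕ.+-suc (a ℕ.∸ b) b) (≡.cong suc (∸-swap a b))

  morphism : differences -Raw-AlmostCommutative⟶ fromCommutativeRing R
  morphism = record
    { ⟦_⟧    = ⟦_⟧
    ; +-homo = λ (a , b) (c , d) → trans (reduce-correct (a ℕ.+ c , b ℕ.+ d)) (trans
        (+-cong (×-homo-+ 1# a c) (-‿cong (×-homo-+ 1# b d))) (add-differences _ _ _ _))
    ; *-homo = λ (a , b) (c , d) → trans
        (reduce-correct (a ℕ.* c ℕ.+ b ℕ.* d , a ℕ.* d ℕ.+ b ℕ.* c)) (trans
        (+-cong (sum-of-products a c b d) (-‿cong (sum-of-products a d b c)))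
        (multiply-differences _ _ _ _))
    ; -‿homo = λ (a , b) → sym (neg-difference _ _)
    ; 0-homo = -‿inverseʳ 0#
    ; 1-homo = trans (+-cong (+-identityʳ 1#) (RingProperties.-0#≈0# ring)) (+-identityʳ 1#)
    }
    where
    sum-of-products : ∀ a b c d →
      (a ℕ.* b ℕ.+ c ℕ.* d) ∙ 1# ≋ a ∙ 1# * b ∙ 1# + c ∙ 1# * d ∙ 1#
    sum-of-products a b c d =
      trans (×-homo-+ 1# (a ℕ.* b) (c ℕ.* d)) (+-cong (×1-homo-* a b) (×1-homo-* c d))

  equal? : ∀ p q → Maybe (⟦ p ⟧ ≋ ⟦ q ⟧)
  equal? (a , b) (c , d) with a ℕ.+ d ℕ.≟ c ℕ.+ b
  ... | no  _ = nothing
  ... | yes e = just (difference-cong a b c d e)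

  open Algebra.Solver.Ring differences (fromCommutativeRing R) morphism equal? public
    using (solve; _:=_; _:+_; _:*_; _:-_; :-_; con)

-- The part of the structure of (ℍ⟦t⟧, sh) that the proof uses: τ is
-- multiplication by t, 𝕋 f is ∑ⱼ tʲ f j, op u is right multiplication by the
-- letter u, and coinduction expresses completeness in t.

record Shuffle⟦t⟧ : Set₁ where
  field
    commutativeRing : CommutativeRing 0ℓ 0ℓ

  open CommutativeRing commutativeRing public
    hiding (zero) renaming (Carrier to R; _≈_ to _≋_)

  field
    τ      : R → R
    τ-cong : ∀ {f g} → f ≋ g → τ f ≋ τ g
    τ-+    : ∀ f g → τ (f + g) ≋ τ f + τ g
    τ-*    : ∀ f g → τ (f * g) ≋ τ f * g

    𝕋      : (ℕ → R) → R
    𝕋-step : ∀ f → 𝕋 f ≋ f 0 + τ (𝕋 (f ∘ suc))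

    coinduction : {P : Set} (step : P → P) (r g h : P → R) →
      (∀ p → g p ≋ r p + τ (g (step p))) →
      (∀ p → h p ≋ r p + τ (h (step p))) →
      ∀ p → g p ≋ h p

    op       : Letter → R → R
    op-cong  : ∀ u {f g} → f ≋ g → op u f ≋ op u g
    op-+     : ∀ u f g → op u (f + g) ≋ op u f + op u g
    op-τ     : ∀ u f → op u (τ f) ≋ τ (op u f)
    op-*-op  : ∀ u v f g → op u f * op v g ≋ op u (f * op v g) + op v (op u f * g)

-- Needed for the term k w⋆(k+1). With b n l = C(n+l, l), Pascal's rule reduces each of the two
-- absorption identities `up` and `right` to both of them at smaller arguments, so they are proved
-- together.
absorption : ∀ n l → (suc n) ℕ.* ((suc n ℕ.+ l) C l) ≡ (suc n ℕ.+ l) ℕ.* ((n ℕ.+ l) C l)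
absorption n l = up n l
  where
  b : ℕ → ℕ → ℕ
  b n l = (n ℕ.+ l) C l

  pascal : ∀ n l → b (suc n) (suc l) ≡ b (suc n) l ℕ.+ b n (suc l)
  pascal n l rewrite ℕ.+-suc n l = ≡.sym (nCk+nC[k+1]≡[n+1]C[k+1] (suc (n ℕ.+ l)) l)

  b-0 : ∀ l → b 0 l ≡ 1
  b-0 = nCn≡1

  up : ∀ n l → suc n ℕ.* b (suc n) l ≡ (suc n ℕ.+ l) ℕ.* b n l
  right : ∀ n l → suc l ℕ.* b n (suc l) ≡ suc (n ℕ.+ l) ℕ.* b n l

  up n zero    rewrite ℕ.+-identityʳ n = ≡.refl
  up n (suc l) rewrite pascal n l = begin
    suc n ℕ.* (b (suc n) l ℕ.+ b n (suc l))       ≡⟨ ℕ.*-distribˡ-+ (suc n) (b (suc n) l) _ ⟩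
    suc n ℕ.* b (suc n) l ℕ.+ suc n ℕ.* b n (suc l) ≡⟨ ≡.cong (ℕ._+ suc n ℕ.* b n (suc l)) (≡.trans (up n l) (≡.sym (right n l))) ⟩
    suc l ℕ.* b n (suc l) ℕ.+ suc n ℕ.* b n (suc l) ≡⟨ ℕ.*-distribʳ-+ (b n (suc l)) (suc l) (suc n) ⟨
    (suc l ℕ.+ suc n) ℕ.* b n (suc l)             ≡⟨ ≡.cong (ℕ._* b n (suc l)) (ℕ.+-comm (suc l) (suc n)) ⟩
    (suc n ℕ.+ suc l) ℕ.* b n (suc l)             ∎
    where open ≡.≡-Reasoning

  right zero    l rewrite b-0 l | b-0 (suc l) = ≡.refl
  right (suc n) l rewrite pascal n l = begin
    suc l ℕ.* (b (suc n) l ℕ.+ b n (suc l))       ≡⟨ ℕ.*-distribˡ-+ (suc l) (b (suc n) l) _ ⟩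
    suc l ℕ.* b (suc n) l ℕ.+ suc l ℕ.* b n (suc l) ≡⟨ ≡.cong (suc l ℕ.* b (suc n) l ℕ.+_) (≡.trans (right n l) (≡.sym (up n l))) ⟩
    suc l ℕ.* b (suc n) l ℕ.+ suc n ℕ.* b (suc n) l ≡⟨ ℕ.*-distribʳ-+ (b (suc n) l) (suc l) (suc n) ⟨
    (suc l ℕ.+ suc n) ℕ.* b (suc n) l             ≡⟨ ≡.cong (ℕ._* b (suc n) l) (ℕ.+-comm (suc l) (suc n)) ⟩
    (suc n ℕ.+ suc l) ℕ.* b (suc n) l             ≡⟨ ≡.cong (ℕ._* b (suc n) l) (ℕ.+-suc (suc n) l) ⟩
    suc (suc n ℕ.+ l) ℕ.* b (suc n) l             ∎
    where open ≡.≡-Reasoning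

wt-∷ʳ : ∀ ks b → wt (ks ++ [ b ]) ≡ wt ks ℕ.+ b
wt-∷ʳ ks b = ≡.trans (sum-++ ks [ b ]) (≡.cong (wt ks ℕ.+_) (ℕ.+-identityʳ b))

wt-reverse : ∀ ks → wt (reverse ks) ≡ wt ks
wt-reverse ks = sum-↭ (↭-reverse ks)

-- Linear functionals and the substitution of one entry.

module Core (A : Shuffle⟦t⟧) where
  open Shuffle⟦t⟧ A public
  open Mult semiring public renaming (_×_ to _∙_)
  open CMult +-commutativeMonoid using (×-distrib-+)
  open RingProperties ring public using (-‿involutive; -0#≈0#)
  open RingSolver commutativeRing public
    using (solve; _:=_; _:+_; _:*_; _:-_; :-_)
  open import Relation.Binary.Reasoning.Setoid setoid public

  reflexive≡ : ∀ {f g : R} → f ≡ g → f ≋ g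
  reflexive≡ ≡.refl = refl

  -- Additivity and compatibility with t already force compatibility with negation, multiples and
  -- the infinite sums `𝕋`. The argument is a family, so that a cut sum as a function of its root
  -- operator (I = R), sums over splittings and the substitution of entries are all instances.
  record Linear {I : Set} (Λ : (I → R) → R) : Set where
    field
      cong   : ∀ {f g} → (∀ i → f i ≋ g i) → Λ f ≋ Λ g
      +-homo : ∀ f g → Λ (λ i → f i + g i) ≋ Λ f + Λ g
      τ-homo : ∀ f → Λ (λ i → τ (f i)) ≋ τ (Λ f)

    0-homo : Λ (λ _ → 0#) ≋ 0#
    0-homo = begin
      z             ≈⟨ solve 1 (λ a → a := (a :+ a) :- a) refl z ⟩
      (z + z) - z   ≈⟨ +-congʳ (+-homo _ _) ⟨
      Λ (λ _ → 0# + 0#) - z ≈⟨ +-congʳ (cong (λ _ → +-identityʳ 0#)) ⟩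
      z - z         ≈⟨ -‿inverseʳ z ⟩
      0#            ∎
      where z = Λ (λ _ → 0#)

    -‿homo : ∀ f → Λ (λ i → - f i) ≋ - Λ f
    -‿homo f = begin
      Λ (λ i → - f i)
        ≈⟨ solve 2 (λ a b → a := (b :+ a) :- b) refl (Λ (λ i → - f i)) (Λ f) ⟩
      (Λ f + Λ (λ i → - f i)) - Λ f    ≈⟨ +-congʳ (+-homo _ _) ⟨
      Λ (λ i → f i - f i) - Λ f        ≈⟨ +-congʳ (cong (λ i → -‿inverseʳ (f i))) ⟩
      Λ (λ _ → 0#) - Λ f               ≈⟨ +-congʳ 0-homo ⟩
      0# - Λ f                         ≈⟨ +-identityˡ _ ⟩
      - Λ f                            ∎

    -homo : ∀ f g → Λ (λ i → f i - g i) ≋ Λ f - Λ g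
    -homo f g = trans (+-homo _ _) (+-congˡ (-‿homo g))

    ∙-homo : ∀ n f → Λ (λ i → n ∙ f i) ≋ n ∙ Λ f
    ∙-homo zero    f = 0-homo
    ∙-homo (suc n) f = trans (+-homo _ _) (+-congˡ (∙-homo n f))

    -- Coinduction along the shift of the family: both sides split off Λ of the term at 0.
    𝕋-homo : ∀ (f : ℕ → I → R) → Λ (λ i → 𝕋 (λ l → f l i)) ≋ 𝕋 (λ l → Λ (f l))
    𝕋-homo = coinduction (λ f → f ∘ suc) (λ f → Λ (f 0)) _ _
      (λ f → trans (cong (λ i → 𝕋-step _)) (trans (+-homo _ _) (+-congˡ (τ-homo _))))
      (λ f → 𝕋-step _)

  LinearOp : (R → R) → Set
  LinearOp Φ = Linear {⊤} (λ f → Φ (f tt))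

  module Op {Φ : R → R} (lin : LinearOp Φ) where
    private module Λ = Linear lin
    cong : ∀ {f g} → f ≋ g → Φ f ≋ Φ g
    cong e = Λ.cong (λ _ → e)
    +-homo : ∀ f g → Φ (f + g) ≋ Φ f + Φ g
    +-homo f g = Λ.+-homo (λ _ → f) (λ _ → g)
    -homo : ∀ f g → Φ (f - g) ≋ Φ f - Φ g
    -homo f g = Λ.-homo (λ _ → f) (λ _ → g)
    τ-homo : ∀ f → Φ (τ f) ≋ τ (Φ f)
    τ-homo f = Λ.τ-homo (λ _ → f)
    0-homo : Φ 0# ≋ 0#
    0-homo = Λ.0-homo
    -‿homo : ∀ f → Φ (- f) ≋ - Φ f
    -‿homo f = Λ.-‿homo (λ _ → f)
    ∙-homo : ∀ n f → Φ (n ∙ f) ≋ n ∙ Φ f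
    ∙-homo n f = Λ.∙-homo n (λ _ → f)
    𝕋-homo : ∀ f → Φ (𝕋 f) ≋ 𝕋 (λ l → Φ (f l))
    𝕋-homo f = Λ.𝕋-homo (λ l _ → f l)

  comp-linear : ∀ {I J : Set} {Λ : (I → R) → R} {M : I → (J → R) → R} →
    Linear Λ → (∀ i → Linear (M i)) → Linear (λ f → Λ (λ i → M i f))
  comp-linear l m = record
    { cong   = λ e → L.cong (λ i → Linear.cong (m i) e)
    ; +-homo = λ f g → trans (L.cong (λ i → Linear.+-homo (m i) f g)) (L.+-homo _ _)
    ; τ-homo = λ f → trans (L.cong (λ i → Linear.τ-homo (m i) f)) (L.τ-homo _)
    }
    where module L = Linear l

  id-linear : LinearOp id
  id-linear = record { cong = λ e → e tt ; +-homo = λ _ _ → refl ; τ-homo = λ _ → refl }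

  *-linear : ∀ c → LinearOp (c *_)
  *-linear c = record
    { cong   = λ e → *-congˡ (e tt)
    ; +-homo = λ f g → distribˡ c (f tt) (g tt)
    ; τ-homo = λ f → trans (*-comm _ _) (trans (sym (τ-* _ _)) (τ-cong (*-comm _ _)))
    }

  op-linear : ∀ u → LinearOp (op u)
  op-linear u = record
    { cong   = λ e → op-cong u (e tt)
    ; +-homo = λ f g → op-+ u (f tt) (g tt)
    ; τ-homo = λ f → op-τ u (f tt)
    }

  τ-linear : LinearOp τ
  τ-linear = record
    { cong = λ e → τ-cong (e tt) ; +-homo = λ f g → τ-+ (f tt) (g tt) ; τ-homo = λ _ → refl }

  -‿linear : LinearOp (-_)
  -‿linear = record
    { cong   = λ e → -‿cong (e tt)
    ; +-homo = λ f g → solve 2 (λ a b → :- (a :+ b) := :- a :+ :- b) refl (f tt) (g tt)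
    ; τ-homo = λ f → sym (Op.-‿homo {τ} τ-linear (f tt))
    }

  ∙-linear : ∀ n → LinearOp (n ∙_)
  ∙-linear n = record
    { cong   = λ e → ×-congʳ n (e tt)
    ; +-homo = λ f g → ×-distrib-+ (f tt) (g tt) n
    ; τ-homo = λ f → sym (Op.∙-homo {τ} τ-linear n (f tt))
    }

  𝕋-cong : ∀ {f g} → (∀ l → f l ≋ g l) → 𝕋 f ≋ 𝕋 g
  𝕋-cong {f} {g} e = coinduction {P = Σ (ℕ → R) λ f → Σ (ℕ → R) λ g → ∀ l → f l ≋ g l}
    (λ (f , g , e) → f ∘ suc , g ∘ suc , e ∘ suc) (λ (f , _) → f 0)
    (λ (f , _) → 𝕋 f) (λ (_ , g , _) → 𝕋 g)
    (λ (f , _) → 𝕋-step f)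
    (λ (_ , g , e) → trans (𝕋-step g) (+-congʳ (sym (e 0)))) (f , g , e)

  𝕋-linear : Linear 𝕋
  𝕋-linear = record
    { cong   = 𝕋-cong
    ; +-homo = λ f g → coinduction (λ (f , g) → f ∘ suc , g ∘ suc) (λ (f , g) → f 0 + g 0)
        (λ (f , g) → 𝕋 (λ l → f l + g l)) (λ (f , g) → 𝕋 f + 𝕋 g)
        (λ _ → 𝕋-step _)
        (λ (f , g) → trans (+-cong (𝕋-step f) (𝕋-step g)) (trans
          (solve 4 (λ a b c d → (a :+ b) :+ (c :+ d) := (a :+ c) :+ (b :+ d)) refl _ _ _ _)
          (+-congˡ (sym (τ-+ _ _)))))
        (f , g)
    ; τ-homo = λ f → sym (Op.𝕋-homo {τ} τ-linear f)
    }

  eval-linear : ∀ {I : Set} (i : I) → Linear (λ f → f i)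
  eval-linear i = record { cong = λ e → e i ; +-homo = λ _ _ → refl ; τ-homo = λ _ → refl }

  opaque
    -- The substitution f(k) ↦ ∑ₗ C(k+l-1, l) tˡ f(k+l) of one entry of an index.
    L : ℕ → (ℕ → R) → R
    L k f = 𝕋 (λ l → ((k ℕ.+ l ℕ.∸ 1) C l) ∙ f (k ℕ.+ l))

    L-linear : ∀ k → Linear (L k)
    L-linear k = comp-linear 𝕋-linear
      (λ l → comp-linear (∙-linear ((k ℕ.+ l ℕ.∸ 1) C l)) (λ _ → eval-linear (k ℕ.+ l)))

    L-cong : ∀ k {f g} → (∀ i → f i ≋ g i) → L k f ≋ L k g
    L-cong k = Linear.cong (L-linear k)

    L-cong⁺ : ∀ n {f g} → (∀ i → f (suc i) ≋ g (suc i)) → L (suc n) f ≋ L (suc n) g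
    L-cong⁺ n e = 𝕋-cong (λ l → ×-congʳ ((n ℕ.+ l) C l) (e (n ℕ.+ l)))

    -- `L` is a t-series of natural multiples, and these pass through every linear functional. All
    -- interchanges of substitutions with cuts, sums and other substitutions come from this fact.
    L-homo : ∀ {I : Set} {Λ : (I → R) → R} → Linear Λ → ∀ k (f : ℕ → I → R) →
      Λ (λ i → L k (λ a → f a i)) ≋ L k (λ a → Λ (f a))
    L-homo lin k f = trans (Linear.𝕋-homo lin _)
      (𝕋-cong (λ l → Linear.∙-homo lin ((k ℕ.+ l ℕ.∸ 1) C l) _))

    L-op : ∀ {Φ} → LinearOp Φ → ∀ k f → Φ (L k f) ≋ L k (λ a → Φ (f a))
    L-op lin k f = L-homo lin k (λ a _ → f a)

    L1-step : ∀ f → L 1 f ≋ f 1 + τ (L 1 (f ∘ suc))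
    L1-step f = trans (𝕋-step _) (+-cong (×-homo-1 _) (τ-cong (𝕋-cong λ l →
      ×-congˡ (≡.trans (nCn≡1 (suc l)) (≡.sym (nCn≡1 l))))))

    -- Pascal's rule
    L-step : ∀ n f → L (suc (suc n)) f ≋ L (suc n) (f ∘ suc) + τ (L (suc (suc n)) (f ∘ suc))
    L-step n f = begin
      L (suc (suc n)) f
        ≈⟨ 𝕋-step _ ⟩
      1 ∙ f (2 ℕ.+ (n ℕ.+ 0)) + τ (𝕋 (λ l → ((1 ℕ.+ (n ℕ.+ suc l)) C suc l) ∙ f (2 ℕ.+ (n ℕ.+ suc l))))
        ≈⟨ +-congˡ (τ-cong (trans (𝕋-cong pascal) (Linear.+-homo 𝕋-linear _ _))) ⟩
      1 ∙ f (2 ℕ.+ (n ℕ.+ 0)) + τ (S + L (suc (suc n)) (f ∘ suc))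
        ≈⟨ +-congˡ (τ-+ _ _) ⟩
      1 ∙ f (2 ℕ.+ (n ℕ.+ 0)) + (τ S + τ (L (suc (suc n)) (f ∘ suc)))
        ≈⟨ +-assoc _ _ _ ⟨
      (1 ∙ f (2 ℕ.+ (n ℕ.+ 0)) + τ S) + τ (L (suc (suc n)) (f ∘ suc))
        ≈⟨ +-congʳ (𝕋-step _) ⟨
      L (suc n) (f ∘ suc) + τ (L (suc (suc n)) (f ∘ suc)) ∎
      where
      S : R
      S = 𝕋 (λ l → ((n ℕ.+ suc l) C suc l) ∙ f (2 ℕ.+ (n ℕ.+ suc l)))
      pascal : ∀ l → ((1 ℕ.+ (n ℕ.+ suc l)) C suc l) ∙ f (2 ℕ.+ (n ℕ.+ suc l)) ≋
        ((n ℕ.+ suc l) C suc l) ∙ f (2 ℕ.+ (n ℕ.+ suc l)) + ((1 ℕ.+ (n ℕ.+ l)) C l) ∙ f (3 ℕ.+ (n ℕ.+ l))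
      pascal l rewrite ℕ.+-suc n l = trans
        (×-congˡ (≡.trans (≡.sym (nCk+nC[k+1]≡[n+1]C[k+1] (suc (n ℕ.+ l)) l)) (ℕ.+-comm ((suc (n ℕ.+ l)) C l) _)))
        (×-homo-+ _ ((suc (n ℕ.+ l)) C suc l) ((suc (n ℕ.+ l)) C l))

    -- Since C(l, l) = 1, a tail sum over j weighted by t^j is the substitution of an entry 1. This
    -- is how the infinite sums of the cyclic formula become columns.
    𝕋≋L1 : ∀ f → 𝕋 (f ∘ suc) ≋ L 1 f
    𝕋≋L1 f = 𝕋-cong (λ l → sym (trans (×-congˡ (nCn≡1 l)) (×-homo-1 _)))

  -- In terms of columns, (1 - tx)^(-1) (1 - tx)^(-n-1) = (1 - tx)^(-n-2): the geometric recurrence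
  -- of the outer factor is Pascal's rule for the right-hand side.
  L1-L : ∀ n f → L 1 (λ p → L (suc n) (λ q → f (p ℕ.+ q))) ≋ L (suc (suc n)) f
  L1-L n f = coinduction (λ f → f ∘ suc) (λ f → L (suc n) (f ∘ suc))
    (λ f → L 1 (λ p → L (suc n) (λ q → f (p ℕ.+ q)))) (λ f → L (suc (suc n)) f)
    (λ f → L1-step (λ p → L (suc n) (λ q → f (p ℕ.+ q)))) (λ f → L-step n f) f

  L-L : ∀ m n f → L (suc m) (λ p → L (suc n) (λ q → f (p ℕ.+ q))) ≋ L (suc m ℕ.+ suc n) f
  L-L zero    n f = L1-L n f
  L-L (suc m) n f = begin
    L (suc (suc m)) (λ p → L (suc n) (λ q → f (p ℕ.+ q)))
      ≈⟨ L1-L m (λ p → L (suc n) (λ q → f (p ℕ.+ q))) ⟨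
    L 1 (λ o → L (suc m) (λ p → L (suc n) (λ q → f (o ℕ.+ p ℕ.+ q))))
      ≈⟨ L-cong 1 (λ o → L-cong (suc m) λ p → L-cong (suc n) λ q → reflexive≡ (≡.cong f (ℕ.+-assoc o p q))) ⟩
    L 1 (λ o → L (suc m) (λ p → L (suc n) (λ q → f (o ℕ.+ (p ℕ.+ q)))))
      ≈⟨ L-cong 1 (λ o → L-L m n (λ q → f (o ℕ.+ q))) ⟩
    L 1 (λ o → L (suc m ℕ.+ suc n) (λ q → f (o ℕ.+ q)))
      ≈⟨ L1-L (m ℕ.+ suc n) f ⟩
    L (suc (suc m) ℕ.+ suc n) f ∎

  -- Columns y x^{k-1} and their t-deformations.

  append : Word → R → R
  append []      f = f
  append (u ∷ w) f = op u (append w f)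

  append-linear : ∀ w → LinearOp (append w)
  append-linear []      = id-linear
  append-linear (u ∷ w) = comp-linear (op-linear u) (λ _ → append-linear w)

  append-++ : ∀ v w f → append (v ++ w) f ≋ append v (append w f)
  append-++ []      w f = refl
  append-++ (u ∷ v) w f = op-cong u (append-++ v w f)

  -- The word y x^{k-1}, last letter first; [] is a junk value for k = 0.
  column : ℕ → Word
  column zero    = []
  column (suc j) = replicate j x ++ [ y ]

  Z : ℕ → R → R
  Z k = append (column k)

  Z-linear : ∀ k → LinearOp (Z k)
  Z-linear k = append-linear (column k)

  -- For k ≥ 1 this is f ↦ f y x^{k-1} (1 - tx)^(-k).
  Zᵗ : ℕ → R → R
  Zᵗ k f = L k (λ a → Z a f)

  Zᵗ-linear : ∀ k → LinearOp (Zᵗ k)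
  Zᵗ-linear k = comp-linear (L-linear k) Z-linear

  L-Z-suc : ∀ n f → L (suc n) (λ a → Z (suc a) f) ≋ op x (Zᵗ (suc n) f)
  L-Z-suc n f = trans
    (L-cong⁺ n {λ a → Z (suc a) f} {λ a → op x (Z a f)} (λ _ → refl))
    (sym (L-op {op x} (op-linear x) (suc n) (λ a → Z a f)))

  Zᵗ-1 : ∀ f → Zᵗ 1 f ≋ op y f + τ (op x (Zᵗ 1 f))
  Zᵗ-1 f = trans (L1-step (λ a → Z a f)) (+-congˡ (τ-cong (L-Z-suc 0 f)))

  Zᵗ-suc : ∀ n f →
    Zᵗ (suc (suc n)) f ≋ op x (Zᵗ (suc n) f) + τ (op x (Zᵗ (suc (suc n)) f))
  Zᵗ-suc n f = trans (L-step n (λ a → Z a f)) (+-cong (L-Z-suc n f) (τ-cong (L-Z-suc (suc n) f)))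

  -- Substituting the equation into itself j times produces `op x` applied j times to g, so the
  -- coinduction runs over all these elements at once.
  Zᵗ-1-unique : ∀ f g → g ≋ op y f + τ (op x g) → g ≋ Zᵗ 1 f
  Zᵗ-1-unique f g e = coinduction suc (λ j → xⁿ j (op y f)) (λ j → xⁿ j g) (λ j → xⁿ j (Zᵗ 1 f))
    (expand g e) (expand (Zᵗ 1 f) (Zᵗ-1 f)) 0
    where
    xⁿ : ℕ → R → R
    xⁿ zero    g = g
    xⁿ (suc j) g = op x (xⁿ j g)

    expand : ∀ g → g ≋ op y f + τ (op x g) → ∀ j → xⁿ j g ≋ xⁿ j (op y f) + τ (xⁿ (suc j) g)
    expand g e zero    = e
    expand g e (suc j) = trans (op-cong x (expand g e j)) (trans (op-+ x _ _) (+-congˡ (op-τ x _)))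

  -- Signs, finite sums and the alternating product of two columns.

  ∑< : ℕ → (ℕ → R) → R
  ∑< zero    f = 0#
  ∑< (suc n) f = f 0 + ∑< n (f ∘ suc)

  sgn : ℕ → R → R
  sgn zero    f = f
  sgn (suc n) f = - sgn n f

  sgn-cong : ∀ n {f g} → f ≋ g → sgn n f ≋ sgn n g
  sgn-cong zero    e = e
  sgn-cong (suc n) e = -‿cong (sgn-cong n e)

  sgn-+ : ∀ m n f → sgn (m ℕ.+ n) f ≋ sgn m (sgn n f)
  sgn-+ zero    n f = refl
  sgn-+ (suc m) n f = -‿cong (sgn-+ m n f)

  sgn-homo : ∀ {I : Set} {Λ : (I → R) → R} → Linear Λ → ∀ n f →
    Λ (λ i → sgn n (f i)) ≋ sgn n (Λ f)
  sgn-homo lin zero    f = refl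
  sgn-homo lin (suc n) f = trans (Linear.-‿homo lin _) (-‿cong (sgn-homo lin n f))

  sgn-op : ∀ {Φ} → LinearOp Φ → ∀ n f → Φ (sgn n f) ≋ sgn n (Φ f)
  sgn-op lin n f = sgn-homo lin n (λ _ → f)

  sgn-linear : ∀ n → LinearOp (sgn n)
  sgn-linear zero    = id-linear
  sgn-linear (suc n) = comp-linear -‿linear (λ _ → sgn-linear n)

  ∑<-linear : ∀ n → Linear (∑< n)
  ∑<-linear zero = record
    { cong = λ _ → refl ; +-homo = λ _ _ → sym (+-identityʳ 0#)
    ; τ-homo = λ _ → sym (Op.0-homo {τ} τ-linear) }
  ∑<-linear (suc n) = record
    { cong   = λ e → +-cong (e 0) (Linear.cong (∑<-linear n) (e ∘ suc))
    ; +-homo = λ f g → trans (+-congˡ (Linear.+-homo (∑<-linear n) _ _))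
        (solve 4 (λ a b c d → (a :+ b) :+ (c :+ d) := (a :+ c) :+ (b :+ d)) refl _ _ _ _)
    ; τ-homo = λ f → trans (+-congˡ (Linear.τ-homo (∑<-linear n) _)) (sym (τ-+ _ _))
    }

  ∑<-homo : ∀ {I : Set} {Λ : (I → R) → R} → Linear Λ → ∀ n (f : ℕ → I → R) →
    Λ (λ i → ∑< n (λ j → f j i)) ≋ ∑< n (λ j → Λ (f j))
  ∑<-homo lin zero    f = Linear.0-homo lin
  ∑<-homo lin (suc n) f =
    trans (Linear.+-homo lin _ _) (+-congˡ (∑<-homo lin n (f ∘ suc)))

  -- ∑_{i ≤ n} (-1)ⁱ e (j + i) (n − i)
  alternating : (ℕ → ℕ → R) → ℕ → ℕ → R
  alternating e j zero    = e j zero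
  alternating e j (suc n) = e j (suc n) - alternating e (suc j) n

  module _ (α β : R) where

    private
      e : ℕ → ℕ → R
      e j n = Z (suc j) α * Zᵗ (suc n) β

      -- The part of `e j n` whose last letter comes from the α factor. For a column of length at
      -- least 2, removing its last x leaves the product with j lowered by one; this makes
      -- neighbouring summands cancel.
      left : ℕ → ℕ → R
      left zero    n = op y (α * Zᵗ (suc n) β)
      left (suc j) n = op x (e j n)

      split : ∀ u v f g h → op u f * op v (g + τ h) ≋
        op u (f * op v (g + τ h)) + (op v (op u f * g) + τ (op v (op u f * h)))
      split u v f g h = trans (op-*-op u v _ _) (+-congˡ
        (trans (op-cong v (distribˡ _ _ _)) (trans (op-+ v _ _)
        (+-congˡ (trans (op-cong v (Op.τ-homo {op u f *_} (*-linear (op u f)) h)) (op-τ v _))))))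

      Zᵗ-suc′ : ∀ n → Zᵗ (suc (suc n)) β ≋ op x (Zᵗ (suc n) β + τ (Zᵗ (suc (suc n)) β))
      Zᵗ-suc′ n = trans (Zᵗ-suc n β) (sym (trans (op-+ x _ _) (+-congˡ (op-τ x _))))

      lastLetter : ℕ → Letter
      lastLetter zero    = y
      lastLetter (suc _) = x
      init : ℕ → R
      init zero    = α
      init (suc j) = Z (suc j) α

      left-op : ∀ j n → left j n ≋ op (lastLetter j) (init j * Zᵗ (suc n) β)
      left-op zero    n = refl
      left-op (suc j) n = refl

      Z-op : ∀ j → Z (suc j) α ≋ op (lastLetter j) (init j)
      Z-op zero    = refl
      Z-op (suc j) = refl

      -- The summands record the origin of the last letter: the α factor, or an x of the β factor
      -- which by Pascal's rule either lowers n or brings a factor t.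
      e-suc : ∀ j n → e j (suc n) ≋ left j (suc n) + op x (e j n) + τ (op x (e j (suc n)))
      e-suc j n = begin
        Z (suc j) α * Zᵗ (suc (suc n)) β
          ≈⟨ *-cong (Z-op j) (Zᵗ-suc′ n) ⟩
        op (lastLetter j) (init j) * op x (Zᵗ (suc n) β + τ (Zᵗ (suc (suc n)) β))
          ≈⟨ split (lastLetter j) x _ _ _ ⟩
        op (lastLetter j) (init j * op x (Zᵗ (suc n) β + τ (Zᵗ (suc (suc n)) β))) +
          (op x (op (lastLetter j) (init j) * Zᵗ (suc n) β) +
           τ (op x (op (lastLetter j) (init j) * Zᵗ (suc (suc n)) β)))
          ≈⟨ +-cong (trans (op-cong (lastLetter j) (*-congˡ (sym (Zᵗ-suc′ n)))) (sym (left-op j (suc n))))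
               (+-cong (op-cong x (*-congʳ (sym (Z-op j))))
                 (τ-cong (op-cong x (*-congʳ (sym (Z-op j)))))) ⟩
        left j (suc n) + (op x (e j n) + τ (op x (e j (suc n))))
          ≈⟨ +-assoc _ _ _ ⟨
        left j (suc n) + op x (e j n) + τ (op x (e j (suc n))) ∎

      e-zero : ∀ j → e j 0 ≋ left j 0 + op y (Z (suc j) α * β) + τ (op x (e j 0))
      e-zero j = begin
        Z (suc j) α * Zᵗ 1 β
          ≈⟨ *-cong (Z-op j) (Zᵗ-1 β) ⟩
        z * (op y β + τ (op x g))
          ≈⟨ trans (distribˡ _ _ _) (+-congˡ (Op.τ-homo {z *_} (*-linear z) _)) ⟩
        z * op y β + τ (z * op x g)
          ≈⟨ +-cong (op-*-op (lastLetter j) y _ _)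
               (trans (τ-cong (op-*-op (lastLetter j) x _ _)) (τ-+ _ _)) ⟩
        (op (lastLetter j) (init j * op y β) + op y (z * β)) +
          (τ (op (lastLetter j) (init j * op x g)) + τ (op x (z * g)))
          ≈⟨ solve 4 (λ a b c d → (a :+ b) :+ (c :+ d) := (a :+ c) :+ b :+ d) refl _ _ _ _ ⟩
        (op (lastLetter j) (init j * op y β) + τ (op (lastLetter j) (init j * op x g))) + op y (z * β) + τ (op x (z * g))
          ≈⟨ +-cong (+-cong assemble (op-cong y (*-congʳ (sym (Z-op j)))))
               (τ-cong (op-cong x (*-congʳ (sym (Z-op j))))) ⟩
        left j 0 + op y (Z (suc j) α * β) + τ (op x (e j 0)) ∎
        where
        z = op (lastLetter j) (init j)
        g = Zᵗ 1 β

        assemble : op (lastLetter j) (init j * op y β) + τ (op (lastLetter j) (init j * op x g)) ≋ left j 0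
        assemble = begin
          op (lastLetter j) (init j * op y β) + τ (op (lastLetter j) (init j * op x g))
            ≈⟨ +-congˡ (op-τ (lastLetter j) _) ⟨
          op (lastLetter j) (init j * op y β) + op (lastLetter j) (τ (init j * op x g))
            ≈⟨ op-+ (lastLetter j) _ _ ⟨
          op (lastLetter j) (init j * op y β + τ (init j * op x g))
            ≈⟨ op-cong (lastLetter j) (+-congˡ (Op.τ-homo {init j *_} (*-linear (init j)) _)) ⟨
          op (lastLetter j) (init j * op y β + init j * τ (op x g))
            ≈⟨ op-cong (lastLetter j) (trans (*-congˡ (Zᵗ-1 β)) (distribˡ _ _ _)) ⟨
          op (lastLetter j) (init j * g)
            ≈⟨ left-op j 0 ⟨
          left j 0 ∎

      -- The summand `op x (e j n)` of `e-suc` is exactly `left (suc j) n`, the head of the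
      -- alternating sum that is subtracted. Only the two ends of the telescope and a multiple of t
      -- survive.
      alternating-fixpoint : ∀ j n → alternating e j n ≋
        left j n + sgn n (op y (Z (suc (j ℕ.+ n)) α * β)) + τ (op x (alternating e j n))
      alternating-fixpoint j zero    rewrite ℕ.+-identityʳ j = e-zero j
      alternating-fixpoint j (suc n) = begin
        e j (suc n) - alternating e (suc j) n
          ≈⟨ +-cong (e-suc j n) (-‿cong (alternating-fixpoint (suc j) n)) ⟩
        (left j (suc n) + op x (e j n) + τ (op x (e j (suc n)))) -
          (op x (e j n) + sgn n (op y (Z (suc (suc j ℕ.+ n)) α * β)) + τ (op x (alternating e (suc j) n)))
          ≈⟨ solve 5 (λ a b c d f → (a :+ b :+ c) :- (b :+ d :+ f) := a :+ :- d :+ (c :- f)) refl _ _ _ _ _ ⟩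
        left j (suc n) - sgn n (op y (Z (suc (suc j ℕ.+ n)) α * β)) +
          (τ (op x (e j (suc n))) - τ (op x (alternating e (suc j) n)))
          ≈⟨ +-cong (+-congˡ (-‿cong (sgn-cong n (op-cong y (*-congʳ
               (reflexive≡ (≡.cong (λ i → Z (suc i) α) (≡.sym (ℕ.+-suc j n)))))))))
               (sym (trans (τ-cong (Op.-homo {op x} (op-linear x) _ _)) (Op.-homo {τ} τ-linear _ _))) ⟩
        left j (suc n) + sgn (suc n) (op y (Z (suc (j ℕ.+ suc n)) α * β)) +
          τ (op x (alternating e j (suc n))) ∎

    -- At j = 0 both ends of the telescope have last letter y, so the fixpoint equation is the one
    -- that characterises `Zᵗ 1`.
    alternating-product : ∀ n → alternating (λ j n → Z (suc j) α * Zᵗ (suc n) β) 0 n ≋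
      Zᵗ 1 (α * Zᵗ (suc n) β) + sgn n (Zᵗ 1 (Z (suc n) α * β))
    alternating-product n = trans
      (Zᵗ-1-unique (α * Zᵗ (suc n) β + sgn n (Z (suc n) α * β)) _
        (trans (alternating-fixpoint 0 n) (+-congʳ (sym (trans (op-+ y _ _)
          (+-congˡ (sgn-op {op y} (op-linear y) n _)))))))
      (trans (Op.+-homo {Zᵗ 1} (Zᵗ-linear 1) _ _) (+-congˡ (sgn-op {Zᵗ 1} (Zᵗ-linear 1) n _)))

  minus-linear : ∀ {I : Set} {Λ M : (I → R) → R} →
    Linear Λ → Linear M → Linear (λ f → Λ f - M f)
  minus-linear l m = record
    { cong   = λ e → +-cong (Linear.cong l e) (-‿cong (Linear.cong m e))
    ; +-homo = λ f g → trans (+-cong (Linear.+-homo l f g) (-‿cong (Linear.+-homo m f g)))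
        (solve 4 (λ a b c d → (a :+ b) :- (c :+ d) := (a :- c) :+ (b :- d)) refl _ _ _ _)
    ; τ-homo = λ f → trans (+-cong (Linear.τ-homo l f) (-‿cong (Linear.τ-homo m f)))
        (sym (Op.-homo {τ} τ-linear _ _))
    }

  *-linearʳ : ∀ c → LinearOp (_* c)
  *-linearʳ c = record
    { cong   = λ e → *-congʳ (e tt)
    ; +-homo = λ f g → distribʳ c (f tt) (g tt)
    ; τ-homo = λ f → sym (τ-* (f tt) c)
    }

  -- Cutting the links of zigzags and of two-armed trees.

  Ops : Set
  Ops = List (R → R)

  -- Every way of cutting the operators into A′ ++ A″ contributes
  -- (-1)^|A′| Φ (A′ applied to 1) times the same sum for A″.
  G : (R → R) → Ops → R
  G Φ []      = Φ 1#
  G Φ (P ∷ A) = Φ 1# * G P A - G (Φ ∘ P) A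

  G-linear : ∀ A → Linear {R} (λ Φ → G Φ A)
  G-linear []      = eval-linear 1#
  G-linear (P ∷ A) = minus-linear
    (comp-linear (*-linearʳ (G P A)) (λ _ → eval-linear 1#))
    (comp-linear (G-linear A) (λ f → eval-linear (P f)))

  G-cong : ∀ A {Φ Φ′} → (∀ f → Φ f ≋ Φ′ f) → G Φ A ≋ G Φ′ A
  G-cong A = Linear.cong (G-linear A)

  G-* : ∀ c Φ A → G (λ f → c * Φ f) A ≋ c * G Φ A
  G-* c Φ []      = refl
  G-* c Φ (P ∷ A) = trans (+-congˡ (-‿cong (G-* c (Φ ∘ P) A)))
    (solve 4 (λ c a b d → c :* a :* b :- c :* d := c :* (a :* b :- d)) refl _ _ _ _)

  -- Ψ f g stands for a root carrying f and g, from which one arm leaves on each side. Cutting the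
  -- root link of the first arm detaches that arm as a zigzag of its own or stacks its first column
  -- onto f; the second arm is treated after the first.
  G₂ : (R → R → R) → Ops → Ops → R
  G₂ Ψ []      B = G (Ψ 1#) B
  G₂ Ψ (P ∷ A) B = G P A * G (Ψ 1#) B - G₂ (Ψ ∘ P) A B

  G₂-linear : ∀ A B → Linear {R × R} (λ Ψ → G₂ (λ f g → Ψ (f , g)) A B)
  G₂-linear []      B = comp-linear (G-linear B) (λ f → eval-linear (1# , f))
  G₂-linear (P ∷ A) B = minus-linear
    (comp-linear (*-linear (G P A)) (λ _ → comp-linear (G-linear B) (λ f → eval-linear (1# , f))))
    (comp-linear (G₂-linear A B) (λ (f , g) → eval-linear (P f , g)))

  G₂-cong : ∀ A B {Ψ Ψ′} → (∀ f g → Ψ f g ≋ Ψ′ f g) → G₂ Ψ A B ≋ G₂ Ψ′ A B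
  G₂-cong A B e = Linear.cong (G₂-linear A B) (λ (f , g) → e f g)

  -- A root that is a product relates nothing on one side to the other, so the tree falls apart into
  -- two zigzags.
  G₂-product : ∀ Φ Ψ A B → G₂ (λ f g → Φ f * Ψ g) A B ≋ G Φ A * G Ψ B
  G₂-product Φ Ψ []      B = G-* (Φ 1#) Ψ B
  G₂-product Φ Ψ (P ∷ A) B = trans
    (+-cong (*-congˡ (G-* (Φ 1#) Ψ B)) (-‿cong (G₂-product (Φ ∘ P) Ψ A B)))
    (solve 4 (λ a b c d → a :* (b :* c) :- d :* c := (b :* a :- d) :* c) refl _ _ _ _)

  -- The order in which the arms are cut does not matter. This mirror image of the defining
  -- recursion unfolds trees whose second arm has been extended.
  G₂-∷ʳ : ∀ Ψ A Q B →
    G₂ Ψ A (Q ∷ B) ≋ G (λ f → Ψ f 1#) A * G Q B - G₂ (λ f g → Ψ f (Q g)) A B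
  G₂-∷ʳ Ψ []      Q B = refl
  G₂-∷ʳ Ψ (P ∷ A) Q B = trans
    (+-congˡ (-‿cong (G₂-∷ʳ (Ψ ∘ P) A Q B)))
    (solve 6 (λ a b c d e h →
       a :* (b :* c :- d) :- (e :* c :- h) := (b :* a :- e) :* c :- (a :* d :- h))
     refl _ _ _ _ _ _)

  -- The sum over j of tʲ times the 2-poset with a chain y x^j from whose
  -- bottom element two zigzag arms leave, one for each list.
  Tree : Ops → Ops → R
  Tree = G₂ (λ f g → Zᵗ 1 (f * g))

  Zᵗ-cong : ∀ k {f g} → f ≋ g → Zᵗ k f ≋ Zᵗ k g
  Zᵗ-cong k = Op.cong {Zᵗ k} (Zᵗ-linear k)

  Tree-∷ˡ : ∀ P A B → Tree (P ∷ A) B ≋ G P A * G (Zᵗ 1) B - G₂ (λ f g → Zᵗ 1 (P f * g)) A B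
  Tree-∷ˡ P A B = +-congʳ (*-congˡ (G-cong B (λ g → Zᵗ-cong 1 (*-identityˡ g))))

  Tree-∷ʳ : ∀ A Q B → Tree A (Q ∷ B) ≋ G (Zᵗ 1) A * G Q B - G₂ (λ f g → Zᵗ 1 (f * Q g)) A B
  Tree-∷ʳ A Q B = trans (G₂-∷ʳ _ A Q B)
    (+-congʳ (*-congʳ (G-cong A (λ g → Zᵗ-cong 1 (*-identityʳ g)))))

  Tree-[]ʳ : ∀ A → Tree A [] ≋ G (Zᵗ 1) A
  Tree-[]ʳ []      = Zᵗ-cong 1 (*-identityˡ 1#)
  Tree-[]ʳ (P ∷ A) = trans (Tree-∷ˡ P A []) (trans (+-congˡ (-‿cong
      (trans (G₂-[]ʳ _ A) (G-cong A (λ f → Zᵗ-cong 1 (*-identityʳ (P f)))))))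
    (+-congʳ (*-comm _ _)))
    where
    G₂-[]ʳ : ∀ Ψ A → G₂ Ψ A [] ≋ G (λ f → Ψ f 1#) A
    G₂-[]ʳ Ψ []      = refl
    G₂-[]ʳ Ψ (P ∷ A) = +-cong (*-comm _ _) (-‿cong (G₂-[]ʳ (Ψ ∘ P) A))

  Tree-[]ˡ : ∀ B → Tree [] B ≋ G (Zᵗ 1) B
  Tree-[]ˡ B = G-cong B (λ g → Zᵗ-cong 1 (*-identityˡ g))

  alternating-shift : ∀ e j n → alternating e (suc j) n ≡ alternating (e ∘ suc) j n
  alternating-shift e j zero    = ≡.refl
  alternating-shift e j (suc n) = ≡.cong (λ z → e (suc j) (suc n) - z) (alternating-shift e (suc j) n)

  -- The factor (-1)^n makes the last summand positive. It is split off because the cyclic sums stop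
  -- one step earlier.
  sgn-alternating : ∀ e n → sgn n (alternating e 0 n) ≋
    ∑< n (λ j → sgn (n ℕ.∸ j) (e j (n ℕ.∸ j))) + e n 0
  sgn-alternating e zero    = sym (+-identityˡ _)
  sgn-alternating e (suc n) = begin
    sgn (suc n) (e 0 (suc n) - alternating e 1 n)
      ≈⟨ Op.-homo {sgn (suc n)} (sgn-linear (suc n)) _ _ ⟩
    sgn (suc n) (e 0 (suc n)) - - sgn n (alternating e 1 n)
      ≈⟨ +-congˡ (trans (-‿involutive _) (trans
           (sgn-cong n (reflexive≡ (alternating-shift e 0 n))) (sgn-alternating (e ∘ suc) n))) ⟩
    sgn (suc n) (e 0 (suc n)) + (∑< n (λ j → sgn (n ℕ.∸ j) (e (suc j) (n ℕ.∸ j))) + e (suc n) 0)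
      ≈⟨ +-assoc _ _ _ ⟨
    sgn (suc n) (e 0 (suc n)) + ∑< n (λ j → sgn (n ℕ.∸ j) (e (suc j) (n ℕ.∸ j))) + e (suc n) 0 ∎

  -- Linearity in the root and `G₂-product` replace the two words α and β of `alternating-product`
  -- by two zigzags hanging from the columns.
  G₂-alternating : ∀ A B j n →
    G₂ (λ f g → alternating (λ j n → Z (suc j) f * Zᵗ (suc n) g) j n) A B ≋
    alternating (λ j n → G (Z (suc j)) A * G (Zᵗ (suc n)) B) j n
  G₂-alternating A B j zero    = G₂-product (Z (suc j)) (Zᵗ 1) A B
  G₂-alternating A B j (suc n) = trans (Linear.-homo (G₂-linear A B) _ _)
    (+-cong (G₂-product (Z (suc j)) (Zᵗ (suc (suc n))) A B)
      (-‿cong (G₂-alternating A B (suc j) n)))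

  -- The sum lacks the term j = n of an alternating product. That term is the detached part of the
  -- first tree, and the subtracted product on the left is the detached part of the second tree. The
  -- stacked parts of the two trees are the two values given by `alternating-product`.
  tree-identity : ∀ n A B →
    ∑< n (λ j → sgn (n ℕ.∸ j) (G (Z (suc j)) A * G (Zᵗ (suc (n ℕ.∸ j))) B))
      - sgn n (G (Zᵗ 1) A * G (Zᵗ (suc n)) B)
    ≋ - (Tree (Z (suc n) ∷ A) B + sgn n (Tree A (Zᵗ (suc n) ∷ B)))
  tree-identity n A B = begin
    S - sgn n U
      ≈⟨ solve 3 (λ s u v → s :- u := ((s :+ v) :- u) :- v) refl S (sgn n U) V ⟩
    ((S + V) - sgn n U) - V
      ≈⟨ +-congʳ (+-congʳ (trans (sym (sgn-alternating _ n)) (sgn-cong n products))) ⟩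
    (sgn n (Q + sgn n P) - sgn n U) - V
      ≈⟨ +-congʳ (+-congʳ (trans (Op.+-homo {sgn n} (sgn-linear n) _ _) (+-congˡ (sgn-sgn n P)))) ⟩
    ((sgn n Q + P) - sgn n U) - V
      ≈⟨ solve 4 (λ q p u v → ((q :+ p) :- u) :- v := :- ((v :- p) :+ (u :- q))) refl _ _ _ _ ⟩
    - ((V - P) + (sgn n U - sgn n Q))
      ≈⟨ -‿cong (+-cong (Tree-∷ˡ _ A B) (trans (sgn-cong n (Tree-∷ʳ A _ B))
           (Op.-homo {sgn n} (sgn-linear n) _ _))) ⟨
    - (Tree (Z (suc n) ∷ A) B + sgn n (Tree A (Zᵗ (suc n) ∷ B))) ∎
    where
    S = ∑< n (λ j → sgn (n ℕ.∸ j) (G (Z (suc j)) A * G (Zᵗ (suc (n ℕ.∸ j))) B))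
    U = G (Zᵗ 1) A * G (Zᵗ (suc n)) B
    V = G (Z (suc n)) A * G (Zᵗ 1) B
    P = G₂ (λ f g → Zᵗ 1 (Z (suc n) f * g)) A B
    Q = G₂ (λ f g → Zᵗ 1 (f * Zᵗ (suc n) g)) A B

    sgn-sgn : ∀ n f → sgn n (sgn n f) ≋ f
    sgn-sgn zero    f = refl
    sgn-sgn (suc n) f = trans (-‿cong (Op.-‿homo {sgn n} (sgn-linear n) (sgn n f)))
      (trans (-‿involutive _) (sgn-sgn n f))

    products : alternating (λ j n → G (Z (suc j)) A * G (Zᵗ (suc n)) B) 0 n ≋ Q + sgn n P
    products = trans (sym (G₂-alternating A B 0 n)) (trans
      (G₂-cong A B (λ f g → alternating-product f g n))
      (trans (Linear.+-homo (G₂-linear A B) _ _) (+-congˡ (sgn-homo (G₂-linear A B) n _))))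

  -- Star elements and the simultaneous substitution of all entries.

  -- star ks is w⋆(ks); starᵗ ks is ∑ₗ ∏ⱼ C(kⱼ+lⱼ-1, lⱼ) t^lⱼ w⋆(ks + l), see E-star.
  star starᵗ : List ℕ → R
  star  []       = 1#
  star  (k ∷ ks) = G (Z k) (map Z ks)
  starᵗ []       = 1#
  starᵗ (k ∷ ks) = G (Zᵗ k) (map Zᵗ ks)

  -- The sum over l of ∏ C(k_j + l_j - 1, l_j) t^(l_1 + ⋯ + l_r) g(k + l), performed one entry at a
  -- time.
  E : List ℕ → (List ℕ → R) → R
  E []       g = g []
  E (k ∷ ks) g = L k (λ a → E ks (λ v → g (a ∷ v)))

  E-linear : ∀ ks → Linear (E ks)
  E-linear []       = eval-linear []
  E-linear (k ∷ ks) = comp-linear (L-linear k)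
    (λ a → comp-linear (E-linear ks) (λ v → eval-linear (a ∷ v)))

  E-cong : ∀ ks {f g} → (∀ v → f v ≋ g v) → E ks f ≋ E ks g
  E-cong ks = Linear.cong (E-linear ks)

  E-homo : ∀ {I : Set} {Λ : (I → R) → R} → Linear Λ → ∀ ks (f : List ℕ → I → R) →
    Λ (λ i → E ks (λ v → f v i)) ≋ E ks (λ v → Λ (f v))
  E-homo lin []       f = refl
  E-homo lin (k ∷ ks) f = trans (L-homo lin k (λ a i → E ks (λ v → f (a ∷ v) i)))
    (L-cong k (λ a → E-homo lin ks (λ v → f (a ∷ v))))

  E-++ : ∀ ks js g → E (ks ++ js) g ≋ E ks (λ v → E js (λ u → g (v ++ u)))
  E-++ []       js g = refl
  E-++ (k ∷ ks) js g = L-cong k (λ a → E-++ ks js (λ v → g (a ∷ v)))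

  L-E-comm : ∀ k ks (f : ℕ → List ℕ → R) →
    L k (λ a → E ks (λ v → f a v)) ≋ E ks (λ v → L k (λ a → f a v))
  L-E-comm k ks f = E-homo (L-linear k) ks (λ v a → f a v)

  E-∷ʳ : ∀ ks k g → E (ks ++ [ k ]) g ≋ L k (λ a → E ks (λ v → g (v ++ [ a ])))
  E-∷ʳ ks k g = trans (E-++ ks [ k ] g) (sym (L-E-comm k ks (λ a v → g (v ++ [ a ]))))

  -- Every `Z a` occurs linearly in each cut term, so the substitution can be carried out inside the
  -- operators. Φ has to be general because stacking replaces it by `Φ ∘ Z a`.
  E-G : ∀ {Φ} → LinearOp Φ → ∀ ks → E ks (λ v → G Φ (map Z v)) ≋ G Φ (map Zᵗ ks)
  E-G {Φ} lin []       = refl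
  E-G {Φ} lin (k ∷ ks) = begin
    L k (λ a → E ks (λ v → Φ 1# * G (Z a) (map Z v) - G (Φ ∘ Z a) (map Z v)))
      ≈⟨ L-cong k (λ a → trans (Linear.-homo (E-linear ks) _ _) (+-cong
           (trans (sym (E-homo {Λ = λ f → Φ 1# * f tt} (*-linear (Φ 1#)) ks (λ v _ → G (Z a) (map Z v))))
             (*-congˡ (E-G {Z a} (Z-linear a) ks)))
           (-‿cong (E-G {Φ ∘ Z a} (comp-linear lin (λ _ → Z-linear a)) ks)))) ⟩
    L k (λ a → Φ 1# * G (Z a) B - G (Φ ∘ Z a) B)
      ≈⟨ Linear.-homo (L-linear k) (λ a → Φ 1# * G (Z a) B) (λ a → G (Φ ∘ Z a) B) ⟩
    L k (λ a → Φ 1# * G (Z a) B) - L k (λ a → G (Φ ∘ Z a) B)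
      ≈⟨ +-cong (sym (L-op {Φ 1# *_} (*-linear (Φ 1#)) k (λ a → G (Z a) B)))
           (-‿cong (sym (L-homo (G-linear B) k (λ a f → Φ (Z a f))))) ⟩
    Φ 1# * L k (λ a → G (Z a) B) - G (λ f → L k (λ a → Φ (Z a f))) B
      ≈⟨ +-cong (*-congˡ (sym (L-homo (G-linear B) k Z)))
           (-‿cong (G-cong B (λ f → sym (L-op {Φ} lin k (λ a → Z a f))))) ⟩
    Φ 1# * G (Zᵗ k) B - G (Φ ∘ Zᵗ k) B ∎
    where B = map Zᵗ ks

  E-star : ∀ ks → E ks star ≋ starᵗ ks
  E-star []       = refl
  E-star (k ∷ ks) = trans (L-cong k (λ a → E-G {Z a} (Z-linear a) ks))
    (sym (L-homo (G-linear (map Zᵗ ks)) k Z))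

  -- Substitutions in different entries commute.
  E-reverse : ∀ ks g → E ks (λ v → g (reverse v)) ≋ E (reverse ks) g
  E-reverse []       g = refl
  E-reverse (k ∷ ks) g = begin
    L k (λ a → E ks (λ v → g (reverse (a ∷ v))))
      ≈⟨ L-cong k (λ a → E-cong ks (λ v → reflexive≡ (≡.cong g (List.unfold-reverse a v)))) ⟩
    L k (λ a → E ks (λ v → g (reverse v ++ [ a ])))
      ≈⟨ L-cong k (λ a → E-reverse ks (λ v → g (v ++ [ a ]))) ⟩
    L k (λ a → E (reverse ks) (λ v → g (v ++ [ a ])))
      ≈⟨ E-∷ʳ (reverse ks) k g ⟨
    E (reverse ks ++ [ k ]) g
      ≈⟨ reflexive≡ (≡.cong (λ js → E js g) (List.unfold-reverse k ks)) ⟨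
    E (reverse (k ∷ ks)) g ∎
    where import Data.List.Properties as List

  -- Vandermonde convolution and the collapse of the alternating tail.

  ∑<-cong-< : ∀ n {f g} → (∀ j → j ℕ.< n → f j ≋ g j) → ∑< n f ≋ ∑< n g
  ∑<-cong-< zero    e = refl
  ∑<-cong-< (suc n) e = +-cong (e 0 ℕ.z<s) (∑<-cong-< n (λ j j<n → e (suc j) (ℕ.s<s j<n)))

  antidiagonal : (ℕ → ℕ → R) → ℕ → R
  antidiagonal g zero    = g 0 0
  antidiagonal g (suc n) = g 0 (suc n) + antidiagonal (g ∘ suc) n

  antidiagonal-cong : ∀ {f g} → (∀ i j → f i j ≋ g i j) → ∀ n → antidiagonal f n ≋ antidiagonal g n
  antidiagonal-cong e zero    = e 0 0
  antidiagonal-cong e (suc n) = +-cong (e 0 (suc n)) (antidiagonal-cong (e ∘ suc) n)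

  antidiagonal-linear : ∀ n → Linear {ℕ × ℕ} (λ f → antidiagonal (λ i j → f (i , j)) n)
  antidiagonal-linear zero    = eval-linear (0 , 0)
  antidiagonal-linear (suc n) = record
    { cong   = λ e → +-cong (e _) (antidiagonal-cong (λ i j → e (suc i , j)) n)
    ; +-homo = λ f g → trans (+-congˡ (Linear.+-homo (antidiagonal-linear n) _ _))
        (solve 4 (λ a b c d → (a :+ b) :+ (c :+ d) := (a :+ c) :+ (b :+ d)) refl _ _ _ _)
    ; τ-homo = λ f → trans (+-congˡ (Linear.τ-homo (antidiagonal-linear n) _)) (sym (τ-+ _ _))
    }

  antidiagonal-last : ∀ g n →
    antidiagonal g (suc n) ≋ antidiagonal (λ i j → g i (suc j)) n + g (suc n) 0
  antidiagonal-last g zero    = refl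
  antidiagonal-last g (suc n) = trans (+-congˡ (antidiagonal-last (g ∘ suc) n)) (sym (+-assoc _ _ _))

  antidiagonal-∑< : ∀ g n → antidiagonal g n ≋ ∑< n (λ j → g j (n ℕ.∸ j)) + g n 0
  antidiagonal-∑< g zero    = sym (+-identityˡ _)
  antidiagonal-∑< g (suc n) = trans (+-congˡ (antidiagonal-∑< (g ∘ suc) n)) (sym (+-assoc _ _ _))

  antidiagonal-∑<′ : ∀ (h : ℕ → ℕ → R) n →
    antidiagonal (λ i j → h i (suc j)) n ≋ ∑< n (λ j → h j (suc n ℕ.∸ j)) + h n 1
  antidiagonal-∑<′ h zero    = sym (+-identityˡ _)
  antidiagonal-∑<′ h (suc n) = trans (+-congˡ (antidiagonal-∑<′ (h ∘ suc) n)) (sym (+-assoc _ _ _))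

  -- At g a b both sides have the same coefficient by ∑_j C(a-1, j) C(b-1, n-j) = C(a+b-2, n), where
  -- c = a + b - 1. The proof does not touch the binomials: splitting off b = 1 and applying
  -- Pascal's rule gives both sides one recurrence in n and t.
  vandermonde : ∀ n (g : ℕ → ℕ → R) →
    antidiagonal (λ i j → L (suc j) (λ a → L (suc i) (λ b → g a b))) n ≋
    L (suc n) (λ c → antidiagonal (λ i j → g (suc i) (suc j)) (pred c))
  vandermonde n g = go n g
    where
    D H rest : ℕ → (ℕ → ℕ → R) → R
    D n g = antidiagonal (λ i j → L (suc j) (λ a → L (suc i) (λ b → g a b))) n
    H n g = L (suc n) (λ c → antidiagonal (λ i j → g (suc i) (suc j)) (pred c))
    rest zero    g = 0#
    rest (suc n) g = D n (λ a → g a ∘ suc)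

    D-step : ∀ n g → D n g ≋
      (L (suc n) (λ a → g a 1) + rest n g) + τ (D n (λ a → g a ∘ suc))
    D-step zero g = begin
      L 1 (λ a → L 1 (λ b → g a b))
        ≈⟨ trans (L-cong 1 (λ a → L1-step (g a))) (Linear.+-homo (L-linear 1) (λ a → g a 1) _) ⟩
      L 1 (λ a → g a 1) + L 1 (λ a → τ (L 1 (g a ∘ suc)))
        ≈⟨ +-cong (sym (+-identityʳ _)) (Linear.τ-homo (L-linear 1) (λ a → L 1 (g a ∘ suc))) ⟩
      (L 1 (λ a → g a 1) + 0#) + τ (L 1 (λ a → L 1 (g a ∘ suc))) ∎
    D-step (suc n) g = begin
      L (suc (suc n)) (λ a → L 1 (g a)) +
        antidiagonal (λ i j → L (suc j) (λ a → L (suc (suc i)) (g a))) n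
        ≈⟨ +-cong
             (trans (L-cong (suc (suc n)) (λ a → L1-step (g a)))
               (trans (Linear.+-homo (L-linear (suc (suc n))) (λ a → g a 1) _)
                 (+-congˡ (Linear.τ-homo (L-linear (suc (suc n))) (λ a → L 1 (g a ∘ suc))))))
             (trans (antidiagonal-cong (λ i j → trans
                 (L-cong (suc j) (λ a → L-step i (g a)))
                 (trans (Linear.+-homo (L-linear (suc j)) (λ a → L (suc i) (g a ∘ suc)) _)
                   (+-congˡ (Linear.τ-homo (L-linear (suc j)) (λ a → L (suc (suc i)) (g a ∘ suc)))))) n)
               (trans (Linear.+-homo (antidiagonal-linear n) _ _)
                 (+-congˡ (Linear.τ-homo (antidiagonal-linear n) _)))) ⟩
      (p + τ q) + (r + τ s)
        ≈⟨ solve 4 (λ p q r s → (p :+ q) :+ (r :+ s) := (p :+ r) :+ (q :+ s)) refl p (τ q) r (τ s) ⟩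
      (p + r) + (τ q + τ s)
        ≈⟨ +-congˡ (τ-+ q s) ⟨
      (p + r) + τ (q + s) ∎
      where
      p = L (suc (suc n)) (λ a → g a 1)
      q = L (suc (suc n)) (λ a → L 1 (g a ∘ suc))
      r = D n (λ a → g a ∘ suc)
      s = antidiagonal (λ i j → L (suc j) (λ a → L (suc (suc i)) (g a ∘ suc))) n

    -- What remains of an antidiagonal once b = 1 is split off: nothing for c = 1, the antidiagonal
    -- of c - 1 beyond that. The value at c = 0 is a default.
    later : (ℕ → R) → ℕ → R
    later f zero          = 0#
    later f (suc zero)    = 0#
    later f (suc (suc c)) = f (suc c)

    H-split : ∀ n g → H n g ≋ L (suc n) (λ a → g a 1) +
      L (suc n) (later (λ c → antidiagonal (λ i j → g (suc i) (suc (suc j))) (pred c)))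
    H-split n g = trans (L-cong⁺ n {_} {λ c → g c 1 + later h c} split)
      (Linear.+-homo (L-linear (suc n)) (λ a → g a 1) (later h))
      where
      h : ℕ → R
      h c = antidiagonal (λ i j → g (suc i) (suc (suc j))) (pred c)
      split : ∀ c → antidiagonal (λ i j → g (suc i) (suc j)) c ≋ g (suc c) 1 + later h (suc c)
      split zero    = sym (+-identityʳ _)
      split (suc c) = trans (antidiagonal-last (λ i j → g (suc i) (suc j)) c) (+-comm _ _)

    later-suc : ∀ n f → L (suc n) (later f ∘ suc) ≋ L (suc n) f
    later-suc n f = L-cong⁺ n {later f ∘ suc} {f} (λ _ → refl)

    go : ∀ n g → D n g ≋ H n g
    H-step : ∀ n g → H n g ≋
      (L (suc n) (λ a → g a 1) + rest n g) + τ (H n (λ a → g a ∘ suc))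

    H-step zero g = trans (H-split 0 g)
      (+-cong (sym (+-identityʳ _)) (trans (L1-step (later _))
        (trans (+-identityˡ _) (τ-cong (later-suc 0 _)))))
    H-step (suc n) g = trans (H-split (suc n) g) (trans
      (+-congˡ (trans (L-step n (later _)) (+-cong
        (trans (later-suc n _) (sym (go n (λ a → g a ∘ suc)))) (τ-cong (later-suc (suc n) _)))))
      (sym (+-assoc _ _ _)))

    go n = coinduction (λ g a → g a ∘ suc) (λ g → L (suc n) (λ a → g a 1) + rest n g)
      (D n) (H n) (D-step n) (H-step n)

  𝕋-unique : ∀ (r g : ℕ → R) → (∀ j → g j ≋ r j + τ (g (suc j))) → g 0 ≋ 𝕋 r
  𝕋-unique r g e = coinduction
    {P = Σ (ℕ → R) λ r → Σ (ℕ → R) λ g → ∀ j → g j ≋ r j + τ (g (suc j))}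
    (λ (r , g , e) → r ∘ suc , g ∘ suc , e ∘ suc) (λ (r , _) → r 0)
    (λ (_ , g , _) → g 0) (λ (r , _) → 𝕋 r)
    (λ (_ , _ , e) → e 0) (λ (r , _) → 𝕋-step r) (r , g , e)

  -- The coefficient of t^m f(m+1) is ∑_j (-1)^j C(m, j), which vanishes unless m = 0.
  𝕋-sgn-L : ∀ f → 𝕋 (λ j → sgn j (L (suc j) f)) ≋ f 1
  𝕋-sgn-L f = sym (𝕋-unique _ tails step)
    where
    -- The remainder after the first j terms, divided by t^j. Its closed form comes from Pascal's
    -- rule: each term cancels half of the preceding remainder.
    tails : ℕ → R
    tails zero    = f 1
    tails (suc j) = sgn (suc j) (L (suc j) (f ∘ suc))

    cancel : ∀ a b → a + b + τ (- b) ≋ (a + b) - τ b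
    cancel a b = +-congˡ (Op.-‿homo {τ} τ-linear b)

    step : ∀ j → tails j ≋ sgn j (L (suc j) f) + τ (tails (suc j))
    step zero = begin
      f 1
        ≈⟨ solve 2 (λ a b → a := (a :+ b) :- b) refl (f 1) _ ⟩
      (f 1 + τ (L 1 (f ∘ suc))) - τ (L 1 (f ∘ suc))
        ≈⟨ +-cong (L1-step f) (Op.-‿homo {τ} τ-linear _) ⟨
      L 1 f + τ (- L 1 (f ∘ suc)) ∎
    step (suc j) = begin
      sgn s a
        ≈⟨ solve 2 (λ a b → a := (a :+ b) :- b) refl (sgn s a) (τ (sgn s b)) ⟩
      (sgn s a + τ (sgn s b)) - τ (sgn s b)
        ≈⟨ +-cong (+-congˡ (sym (sgn-op {τ} τ-linear s b))) (Op.-‿homo {τ} τ-linear _) ⟨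
      (sgn s a + sgn s (τ b)) + τ (- sgn s b)
        ≈⟨ +-congʳ (trans (sgn-cong s (L-step j f)) (Op.+-homo {sgn s} (sgn-linear s) _ _)) ⟨
      sgn s (L (suc (suc j)) f) + τ (sgn (suc s) b) ∎
      where
      s = suc j
      a = L (suc j) (f ∘ suc)
      b = L (suc (suc j)) (f ∘ suc)

  -- Adding the term j = n completes the antidiagonal required by `vandermonde`. The alternating
  -- tail collapses to the pairs with b = 1, which are exactly the ones that a cyclic sum omits, its
  -- last entry being at least 2.
  double-sum : ∀ n (g : ℕ → ℕ → R) →
    (∑< n (λ j → L (suc (n ℕ.∸ j)) (λ a → L (suc j) (g a)))
      - 𝕋 (λ j → sgn j (L (suc n) (λ a → L (suc j) (g a)))))
    + L 1 (λ a → L (suc n) (g a))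
    ≋ L (suc n) (λ c → ∑< (pred c) (λ j → g (suc j) (c ℕ.∸ j)))
  double-sum n g = begin
    (S - 𝕋 (λ j → sgn j (L (suc n) (λ a → L (suc j) (g a))))) + V
      ≈⟨ +-congʳ (+-congˡ (-‿cong collapse)) ⟩
    (S - U) + V
      ≈⟨ solve 3 (λ s w v → (s :- w) :+ v := (s :+ v) :- w) refl S U V ⟩
    (S + V) - U
      ≈⟨ +-congʳ boundary ⟨
    antidiagonal (λ i j → L (suc j) (λ a → L (suc i) (g a))) n - U
      ≈⟨ +-congʳ (vandermonde n g) ⟩
    L (suc n) (λ c → antidiagonal (λ i j → g (suc i) (suc j)) (pred c)) - U
      ≈⟨ Linear.-homo (L-linear (suc n)) (λ c → antidiagonal (λ i j → g (suc i) (suc j)) (pred c)) (λ a → g a 1) ⟨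
    L (suc n) (λ c → antidiagonal (λ i j → g (suc i) (suc j)) (pred c) - g c 1)
      ≈⟨ L-cong⁺ n {λ c → antidiagonal (λ i j → g (suc i) (suc j)) (pred c) - g c 1} peel ⟩
    L (suc n) (λ c → ∑< (pred c) (λ j → g (suc j) (c ℕ.∸ j))) ∎
    where
    S = ∑< n (λ j → L (suc (n ℕ.∸ j)) (λ a → L (suc j) (g a)))
    V = L 1 (λ a → L (suc n) (g a))
    U = L (suc n) (λ a → g a 1)

    boundary : antidiagonal (λ i j → L (suc j) (λ a → L (suc i) (g a))) n ≋ S + V
    boundary = antidiagonal-∑< (λ i j → L (suc j) (λ a → L (suc i) (g a))) n

    collapse : 𝕋 (λ j → sgn j (L (suc n) (λ a → L (suc j) (g a)))) ≋ U
    collapse = begin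
      𝕋 (λ j → sgn j (L (suc n) (λ a → L (suc j) (g a))))
        ≈⟨ 𝕋-cong (λ j → sgn-homo (L-linear (suc n)) j (λ a → L (suc j) (g a))) ⟨
      𝕋 (λ j → L (suc n) (λ a → sgn j (L (suc j) (g a))))
        ≈⟨ Linear.𝕋-homo (L-linear (suc n)) (λ j a → sgn j (L (suc j) (g a))) ⟨
      L (suc n) (λ a → 𝕋 (λ j → sgn j (L (suc j) (g a))))
        ≈⟨ L-cong (suc n) (λ a → 𝕋-sgn-L (g a)) ⟩
      U ∎

    peel : ∀ c → antidiagonal (λ i j → g (suc i) (suc j)) c - g (suc c) 1 ≋
      ∑< c (λ j → g (suc j) (suc c ℕ.∸ j))
    peel c = trans (+-congʳ (antidiagonal-∑<′ (g ∘ suc) c))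
      (solve 2 (λ a b → (a :+ b) :- b := a) refl _ _)

  opaque
    unfolding L

    -- In the dual sum the factor k of k w⋆(k+1) varies with l; absorption, (n+1) C(n+1+l, l) =
    -- (n+1+l) C(n+l, l), makes it constant again at the price of raising the substituted entry by
    -- one.
    L-∙ : ∀ n f → L (suc n) (λ a → a ∙ f (suc a)) ≋ suc n ∙ L (suc (suc n)) f
    L-∙ n f = trans (𝕋-cong (λ l → begin
        ((n ℕ.+ l) C l) ∙ ((suc n ℕ.+ l) ∙ f (suc (suc n ℕ.+ l)))
          ≈⟨ ×-assocˡ _ ((n ℕ.+ l) C l) (suc n ℕ.+ l) ⟩
        (((n ℕ.+ l) C l) ℕ.* (suc n ℕ.+ l)) ∙ f (suc (suc n ℕ.+ l))
          ≈⟨ ×-congˡ (≡.trans (ℕ.*-comm ((n ℕ.+ l) C l) _) (≡.sym (absorption n l))) ⟩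
        (suc n ℕ.* ((suc n ℕ.+ l) C l)) ∙ f (suc (suc n ℕ.+ l))
          ≈⟨ ×-assocˡ _ (suc n) ((suc n ℕ.+ l) C l) ⟨
        suc n ∙ (((suc n ℕ.+ l) C l) ∙ f (suc (suc n ℕ.+ l))) ∎))
      (Linear.∙-homo 𝕋-linear (suc n) _)

  -- The product of the series (1 - tx)^(-k_i) is (1 - tx)^(-k): a function of the weight sees only
  -- the total shift, and `L-L` merges the entries one by one.
  E-wt : ∀ k ks → All NonZero (k ∷ ks) → ∀ f → E (k ∷ ks) (λ v → f (wt v)) ≋ L (wt (k ∷ ks)) f
  E-wt k       []       _                 f = trans (L-cong k (λ a → reflexive≡ (≡.cong f (ℕ.+-identityʳ a))))
    (reflexive≡ (≡.cong (λ k → L k f) (≡.sym (ℕ.+-identityʳ k))))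
  E-wt (suc m) (suc n ∷ ks) (_ ∷ pos@(_ ∷ _)) f = trans
    (L-cong (suc m) (λ a → E-wt (suc n) ks pos (λ b → f (a ℕ.+ b))))
    (L-L m (n ℕ.+ wt ks) f)

  -- Sums over marked entries, rotations and splittings of an index.

  -- Holes ks φ sums φ p a q over all ways of writing ks = p ++ a ∷ q.
  Holes : List ℕ → (List ℕ → ℕ → List ℕ → R) → R
  Holes []       φ = 0#
  Holes (a ∷ q) φ = φ [] a q + Holes q (λ p → φ (a ∷ p))

  Holes-cong : ∀ ks {φ ψ} → (∀ p a q → φ p a q ≋ ψ p a q) → Holes ks φ ≋ Holes ks ψ
  Holes-cong []       e = refl
  Holes-cong (a ∷ ks) e = +-cong (e [] a ks) (Holes-cong ks (λ p → e (a ∷ p)))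

  Holes-linear : ∀ ks → Linear {List ℕ × ℕ × List ℕ} (λ φ → Holes ks (λ p a q → φ (p , a , q)))
  Holes-linear [] = record
    { cong = λ _ → refl ; +-homo = λ _ _ → sym (+-identityʳ 0#)
    ; τ-homo = λ _ → sym (Op.0-homo {τ} τ-linear) }
  Holes-linear (a ∷ ks) = record
    { cong   = λ e → Holes-cong (a ∷ ks) (λ p a q → e (p , a , q))
    ; +-homo = λ f g → trans (+-congˡ (Linear.+-homo (Holes-linear ks) _ _))
        (solve 4 (λ a b c d → (a :+ b) :+ (c :+ d) := (a :+ c) :+ (b :+ d)) refl _ _ _ _)
    ; τ-homo = λ f → trans (+-congˡ (Linear.τ-homo (Holes-linear ks) _)) (sym (τ-+ _ _))
    }

  Holes-homo : ∀ {I : Set} {Λ : (I → R) → R} → Linear Λ → ∀ ks (φ : I → List ℕ → ℕ → List ℕ → R) →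
    Λ (λ i → Holes ks (φ i)) ≋ Holes ks (λ p a q → Λ (λ i → φ i p a q))
  Holes-homo lin []       φ = Linear.0-homo lin
  Holes-homo lin (a ∷ ks) φ = trans (Linear.+-homo lin _ _)
    (+-congˡ (Holes-homo lin ks (λ i p → φ i (a ∷ p))))

  Holes-∷ʳ : ∀ ks b φ →
    Holes (ks ++ [ b ]) φ ≋ Holes ks (λ p a q → φ p a (q ++ [ b ])) + φ ks b []
  Holes-∷ʳ []       b φ = +-comm _ _
  Holes-∷ʳ (a ∷ ks) b φ = trans (+-congˡ (Holes-∷ʳ ks b (λ p → φ (a ∷ p)))) (sym (+-assoc _ _ _))

  Holes-reverse : ∀ ks φ →
    Holes (reverse ks) φ ≋ Holes ks (λ p a q → φ (reverse q) a (reverse p))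
  Holes-reverse []       φ = refl
  Holes-reverse (a ∷ ks) φ = begin
    Holes (reverse (a ∷ ks)) φ
      ≈⟨ reflexive≡ (≡.cong (λ js → Holes js φ) (List.unfold-reverse a ks)) ⟩
    Holes (reverse ks ++ [ a ]) φ
      ≈⟨ Holes-∷ʳ (reverse ks) a φ ⟩
    Holes (reverse ks) (λ p b q → φ p b (q ++ [ a ])) + φ (reverse ks) a []
      ≈⟨ +-congʳ (Holes-reverse ks _) ⟩
    Holes ks (λ p b q → φ (reverse q) b (reverse p ++ [ a ])) + φ (reverse ks) a []
      ≈⟨ +-congʳ (Holes-cong ks (λ p b q → reflexive≡ (≡.cong (φ (reverse q) b) (≡.sym (List.unfold-reverse a p))))) ⟩
    Holes ks (λ p b q → φ (reverse q) b (reverse (a ∷ p))) + φ (reverse ks) a []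
      ≈⟨ +-comm _ _ ⟩
    Holes (a ∷ ks) (λ p a q → φ (reverse q) a (reverse p)) ∎

  E-Holes : ∀ ks φ → E ks (λ v → Holes v φ) ≋
    Holes ks (λ p k q → E p (λ p′ → L k (λ a → E q (λ q′ → φ p′ a q′))))
  E-Holes []       φ = refl
  E-Holes (k ∷ ks) φ = begin
    L k (λ a → E ks (λ v → φ [] a v + Holes v (λ p → φ (a ∷ p))))
      ≈⟨ L-cong k (λ a → trans (Linear.+-homo (E-linear ks) _ _) (+-congˡ (E-Holes ks (λ p → φ (a ∷ p))))) ⟩
    L k (λ a → E ks (φ [] a) + Holes ks (λ p j q → E p (λ p′ → L j (λ b → E q (φ (a ∷ p′) b)))))
      ≈⟨ Linear.+-homo (L-linear k) (λ a → E ks (φ [] a)) _ ⟩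
    L k (λ a → E ks (φ [] a)) +
      L k (λ a → Holes ks (λ p j q → E p (λ p′ → L j (λ b → E q (φ (a ∷ p′) b)))))
      ≈⟨ +-congˡ (Holes-homo (L-linear k) ks (λ a p j q → E p (λ p′ → L j (λ b → E q (φ (a ∷ p′) b))))) ⟩
    Holes (k ∷ ks) (λ p k q → E p (λ p′ → L k (λ a → E q (λ q′ → φ p′ a q′)))) ∎

  -- The two arguments are consecutive rotations of ks, so the sum telescopes, and a full turn
  -- returns to ks. In the induction, s collects the entries already rotated past.
  Holes-rotations : ∀ (f : List ℕ → R) ks →
    Holes ks (λ p a q → f (a ∷ q ++ p) - f (q ++ p ++ [ a ])) ≋ 0#
  Holes-rotations f ks = begin
    Holes ks (λ p a q → f (a ∷ q ++ p) - f (q ++ p ++ [ a ]))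
      ≈⟨ go [] ks ⟩
    f (ks ++ []) - f ks
      ≈⟨ +-congʳ (reflexive≡ (≡.cong f (List.++-identityʳ ks))) ⟩
    f ks - f ks
      ≈⟨ -‿inverseʳ _ ⟩
    0# ∎
    where
    go : ∀ s ks → Holes ks (λ p a q → f (a ∷ q ++ s ++ p) - f (q ++ s ++ p ++ [ a ])) ≋
      f (ks ++ s) - f (s ++ ks)
    go s []       = sym (trans (+-congˡ (-‿cong (reflexive≡ (≡.cong f (List.++-identityʳ s))))) (-‿inverseʳ _))
    go s (a ∷ ks) = begin
      (f (a ∷ ks ++ s ++ []) - f (ks ++ s ++ [ a ])) +
        Holes ks (λ p b q → f (b ∷ q ++ s ++ a ∷ p) - f (q ++ s ++ a ∷ p ++ [ b ]))
        ≈⟨ +-cong (+-congʳ (reflexive≡ (≡.cong (λ u → f (a ∷ ks ++ u)) (List.++-identityʳ s))))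
             (Holes-cong ks (λ p b q → +-cong
               (reflexive≡ (≡.cong (λ u → f (b ∷ q ++ u)) (≡.sym (List.∷ʳ-++ s a p))))
               (-‿cong (reflexive≡ (≡.cong (λ u → f (q ++ u)) (≡.sym (List.∷ʳ-++ s a (p ++ [ b ])))))))) ⟩
      (f (a ∷ ks ++ s) - f (ks ++ s ++ [ a ])) +
        Holes ks (λ p b q → f (b ∷ q ++ (s ++ [ a ]) ++ p) - f (q ++ (s ++ [ a ]) ++ p ++ [ b ]))
        ≈⟨ +-congˡ (go (s ++ [ a ]) ks) ⟩
      (f (a ∷ ks ++ s) - f (ks ++ s ++ [ a ])) + (f (ks ++ s ++ [ a ]) - f ((s ++ [ a ]) ++ ks))
        ≈⟨ solve 3 (λ a b c → (a :- b) :+ (b :- c) := a :- c) refl _ _ _ ⟩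
      f (a ∷ ks ++ s) - f ((s ++ [ a ]) ++ ks)
        ≈⟨ +-congˡ (-‿cong (reflexive≡ (≡.cong f (List.∷ʳ-++ s a ks)))) ⟩
      f (a ∷ ks ++ s) - f (s ++ a ∷ ks) ∎

  Splits : List ℕ → (List ℕ → List ℕ → R) → R
  Splits []       φ = φ [] []
  Splits (k ∷ ks) φ = φ [] (k ∷ ks) + Splits ks (λ p q → φ (k ∷ p) q)

  Splits-linear : ∀ ks → Linear {List ℕ × List ℕ} (λ φ → Splits ks (λ p q → φ (p , q)))
  Splits-linear [] = eval-linear ([] , [])
  Splits-linear (k ∷ ks) = record
    { cong   = λ e → +-cong (e _) (Linear.cong (Splits-linear ks) (λ (p , q) → e (k ∷ p , q)))
    ; +-homo = λ f g → trans (+-congˡ (Linear.+-homo (Splits-linear ks) _ _))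
        (solve 4 (λ a b c d → (a :+ b) :+ (c :+ d) := (a :+ c) :+ (b :+ d)) refl _ _ _ _)
    ; τ-homo = λ f → trans (+-congˡ (Linear.τ-homo (Splits-linear ks) _)) (sym (τ-+ _ _))
    }

  Splits-cong : ∀ ks {φ ψ} → (∀ p q → φ p q ≋ ψ p q) → Splits ks φ ≋ Splits ks ψ
  Splits-cong ks e = Linear.cong (Splits-linear ks) (λ (p , q) → e p q)

  Splits-homo : ∀ {I : Set} {Λ : (I → R) → R} → Linear Λ → ∀ ks (φ : I → List ℕ → List ℕ → R) →
    Λ (λ i → Splits ks (φ i)) ≋ Splits ks (λ p q → Λ (λ i → φ i p q))
  Splits-homo lin []       φ = refl
  Splits-homo lin (k ∷ ks) φ = trans (Linear.+-homo lin _ _)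
    (+-congˡ (Splits-homo lin ks (λ i p → φ i (k ∷ p))))

  Splits-∷ʳ : ∀ ks b φ →
    Splits (ks ++ [ b ]) φ ≋ Splits ks (λ p q → φ p (q ++ [ b ])) + φ (ks ++ [ b ]) []
  Splits-∷ʳ []       b φ = refl
  Splits-∷ʳ (k ∷ ks) b φ = trans (+-congˡ (Splits-∷ʳ ks b (λ p → φ (k ∷ p)))) (sym (+-assoc _ _ _))

  -- The cyclic sum formula in the abstract algebra.

  starŜ : List ℕ → R
  starŜ ks = Splits ks (λ p q → sgn (wt q) (star p * starᵗ (reverse q)))

  cuts : (List ℕ → R) → ℕ → List ℕ → R
  cuts f m c = ∑< (pred m) (λ j → f (suc j ∷ c ++ [ m ℕ.∸ j ]))

  cyclic cyclicŜ : List ℕ → R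
  cyclic  ks = Holes ks (λ p m q → cuts star m (q ++ p)) - wt ks ∙ star [ suc (wt ks) ]
  cyclicŜ ks =
    Holes ks (λ p m q → cuts starŜ m (q ++ p) - 𝕋 (λ j → starŜ (suc j ∷ q ++ p ++ [ m ])))
      - wt ks ∙ starŜ [ suc (wt ks) ]

  -- The contribution of one marked entry to the dual sum, after substitution in all entries. The
  -- splittings with empty left part have to be brought to this form.
  mixed : ℕ → List ℕ → R
  mixed m c = L m (λ b → E c (cuts star b))

  -- Its values at the rotations of an index are what telescopes in the cyclic sum.
  spine : List ℕ → R
  spine c = Splits c (λ p q → sgn (wt q) (Tree (map Z p) (map Zᵗ (reverse q))))

  sgn-≡ : ∀ {m n} f → m ≡ n → sgn m f ≋ sgn n f
  sgn-≡ f ≡.refl = refl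

  module _ (n : ℕ) (c : List ℕ) where
    private
      m k : ℕ
      m = suc n
      k = m ℕ.+ wt c

      D : List ℕ
      D = reverse c

      -- The splittings of (j+1, c, b+1), sorted by the place of the cut: before everything, between
      -- the two end entries, after everything.
      none middle full : ℕ → ℕ → R
      none   j b = sgn (suc j ℕ.+ wt c ℕ.+ suc b) (starᵗ (suc b ∷ D ++ [ suc j ]))
      middle j b = Splits c (λ p q → sgn (wt q ℕ.+ suc b) (star (suc j ∷ p) * starᵗ (suc b ∷ reverse q)))
      full   j b = star (suc j ∷ c ++ [ suc b ])

      starŜ-split : ∀ j b → starŜ (suc j ∷ c ++ [ suc b ]) ≋ none j b + (middle j b + full j b)
      starŜ-split j b = +-cong
        (trans (sgn-cong (wt (suc j ∷ c ++ [ suc b ])) (*-identityˡ _))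
          (reflexive≡ (≡.cong₂ sgn weight (≡.cong starᵗ reversed))))
        (trans (Splits-∷ʳ c (suc b) _) (+-cong
          (Splits-cong c (λ p q → reflexive≡ (≡.cong₂ sgn (wt-∷ʳ q (suc b))
            (≡.cong (λ u → star (suc j ∷ p) * starᵗ u) (List.reverse-++ q [ suc b ])))))
          (*-identityʳ _)))
        where
        weight : wt (suc j ∷ c ++ [ suc b ]) ≡ suc j ℕ.+ wt c ℕ.+ suc b
        weight = ≡.trans (≡.cong (suc j ℕ.+_) (wt-∷ʳ c (suc b))) (≡.sym (ℕ.+-assoc (suc j) (wt c) (suc b)))
        reversed : reverse (suc j ∷ c ++ [ suc b ]) ≡ suc b ∷ D ++ [ suc j ]
        reversed = ≡.trans (List.unfold-reverse (suc j) (c ++ [ suc b ]))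
          (≡.cong (_++ [ suc j ]) (List.reverse-++ c [ suc b ]))

      𝕋-G : ∀ B → 𝕋 (λ j → G (Z (suc j)) B) ≋ G (Zᵗ 1) B
      𝕋-G B = trans (𝕋≋L1 (λ a → G (Z a) B)) (sym (L-homo (G-linear B) 1 Z))

      -- The tail over j turns the first column into `Zᵗ 1`, so it is a tree with empty second arm.
      full-part : ∑< n (λ j → full j (n ℕ.∸ j)) - 𝕋 (λ j → full j n) ≋
        cuts star m c - Tree (map Z (c ++ [ m ])) []
      full-part = +-cong
        (∑<-cong-< n (λ j j<n → reflexive≡ (≡.cong (λ b → star (suc j ∷ c ++ [ b ]))
          (≡.sym (ℕ.+-∸-assoc 1 (ℕ.<⇒≤ j<n))))))
        (-‿cong (trans (𝕋-G (map Z (c ++ [ m ]))) (sym (Tree-[]ʳ (map Z (c ++ [ m ]))))))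

      -- `tree-identity` for the arms p and `reverse q`. The column m ends up in front of p in one
      -- tree and behind q in the other: these are its places in two consecutive rotations.
      middle-cut : ∀ p q →
        ∑< n (λ j → sgn (wt q ℕ.+ suc (n ℕ.∸ j)) (star (suc j ∷ p) * starᵗ (suc (n ℕ.∸ j) ∷ reverse q)))
          - 𝕋 (λ j → sgn (wt q ℕ.+ m) (star (suc j ∷ p) * starᵗ (m ∷ reverse q)))
        ≋ sgn (wt q) (Tree (map Z (m ∷ p)) (map Zᵗ (reverse q)))
          - sgn (wt (q ++ [ m ])) (Tree (map Z p) (map Zᵗ (reverse (q ++ [ m ]))))
      middle-cut p q = begin
        ∑< n (λ j → sgn (w ℕ.+ suc (n ℕ.∸ j)) (e j (n ℕ.∸ j))) - 𝕋 (λ j → sgn (w ℕ.+ m) (e j n))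
          ≈⟨ +-cong
               (trans (Linear.cong (∑<-linear n) (λ j → trans (sgn-+ w (suc (n ℕ.∸ j)) _)
                   (Op.-‿homo {sgn w} (sgn-linear w) (sgn (n ℕ.∸ j) (e j (n ℕ.∸ j))))))
                 (trans (Linear.-‿homo (∑<-linear n) (λ j → sgn w (sgn (n ℕ.∸ j) (e j (n ℕ.∸ j)))))
                   (-‿cong (sgn-homo (∑<-linear n) w (λ j → sgn (n ℕ.∸ j) (e j (n ℕ.∸ j)))))))
               (-‿cong (trans (sgn-homo 𝕋-linear (w ℕ.+ m) (λ j → e j n)) (trans
                 (sgn-+ w m (𝕋 (λ j → e j n)))
                 (trans (Op.-‿homo {sgn w} (sgn-linear w) _)
                   (-‿cong (sgn-cong w (sgn-cong n (trans
                     (sym (Op.𝕋-homo {_* G (Zᵗ m) B} (*-linearʳ _) _)) (*-congʳ (𝕋-G P))))))))))⟩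
        - sgn w S - - sgn w (sgn n T₀)
          ≈⟨ solve 2 (λ a b → :- a :- :- b := :- (a :- b)) refl (sgn w S) (sgn w (sgn n T₀)) ⟩
        - (sgn w S - sgn w (sgn n T₀))
          ≈⟨ -‿cong (Op.-homo {sgn w} (sgn-linear w) S (sgn n T₀)) ⟨
        - sgn w (S - sgn n T₀)
          ≈⟨ -‿cong (trans (sgn-cong w (tree-identity n P B)) (Op.-‿homo {sgn w} (sgn-linear w) _)) ⟩
        - - sgn w (T₁ + sgn n T₂)
          ≈⟨ trans (-‿involutive _) (Op.+-homo {sgn w} (sgn-linear w) T₁ (sgn n T₂)) ⟩
        sgn w T₁ + sgn w (sgn n T₂)
          ≈⟨ +-congˡ (trans (sym (-‿involutive _)) (-‿cong (trans
               (sym (Op.-‿homo {sgn w} (sgn-linear w) (sgn n T₂))) (sym (sgn-+ w m T₂))))) ⟩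
        sgn w T₁ - sgn (w ℕ.+ m) T₂
          ≈⟨ +-congˡ (-‿cong (reflexive≡ (≡.cong₂ sgn (≡.sym (wt-∷ʳ q m))
               (≡.cong (λ u → Tree P (map Zᵗ u)) (≡.sym (List.reverse-++ q [ m ])))))) ⟩
        sgn w T₁ - sgn (wt (q ++ [ m ])) (Tree P (map Zᵗ (reverse (q ++ [ m ])))) ∎
        where
        w = wt q
        P B : Ops
        P = map Z p
        B = map Zᵗ (reverse q)
        e : ℕ → ℕ → R
        e j b = G (Z (suc j)) P * G (Zᵗ (suc b)) B
        S T₀ T₁ T₂ : R
        S = ∑< n (λ j → sgn (n ℕ.∸ j) (e j (n ℕ.∸ j)))
        T₀ = G (Zᵗ 1) P * G (Zᵗ m) B
        T₁ = Tree (Z m ∷ P) B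
        T₂ = Tree P (Zᵗ m ∷ B)

      -- With m forced into the left part of m ∷ c, or into the right part of c ++ [ m ], each
      -- `spine` lacks one extreme splitting, which is therefore subtracted.
      middle-part : ∑< n (λ j → middle j (n ℕ.∸ j)) - 𝕋 (λ j → middle j n) ≋
        (spine (m ∷ c) - sgn k (Tree [] (map Zᵗ (reverse (m ∷ c)))))
          - (spine (c ++ [ m ]) - Tree (map Z (c ++ [ m ])) [])
      middle-part = begin
        ∑< n (λ j → middle j (n ℕ.∸ j)) - 𝕋 (λ j → middle j n)
          ≈⟨ +-cong (Splits-homo (∑<-linear n) c _) (-‿cong (Splits-homo 𝕋-linear c _)) ⟩
        Splits c (λ p q → first p q) - Splits c (λ p q → second p q)
          ≈⟨ Linear.-homo (Splits-linear c) _ _ ⟨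
        Splits c (λ p q → first p q - second p q)
          ≈⟨ trans (Splits-cong c middle-cut) (Linear.-homo (Splits-linear c) _ _) ⟩
        Splits c (λ p q → V (m ∷ p) q) - Splits c (λ p q → V p (q ++ [ m ]))
          ≈⟨ +-cong (solve 2 (λ a b → a := (b :+ a) :- b) refl _ (V [] (m ∷ c)))
               (-‿cong (trans (solve 2 (λ a b → a := (a :+ b) :- b) refl _ _)
                 (+-congʳ (sym (Splits-∷ʳ c m V))))) ⟩
        (spine (m ∷ c) - V [] (m ∷ c)) - (spine (c ++ [ m ]) - V (c ++ [ m ]) []) ∎
        where
        V first second : List ℕ → List ℕ → R
        V p q = sgn (wt q) (Tree (map Z p) (map Zᵗ (reverse q)))
        first p q = ∑< n (λ j → sgn (wt q ℕ.+ suc (n ℕ.∸ j)) (star (suc j ∷ p) * starᵗ (suc (n ℕ.∸ j) ∷ reverse q)))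
        second p q = 𝕋 (λ j → sgn (wt q ℕ.+ m) (star (suc j ∷ p) * starᵗ (m ∷ reverse q)))

      g : ℕ → ℕ → R
      g a b = E D (λ v → star (a ∷ v ++ [ b ]))

      starᵗ-ends : ∀ a b → starᵗ (a ∷ D ++ [ b ]) ≋ L a (λ a → L b (g a))
      starᵗ-ends a b = trans (sym (E-star (a ∷ D ++ [ b ])))
        (L-cong a (λ a → E-∷ʳ D b (λ v → star (a ∷ v))))

      -- In the finite sum the weight is constant, hence so is the sign; in the tail the weight
      -- grows with j and yields the alternating sum of `double-sum`. The term added there to
      -- complete the antidiagonal leaves the tree on the right.
      none-part : ∑< n (λ j → none j (n ℕ.∸ j)) - 𝕋 (λ j → none j n) ≋
        sgn (suc k) (mixed m D) + sgn k (Tree [] (map Zᵗ (reverse (m ∷ c))))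
      none-part = begin
        ∑< n (λ j → none j (n ℕ.∸ j)) - 𝕋 (λ j → none j n)
          ≈⟨ +-cong
               (trans (∑<-cong-< n (λ j j<n → trans (sgn-≡ _ (weight j (ℕ.<⇒≤ j<n)))
                   (sgn-cong (suc k) (starᵗ-ends (suc (n ℕ.∸ j)) (suc j)))))
                 (sgn-homo (∑<-linear n) (suc k) _))
               (-‿cong (trans (𝕋-cong (λ j → trans (sgn-≡ _ (weight′ j)) (trans (sgn-+ (suc k) j _)
                   (sgn-cong (suc k) (sgn-cong j (starᵗ-ends m (suc j)))))))
                 (sgn-homo 𝕋-linear (suc k) _))) ⟩
        sgn (suc k) P₁ - sgn (suc k) P₂
          ≈⟨ Op.-homo {sgn (suc k)} (sgn-linear (suc k)) P₁ P₂ ⟨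
        sgn (suc k) (P₁ - P₂)
          ≈⟨ sgn-cong (suc k) (solve 2 (λ a b → a := (a :+ b) :- b) refl (P₁ - P₂) P₃) ⟩
        sgn (suc k) (((P₁ - P₂) + P₃) - P₃)
          ≈⟨ trans (Op.-homo {sgn (suc k)} (sgn-linear (suc k)) _ _) (+-cong
               (sgn-cong (suc k) (trans (double-sum n g) (L-cong m inner)))
               (trans (-‿involutive _) (sgn-cong k ends))) ⟩
        sgn (suc k) (mixed m D) + sgn k (Tree [] (map Zᵗ (reverse (m ∷ c)))) ∎
        where
        P₁ P₂ P₃ : R
        P₁ = ∑< n (λ j → L (suc (n ℕ.∸ j)) (λ a → L (suc j) (g a)))
        P₂ = 𝕋 (λ j → sgn j (L m (λ a → L (suc j) (g a))))
        P₃ = L 1 (λ a → L m (g a))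

        weight : ∀ j → j ℕ.≤ n → suc j ℕ.+ wt c ℕ.+ suc (n ℕ.∸ j) ≡ suc k
        weight j j≤n = ≡.trans (ℕ.+-suc (suc j ℕ.+ wt c) (n ℕ.∸ j)) (≡.cong (λ i → suc (suc i)) (≡.trans
          (≡.cong (ℕ._+ (n ℕ.∸ j)) (ℕ.+-comm j (wt c))) (≡.trans (ℕ.+-assoc (wt c) j _)
          (≡.trans (≡.cong (wt c ℕ.+_) (ℕ.m+[n∸m]≡n j≤n)) (ℕ.+-comm (wt c) n)))))

        weight′ : ∀ j → suc j ℕ.+ wt c ℕ.+ suc n ≡ suc k ℕ.+ j
        weight′ j = ≡.trans (ℕ.+-suc (suc j ℕ.+ wt c) n) (≡.cong (λ i → suc (suc i)) (≡.trans
          (ℕ.+-assoc j (wt c) n) (≡.trans (ℕ.+-comm j (wt c ℕ.+ n))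
          (≡.cong (ℕ._+ j) (ℕ.+-comm (wt c) n)))))

        inner : ∀ a → ∑< (pred a) (λ j → g (suc j) (a ℕ.∸ j)) ≋ E D (cuts star a)
        inner a = sym (∑<-homo (E-linear D) (pred a) (λ j v → star (suc j ∷ v ++ [ a ℕ.∸ j ])))

        ends : P₃ ≋ Tree [] (map Zᵗ (reverse (m ∷ c)))
        ends = trans (sym (starᵗ-ends 1 m)) (trans (reflexive≡ (≡.cong (λ u → G (Zᵗ 1) (map Zᵗ u))
          (≡.sym (List.unfold-reverse m c)))) (sym (Tree-[]ˡ (map Zᵗ (reverse (m ∷ c))))))

    -- The trees left over by `none-part` and `full-part` are precisely the extreme splittings
    -- missing from `middle-part`, so that complete spines remain.
    cyclicŜ-summand :
      cuts starŜ m c - 𝕋 (λ j → starŜ (suc j ∷ c ++ [ m ])) ≋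
      cuts star m c + (spine (m ∷ c) - spine (c ++ [ m ])) + sgn (suc k) (mixed m (reverse c))
    cyclicŜ-summand = begin
      cuts starŜ m c - 𝕋 (λ j → starŜ (suc j ∷ c ++ [ m ]))
        ≈⟨ +-cong
             (trans (∑<-cong-< n (λ j j<n → trans (reflexive≡ (≡.cong (λ b → starŜ (suc j ∷ c ++ [ b ]))
                 (ℕ.+-∸-assoc 1 (ℕ.<⇒≤ j<n)))) (starŜ-split j (n ℕ.∸ j))))
               (trans (Linear.+-homo (∑<-linear n) _ _) (+-congˡ (Linear.+-homo (∑<-linear n) _ _))))
             (-‿cong (trans (𝕋-cong (λ j → starŜ-split j n))
               (trans (Linear.+-homo 𝕋-linear _ _) (+-congˡ (Linear.+-homo 𝕋-linear _ _))))) ⟩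
      (N₁ + (M₁ + F₁)) - (N₂ + (M₂ + F₂))
        ≈⟨ solve 6 (λ a b c d e f → (a :+ (b :+ c)) :- (d :+ (e :+ f)) := (a :- d) :+ ((b :- e) :+ (c :- f)))
             refl N₁ M₁ F₁ N₂ M₂ F₂ ⟩
      (N₁ - N₂) + ((M₁ - M₂) + (F₁ - F₂))
        ≈⟨ +-cong none-part (+-cong middle-part full-part) ⟩
      (X + Y) + (((S₁ - Y) - (S₂ - T₀)) + (C - T₀))
        ≈⟨ solve 6 (λ x y s₁ s₂ t c → (x :+ y) :+ (((s₁ :- y) :- (s₂ :- t)) :+ (c :- t)) :=
             (c :+ (s₁ :- s₂)) :+ x) refl X Y S₁ S₂ T₀ C ⟩
      (C + (S₁ - S₂)) + X ∎
      where
      N₁ N₂ M₁ M₂ F₁ F₂ X Y S₁ S₂ T₀ C : R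
      N₁ = ∑< n (λ j → none j (n ℕ.∸ j))
      N₂ = 𝕋 (λ j → none j n)
      M₁ = ∑< n (λ j → middle j (n ℕ.∸ j))
      M₂ = 𝕋 (λ j → middle j n)
      F₁ = ∑< n (λ j → full j (n ℕ.∸ j))
      F₂ = 𝕋 (λ j → full j n)
      X = sgn (suc k) (mixed m D)
      Y = sgn k (Tree [] (map Zᵗ (reverse (m ∷ c))))
      S₁ = spine (m ∷ c)
      S₂ = spine (c ++ [ m ])
      T₀ = Tree (map Z (c ++ [ m ])) []
      C = cuts star m c

  -- Substitution and reversal act on the marked entry and on the rest separately. The correction
  -- term depends on the weight only and is evaluated by `E-wt` and `L-∙`.
  E-cyclic : ∀ ks → All NonZero ks → ks ≢ [] →
    E ks (λ v → cyclic (reverse v)) ≋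
      Holes ks (λ p m q → mixed m (reverse (q ++ p))) - wt ks ∙ L (suc (wt ks)) (λ a → star [ a ])
  E-cyclic []       pos ne = contradiction ≡.refl ne
  E-cyclic ks@(suc n ∷ ks′) pos@(_ ∷ _) ne = trans
    (Linear.-homo (E-linear ks) (λ v → Holes (reverse v) (λ p m q → cuts star m (q ++ p)))
      (λ v → wt (reverse v) ∙ star [ suc (wt (reverse v)) ]))
    (+-cong holes weights)
    where
    holes : E ks (λ v → Holes (reverse v) (λ p m q → cuts star m (q ++ p))) ≋
      Holes ks (λ p m q → mixed m (reverse (q ++ p)))
    holes = begin
      E ks (λ v → Holes (reverse v) (λ p m q → cuts star m (q ++ p)))
        ≈⟨ E-reverse ks (λ v → Holes v (λ p m q → cuts star m (q ++ p))) ⟩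
      E (reverse ks) (λ v → Holes v (λ p m q → cuts star m (q ++ p)))
        ≈⟨ E-Holes (reverse ks) _ ⟩
      Holes (reverse ks) (λ p k q → E p (λ p′ → L k (λ a → E q (λ q′ → cuts star a (q′ ++ p′)))))
        ≈⟨ Holes-cong (reverse ks) (λ p k q → begin
             E p (λ p′ → L k (λ a → E q (λ q′ → cuts star a (q′ ++ p′))))
               ≈⟨ L-E-comm k p (λ a p′ → E q (λ q′ → cuts star a (q′ ++ p′))) ⟨
             L k (λ a → E p (λ p′ → E q (λ q′ → cuts star a (q′ ++ p′))))
               ≈⟨ L-cong k (λ a → trans (E-homo (E-linear p) q (λ q′ p′ → cuts star a (q′ ++ p′)))
                    (sym (E-++ q p (cuts star a)))) ⟩
             mixed k (q ++ p) ∎) ⟩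
      Holes (reverse ks) (λ p k q → mixed k (q ++ p))
        ≈⟨ Holes-reverse ks _ ⟩
      Holes ks (λ p k q → mixed k (reverse p ++ reverse q))
        ≈⟨ Holes-cong ks (λ p k q → reflexive≡ (≡.cong (mixed k) (≡.sym (List.reverse-++ q p)))) ⟩
      Holes ks (λ p k q → mixed k (reverse (q ++ p))) ∎

    weights : - E ks (λ v → wt (reverse v) ∙ star [ suc (wt (reverse v)) ]) ≋
      - (wt ks ∙ L (suc (wt ks)) (λ a → star [ a ]))
    weights = -‿cong (begin
      E ks (λ v → wt (reverse v) ∙ star [ suc (wt (reverse v)) ])
        ≈⟨ E-cong ks (λ v → reflexive≡ (≡.cong (λ w → w ∙ star [ suc w ]) (wt-reverse v))) ⟩
      E ks (λ v → wt v ∙ star [ suc (wt v) ])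
        ≈⟨ E-wt (suc n) ks′ pos (λ w → w ∙ star [ suc w ]) ⟩
      L (wt ks) (λ w → w ∙ star [ suc w ])
        ≈⟨ L-∙ (n ℕ.+ wt ks′) (λ a → star [ a ]) ⟩
      wt ks ∙ L (suc (wt ks)) (λ a → star [ a ]) ∎)

  -- Positivity exhibits the marked entry as a successor, and the weight equation gives all summands
  -- the common sign (-1)^(k+1).
  Holes-cong-wt : ∀ ks → All NonZero ks → ∀ {φ ψ} →
    (∀ p n q → suc n ℕ.+ wt (q ++ p) ≡ wt ks → φ p (suc n) q ≋ ψ p (suc n) q) →
    Holes ks φ ≋ Holes ks ψ
  Holes-cong-wt []           _         e = refl
  Holes-cong-wt (suc n ∷ ks) (_ ∷ pos) e = +-cong
    (e [] n ks (≡.cong (λ u → suc n ℕ.+ wt u) (List.++-identityʳ ks)))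
    (Holes-cong-wt ks pos (λ p i q w → e (suc n ∷ p) i q (weight p i q w)))
    where
    weight : ∀ p i q → suc i ℕ.+ wt (q ++ p) ≡ wt ks →
      suc i ℕ.+ wt (q ++ suc n ∷ p) ≡ suc n ℕ.+ wt ks
    weight p i q w rewrite ≡.sym w | sum-++ q (suc n ∷ p) | sum-++ q p = ≡.trans
      (≡.cong (suc i ℕ.+_) (x∙yz≈y∙xz (wt q) (suc n) (wt p)))
      (x∙yz≈y∙xz (suc i) (suc n) (wt q ℕ.+ wt p))

  cyclic-sum : ∀ ks → All NonZero ks → ks ≢ [] →
    cyclicŜ ks ≋ cyclic ks + sgn (suc (wt ks)) (E ks (λ v → cyclic (reverse v)))
  cyclic-sum ks pos ne = begin
    cyclicŜ ks
      ≈⟨ +-cong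
           (Holes-cong-wt ks pos {λ p m q → cuts starŜ m (q ++ p) - 𝕋 (λ j → starŜ (suc j ∷ q ++ p ++ [ m ]))}
              {λ p m q → (φ p m q + ψ p m q) + sgn (suc k) (χ p m q)}
              (λ p n q w → trans
                (+-congˡ (-‿cong (𝕋-cong (λ j → reflexive≡ (≡.cong (λ u → starŜ (suc j ∷ u)) (≡.sym (List.++-assoc q p [ suc n ])))))))
                (trans (cyclicŜ-summand n (q ++ p))
                  (+-cong (+-congˡ (+-congˡ (-‿cong (reflexive≡ (≡.cong spine (List.++-assoc q p [ suc n ]))))))
                    (sgn-≡ _ (≡.cong suc w))))))
           (-‿cong (×-congʳ k last-term)) ⟩
    Holes ks (λ p m q → (φ p m q + ψ p m q) + sgn (suc k) (χ p m q)) - k ∙ (sgn (suc k) Λ + star [ suc k ])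
      ≈⟨ +-cong
           (trans (Linear.+-homo (Holes-linear ks) _ _) (+-cong
             (trans (Linear.+-homo (Holes-linear ks) _ _)
               (trans (+-congˡ (Holes-rotations spine ks)) (+-identityʳ _)))
             (sgn-homo (Holes-linear ks) (suc k) _)))
           (-‿cong (trans (Op.+-homo {k ∙_} (∙-linear k) _ _) (+-congʳ (sgn-op {k ∙_} (∙-linear k) (suc k) Λ)))) ⟩
    (Holes ks φ + sgn (suc k) (Holes ks χ)) - (sgn (suc k) (k ∙ Λ) + k ∙ star [ suc k ])
      ≈⟨ solve 4 (λ a b c d → (a :+ b) :- (c :+ d) := (a :- d) :+ (b :- c)) refl _ _ _ _ ⟩
    cyclic ks + (sgn (suc k) (Holes ks χ) - sgn (suc k) (k ∙ Λ))
      ≈⟨ +-congˡ (trans (sgn-cong (suc k) (E-cyclic ks pos ne)) (Op.-homo {sgn (suc k)} (sgn-linear (suc k)) _ _)) ⟨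
    cyclic ks + sgn (suc k) (E ks (λ v → cyclic (reverse v))) ∎
    where
    k = wt ks
    Λ : R
    Λ = L (suc k) (λ a → star [ a ])
    φ ψ χ : List ℕ → ℕ → List ℕ → R
    φ p m q = cuts star m (q ++ p)
    ψ p m q = spine (m ∷ q ++ p) - spine (q ++ p ++ [ m ])
    χ p m q = mixed m (reverse (q ++ p))

    last-term : starŜ [ suc k ] ≋ sgn (suc k) Λ + star [ suc k ]
    last-term = +-cong
      (trans (sgn-≡ _ (ℕ.+-identityʳ (suc k))) (sgn-cong (suc k)
        (trans (*-identityˡ _) (sym (E-star [ suc k ])))))
      (*-identityʳ _)

  -- Closure under the operations from which `cyclic` and `E` are built. The instance of interest
  -- consists of the series in which no word begins with x.
  record Subalgebra (P : R → Set) : Set where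
    field
      0∈   : P 0#
      1∈   : P 1#
      +∈   : ∀ {f g} → P f → P g → P (f + g)
      neg∈ : ∀ {f} → P f → P (- f)
      *∈   : ∀ {f g} → P f → P g → P (f * g)
      𝕋∈   : ∀ {F} → (∀ j → P (F j)) → P (𝕋 F)
      Z∈   : ∀ k {f} → P f → P (Z k f)

    sgn∈ : ∀ m {f} → P f → P (sgn m f)
    sgn∈ zero    h = h
    sgn∈ (suc m) h = neg∈ (sgn∈ m h)

    ∙∈ : ∀ m {f} → P f → P (m ∙ f)
    ∙∈ zero    h = 0∈
    ∙∈ (suc m) h = +∈ h (∙∈ m h)

    opaque
      unfolding L

      L∈ : ∀ k {F} → (∀ a → P (F a)) → P (L k F)
      L∈ k h = 𝕋∈ (λ l → ∙∈ ((k ℕ.+ l ℕ.∸ 1) C l) (h (k ℕ.+ l)))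

    E∈ : ∀ ks {F} → (∀ v → P (F v)) → P (E ks F)
    E∈ []       h = h []
    E∈ (k ∷ ks) h = L∈ k (λ a → E∈ ks (λ v → h (a ∷ v)))

    ∑<∈ : ∀ n {F} → (∀ j → P (F j)) → P (∑< n F)
    ∑<∈ zero    h = 0∈
    ∑<∈ (suc n) h = +∈ (h 0) (∑<∈ n (h ∘ suc))

    Holes∈ : ∀ ks {φ} → (∀ p m q → P (φ p m q)) → P (Holes ks φ)
    Holes∈ []       h = 0∈
    Holes∈ (k ∷ ks) h = +∈ (h [] k ks) (Holes∈ ks (λ p → h (k ∷ p)))

    G∈ : ∀ {Φ} ks → (∀ {f} → P f → P (Φ f)) → P (G Φ (map Z ks))
    G∈ []       h = h 1∈
    G∈ (k ∷ ks) h = +∈ (*∈ (h 1∈) (G∈ ks (Z∈ k))) (neg∈ (G∈ ks (λ i → h (Z∈ k i))))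

    star∈ : ∀ ks → P (star ks)
    star∈ []       = 1∈
    star∈ (k ∷ ks) = G∈ ks (Z∈ k)

    cyclic∈ : ∀ ks → P (cyclic ks)
    cyclic∈ ks = +∈
      (Holes∈ ks (λ p m q → ∑<∈ (pred m) (λ j → star∈ (suc j ∷ (q ++ p) ++ [ m ℕ.∸ j ]))))
      (neg∈ (∙∈ (wt ks) (star∈ [ suc (wt ks) ])))

  cyclic-sum∈ : ∀ {P} → Subalgebra P → ∀ ks →
    P (cyclic ks + sgn (suc (wt ks)) (E ks (λ v → cyclic (reverse v))))
  cyclic-sum∈ S ks = +∈ (cyclic∈ ks) (sgn∈ (suc (wt ks)) (E∈ ks (λ v → cyclic∈ (reverse v))))
    where open Subalgebra S

-- The model: coefficient functions on words and power series over them.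

-- The shuffle product is determined by f ⧢ g at the empty word together with
-- the fact that f ↦ f ∘ (u ∷_) ("delete the last letter u") is a derivation.

module ShuffleAlgebra (K : CommutativeRing 0ℓ 0ℓ) where
  open CommutativeRing K hiding (zero) renaming (_≈_ to _≋_)
  open import Relation.Binary.Reasoning.Setoid setoid

  Coeffs : Set
  Coeffs = Word → Carrier

  infix 4 _≐_
  _≐_ : Coeffs → Coeffs → Set
  f ≐ g = ∀ w → f w ≋ g w

  infixl 7 _⧢_
  _⧢_ : Coeffs → Coeffs → Coeffs
  (f ⧢ g) []      = f [] * g []
  (f ⧢ g) (u ∷ w) = ((f ∘ (u ∷_)) ⧢ g) w + (f ⧢ (g ∘ (u ∷_))) w

  infixl 6 _⊞_
  _⊞_ : Coeffs → Coeffs → Coeffs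
  (f ⊞ g) w = f w + g w

  ε : Coeffs
  ε []      = 1#
  ε (_ ∷ _) = 0#

  𝟘 : Coeffs
  𝟘 _ = 0#

  ⧢-cong : ∀ {f f′ g g′} → f ≐ f′ → g ≐ g′ → f ⧢ g ≐ f′ ⧢ g′
  ⧢-cong d e []      = *-cong (d []) (e [])
  ⧢-cong d e (u ∷ w) =
    +-cong (⧢-cong (d ∘ (u ∷_)) e w) (⧢-cong d (e ∘ (u ∷_)) w)

  ⧢-comm : ∀ f g → f ⧢ g ≐ g ⧢ f
  ⧢-comm f g []      = *-comm _ _
  ⧢-comm f g (u ∷ w) = trans (+-cong (⧢-comm _ g w) (⧢-comm f _ w)) (+-comm _ _)

  ⧢-distribʳ : ∀ h f g → (f ⊞ g) ⧢ h ≐ (f ⧢ h) ⊞ (g ⧢ h)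
  ⧢-distribʳ h f g []      = distribʳ _ _ _
  ⧢-distribʳ h f g (u ∷ w) = trans
    (+-cong (⧢-distribʳ h _ _ w) (⧢-distribʳ (h ∘ (u ∷_)) f g w))
    (interchange +-commutativeSemigroup _ _ _ _)

  ⧢-distribˡ : ∀ h f g → h ⧢ (f ⊞ g) ≐ (h ⧢ f) ⊞ (h ⧢ g)
  ⧢-distribˡ h f g w = trans (⧢-comm h _ w)
    (trans (⧢-distribʳ h f g w) (+-cong (⧢-comm f h w) (⧢-comm g h w)))

  -- On both sides a last letter is deleted from exactly one of the three factors.
  ⧢-assoc : ∀ f g h → (f ⧢ g) ⧢ h ≐ f ⧢ (g ⧢ h)
  ⧢-assoc f g h []      = *-assoc _ _ _
  ⧢-assoc f g h (u ∷ w) = begin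
    (((f↓ ⧢ g) ⊞ (f ⧢ g↓)) ⧢ h) w + ((f ⧢ g) ⧢ h↓) w
      ≈⟨ +-congʳ (⧢-distribʳ h (f↓ ⧢ g) (f ⧢ g↓) w) ⟩
    (((f↓ ⧢ g) ⧢ h) w + ((f ⧢ g↓) ⧢ h) w) + ((f ⧢ g) ⧢ h↓) w
      ≈⟨ +-cong (+-cong (⧢-assoc f↓ g h w) (⧢-assoc f g↓ h w)) (⧢-assoc f g h↓ w) ⟩
    ((f↓ ⧢ (g ⧢ h)) w + (f ⧢ (g↓ ⧢ h)) w) + (f ⧢ (g ⧢ h↓)) w
      ≈⟨ trans (+-assoc _ _ _) (+-congˡ (sym (⧢-distribˡ f (g↓ ⧢ h) (g ⧢ h↓) w))) ⟩
    (f↓ ⧢ (g ⧢ h)) w + (f ⧢ ((g↓ ⧢ h) ⊞ (g ⧢ h↓))) w ∎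
    where
    f↓ g↓ h↓ : Coeffs
    f↓ = f ∘ (u ∷_)
    g↓ = g ∘ (u ∷_)
    h↓ = h ∘ (u ∷_)

  ⧢-zeroˡ : ∀ g → 𝟘 ⧢ g ≐ 𝟘
  ⧢-zeroˡ g []      = zeroˡ _
  ⧢-zeroˡ g (u ∷ w) = trans (+-cong (⧢-zeroˡ g w) (⧢-zeroˡ _ w)) (+-identityʳ 0#)

  ⧢-identityˡ : ∀ g → ε ⧢ g ≐ g
  ⧢-identityˡ g []      = *-identityˡ _
  ⧢-identityˡ g (u ∷ w) =
    trans (+-cong (⧢-zeroˡ g w) (⧢-identityˡ _ w)) (+-identityˡ _)

  commutativeRing : CommutativeRing 0ℓ 0ℓ
  commutativeRing = record
    { Carrier = Coeffs
    ; _≈_     = _≐_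
    ; _+_     = _⊞_
    ; _*_     = _⧢_
    ; -_      = λ f w → - f w
    ; 0#      = 𝟘
    ; 1#      = ε
    ; isCommutativeRing = record
      { isRing = record
        { +-isAbelianGroup = Pointwise.isAbelianGroup Word +-isAbelianGroup
        ; *-cong     = ⧢-cong
        ; *-assoc    = ⧢-assoc
        ; *-identity = ⧢-identityˡ , λ f w → trans (⧢-comm f ε w) (⧢-identityˡ f w)
        ; distrib    = ⧢-distribˡ , ⧢-distribʳ
        }
      ; *-comm = ⧢-comm
      }
    }

  snoc : Letter → Coeffs → Coeffs
  snoc u f []      = 0#
  snoc u f (v ∷ w) = if does (u ≟ᴸ v) then f w else 0#

  snoc-cong : ∀ u {f g} → f ≐ g → snoc u f ≐ snoc u g
  snoc-cong u e []      = refl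
  snoc-cong u e (v ∷ w) with does (u ≟ᴸ v)
  ... | true  = e w
  ... | false = refl

  snoc-⊞ : ∀ u f g → snoc u (f ⊞ g) ≐ snoc u f ⊞ snoc u g
  snoc-⊞ u f g []      = sym (+-identityʳ 0#)
  snoc-⊞ u f g (v ∷ w) with does (u ≟ᴸ v)
  ... | true  = refl
  ... | false = sym (+-identityʳ 0#)

  snoc-𝟘 : ∀ u → snoc u 𝟘 ≐ 𝟘
  snoc-𝟘 u []      = refl
  snoc-𝟘 u (v ∷ w) with does (u ≟ᴸ v)
  ... | true  = refl
  ... | false = refl

  snoc-⧢-snoc : ∀ u v f g →
    snoc u f ⧢ snoc v g ≐ snoc u (f ⧢ snoc v g) ⊞ snoc v (snoc u f ⧢ g)
  snoc-⧢-snoc u v f g []      = trans (zeroˡ 0#) (sym (+-identityʳ 0#))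
  snoc-⧢-snoc u v f g (c ∷ w) with does (u ≟ᴸ c) | does (v ≟ᴸ c)
  ... | true  | true  = refl
  ... | true  | false = +-congˡ (trans (⧢-comm (snoc u f) 𝟘 w) (⧢-zeroˡ (snoc u f) w))
  ... | false | true  = +-congʳ (⧢-zeroˡ (snoc v g) w)
  ... | false | false =
    +-cong (⧢-zeroˡ (snoc v g) w) (trans (⧢-comm (snoc u f) 𝟘 w) (⧢-zeroˡ (snoc u f) w))

  -- Deleting the first letter commutes with deleting last letters and is a derivation as well.
  -- Invariance under reversal and closure of ℍ¹ under the product both rest on this.
  ⧢-first : ∀ u f g → (λ w → (f ⧢ g) (w ++ [ u ])) ≐
    ((λ w → f (w ++ [ u ])) ⧢ g) ⊞ (f ⧢ (λ w → g (w ++ [ u ])))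
  ⧢-first u f g []      = refl
  ⧢-first u f g (v ∷ w) = trans (+-cong (⧢-first u _ g w) (⧢-first u f _ w))
    (interchange +-commutativeSemigroup _ _ _ _)

module PowerSeries (K : CommutativeRing 0ℓ 0ℓ) where
  open CommutativeRing K hiding (zero) renaming (_≈_ to _≋_)
  open import Relation.Binary.Reasoning.Setoid setoid
  open RingSolver K using (solve; _:=_; _:+_; _:*_)

  Series : Set
  Series = ℕ → Carrier

  infix 4 _≐_
  _≐_ : Series → Series → Set
  f ≐ g = ∀ n → f n ≋ g n

  infixl 6 _⊞_
  _⊞_ : Series → Series → Series
  (f ⊞ g) n = f n + g n

  infixl 7 _⊠_
  _⊠_ : Series → Series → Series
  (f ⊠ g) zero    = f 0 * g 0
  (f ⊠ g) (suc n) = f 0 * g (suc n) + ((f ∘ suc) ⊠ g) n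

  𝟘 : Series
  𝟘 _ = 0#

  𝟙 : Series
  𝟙 zero    = 1#
  𝟙 (suc _) = 0#

  ⊠-cong : ∀ {f f′ g g′} → f ≐ f′ → g ≐ g′ → f ⊠ g ≐ f′ ⊠ g′
  ⊠-cong d e zero    = *-cong (d 0) (e 0)
  ⊠-cong d e (suc n) = +-cong (*-cong (d 0) (e (suc n))) (⊠-cong (d ∘ suc) e n)

  -- The convolution recursion read from the other end, which turns commutativity into an induction.
  ⊠-last : ∀ f g n → (f ⊠ g) (suc n) ≋ (f ⊠ (g ∘ suc)) n + f (suc n) * g 0
  ⊠-last f g zero    = refl
  ⊠-last f g (suc n) = trans (+-congˡ (⊠-last (f ∘ suc) g n)) (sym (+-assoc _ _ _))

  ⊠-comm : ∀ f g → f ⊠ g ≐ g ⊠ f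
  ⊠-comm f g zero    = *-comm _ _
  ⊠-comm f g (suc n) = begin
    f 0 * g (suc n) + ((f ∘ suc) ⊠ g) n   ≈⟨ +-cong (*-comm _ _) (⊠-comm (f ∘ suc) g n) ⟩
    g (suc n) * f 0 + (g ⊠ (f ∘ suc)) n   ≈⟨ +-comm _ _ ⟩
    (g ⊠ (f ∘ suc)) n + g (suc n) * f 0   ≈⟨ ⊠-last g f n ⟨
    (g ⊠ f) (suc n)                       ∎

  ⊠-distribʳ : ∀ h f g → (f ⊞ g) ⊠ h ≐ (f ⊠ h) ⊞ (g ⊠ h)
  ⊠-distribʳ h f g zero    = distribʳ _ _ _
  ⊠-distribʳ h f g (suc n) = trans
    (+-cong (distribʳ _ _ _) (⊠-distribʳ h (f ∘ suc) (g ∘ suc) n))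
    (interchange +-commutativeSemigroup _ _ _ _)

  ⊠-distribˡ : ∀ h f g → h ⊠ (f ⊞ g) ≐ (h ⊠ f) ⊞ (h ⊠ g)
  ⊠-distribˡ h f g n = trans (⊠-comm h _ n)
    (trans (⊠-distribʳ h f g n) (+-cong (⊠-comm f h n) (⊠-comm g h n)))

  ⊠-scale : ∀ c g h n → ((λ m → c * g m) ⊠ h) n ≋ c * (g ⊠ h) n
  ⊠-scale c g h zero    = *-assoc _ _ _
  ⊠-scale c g h (suc n) = trans
    (+-cong (*-assoc _ _ _) (⊠-scale c (g ∘ suc) h n)) (sym (distribˡ _ _ _))

  ⊠-assoc : ∀ f g h → (f ⊠ g) ⊠ h ≐ f ⊠ (g ⊠ h)
  ⊠-assoc f g h zero    = *-assoc _ _ _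
  ⊠-assoc f g h (suc n) = begin
    (f 0 * g 0) * h (suc n) + (((λ m → f 0 * g (suc m)) ⊞ ((f ∘ suc) ⊠ g)) ⊠ h) n
      ≈⟨ +-congˡ (trans (⊠-distribʳ h _ _ n)
           (+-cong (⊠-scale (f 0) (g ∘ suc) h n) (⊠-assoc (f ∘ suc) g h n))) ⟩
    (f 0 * g 0) * h (suc n) + (f 0 * ((g ∘ suc) ⊠ h) n + ((f ∘ suc) ⊠ (g ⊠ h)) n)
      ≈⟨ solve 5 (λ a b c d e → (a :* b) :* c :+ (a :* d :+ e) := a :* (b :* c :+ d) :+ e)
           refl (f 0) (g 0) (h (suc n)) _ _ ⟩
    f 0 * (g 0 * h (suc n) + ((g ∘ suc) ⊠ h) n) + ((f ∘ suc) ⊠ (g ⊠ h)) n ∎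

  ⊠-zeroˡ : ∀ g → 𝟘 ⊠ g ≐ 𝟘
  ⊠-zeroˡ g zero    = zeroˡ _
  ⊠-zeroˡ g (suc n) = trans (+-cong (zeroˡ _) (⊠-zeroˡ g n)) (+-identityʳ 0#)

  ⊠-identityˡ : ∀ g → 𝟙 ⊠ g ≐ g
  ⊠-identityˡ g zero    = *-identityˡ _
  ⊠-identityˡ g (suc n) = trans (+-cong (*-identityˡ _) (⊠-zeroˡ g n)) (+-identityʳ _)

  commutativeRing : CommutativeRing 0ℓ 0ℓ
  commutativeRing = record
    { Carrier = Series
    ; _≈_     = _≐_
    ; _+_     = _⊞_
    ; _*_     = _⊠_
    ; -_      = λ f n → - f n
    ; 0#      = 𝟘
    ; 1#      = 𝟙
    ; isCommutativeRing = record
      { isRing = record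
        { +-isAbelianGroup = Pointwise.isAbelianGroup ℕ +-isAbelianGroup
        ; *-cong     = ⊠-cong
        ; *-assoc    = ⊠-assoc
        ; *-identity = ⊠-identityˡ , λ f n → trans (⊠-comm f 𝟙 n) (⊠-identityˡ f n)
        ; distrib    = ⊠-distribˡ , ⊠-distribʳ
        }
      ; *-comm = ⊠-comm
      }
    }

  shift : Series → Series
  shift f zero    = 0#
  shift f (suc n) = f n

  shift-cong : ∀ {f g} → f ≐ g → shift f ≐ shift g
  shift-cong e zero    = refl
  shift-cong e (suc n) = e n

  shift-⊞ : ∀ f g → shift (f ⊞ g) ≐ shift f ⊞ shift g
  shift-⊞ f g zero    = sym (+-identityʳ 0#)
  shift-⊞ f g (suc n) = refl

  shift-⊠ : ∀ f g → shift (f ⊠ g) ≐ shift f ⊠ g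
  shift-⊠ f g zero    = sym (zeroˡ _)
  shift-⊠ f g (suc n) = sym (trans (+-congʳ (zeroˡ _)) (+-identityˡ _))

  ∑shift : (ℕ → Series) → Series
  ∑shift f zero    = f 0 0
  ∑shift f (suc n) = f 0 (suc n) + ∑shift (f ∘ suc) n

  ∑shift-step : ∀ f → ∑shift f ≐ f 0 ⊞ shift (∑shift (f ∘ suc))
  ∑shift-step f zero    = sym (+-identityʳ _)
  ∑shift-step f (suc n) = refl

  -- The coefficient of t^n is reached by unfolding the common recurrence n times, so induction on n
  -- suffices.
  shift-coinduction : {P : Set} (step : P → P) (r g h : P → Series) →
    (∀ p → g p ≐ r p ⊞ shift (g (step p))) →
    (∀ p → h p ≐ r p ⊞ shift (h (step p))) →
    ∀ p → g p ≐ h p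
  shift-coinduction step r g h d e p zero    = trans (d p 0) (sym (e p 0))
  shift-coinduction step r g h d e p (suc n) = trans (d p (suc n)) (trans
    (+-congˡ (shift-coinduction step r g h d e (step p) n)) (sym (e p (suc n))))

module _ (K : CommutativeRing 0ℓ 0ℓ) where
  private
    module S = ShuffleAlgebra K
    module P = PowerSeries S.commutativeRing
    module K = CommutativeRing K

  shuffle⟦t⟧ : Shuffle⟦t⟧
  shuffle⟦t⟧ = record
    { commutativeRing = P.commutativeRing
    ; τ      = P.shift
    ; τ-cong = P.shift-cong
    ; τ-+    = P.shift-⊞
    ; τ-*    = P.shift-⊠
    ; 𝕋      = P.∑shift
    ; 𝕋-step = P.∑shift-step
    ; coinduction = P.shift-coinduction
    ; op      = λ u f n → S.snoc u (f n)
    ; op-cong = λ u e n → S.snoc-cong u (e n)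
    ; op-+    = λ u f g n → S.snoc-⊞ u (f n) (g n)
    ; op-τ    = op-τ
    ; op-*-op = op-*-op
    }
    where
    op : Letter → P.Series → P.Series
    op u f n = S.snoc u (f n)

    op-τ : ∀ u f → op u (P.shift f) P.≐ P.shift (op u f)
    op-τ u f zero    = S.snoc-𝟘 u
    op-τ u f (suc n) = λ _ → K.refl

    op-*-op : ∀ u v f g →
      op u f P.⊠ op v g P.≐ op u (f P.⊠ op v g) P.⊞ op v (op u f P.⊠ g)
    op-*-op u v f g zero      = S.snoc-⧢-snoc u v (f 0) (g 0)
    op-*-op u v f g (suc n) w = begin
      (S.snoc u (f 0) S.⧢ S.snoc v (g (suc n))) w K.+ (op u (f ∘ suc) P.⊠ op v g) n w
        ≈⟨ K.+-cong (S.snoc-⧢-snoc u v (f 0) (g (suc n)) w) (op-*-op u v (f ∘ suc) g n w) ⟩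
      _
        ≈⟨ interchange K.+-commutativeSemigroup _ _ _ _ ⟩
      _
        ≈⟨ K.+-cong (S.snoc-⊞ u _ _ w) (S.snoc-⊞ v _ _ w) ⟨
      (op u (f P.⊠ op v g) P.⊞ op v (op u f P.⊠ g)) (suc n) w ∎
      where open import Relation.Binary.Reasoning.Setoid K.setoid

-- Sums over lists.

module ListSums (S : CommutativeRing 0ℓ 0ℓ) where
  open CommutativeRing S hiding (zero) renaming (_≈_ to _≋_; Carrier to V)
  open RingSolver S using (solve; _:=_; _:+_; _:-_; :-_)

  ∑ᴸ : {A : Set} → List A → (A → V) → V
  ∑ᴸ []       F = 0#
  ∑ᴸ (a ∷ as) F = F a + ∑ᴸ as F

  module _ {A : Set} where
    ∑ᴸ-cong-All : ∀ {as} {F G : A → V} → All (λ a → F a ≋ G a) as → ∑ᴸ as F ≋ ∑ᴸ as G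
    ∑ᴸ-cong-All []       = refl
    ∑ᴸ-cong-All (e ∷ es) = +-cong e (∑ᴸ-cong-All es)

    ∑ᴸ-cong : ∀ as {F G : A → V} → (∀ a → F a ≋ G a) → ∑ᴸ as F ≋ ∑ᴸ as G
    ∑ᴸ-cong as e = ∑ᴸ-cong-All (All.universal e as)

    ∑ᴸ-+ : ∀ as (F G : A → V) → ∑ᴸ as (λ a → F a + G a) ≋ ∑ᴸ as F + ∑ᴸ as G
    ∑ᴸ-+ []       F G = sym (+-identityʳ 0#)
    ∑ᴸ-+ (a ∷ as) F G = trans (+-congˡ (∑ᴸ-+ as F G)) (interchange +-commutativeSemigroup _ _ _ _)

    ∑ᴸ-0 : ∀ (as : List A) → ∑ᴸ as (λ _ → 0#) ≋ 0#
    ∑ᴸ-0 []       = refl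
    ∑ᴸ-0 (a ∷ as) = trans (+-identityˡ _) (∑ᴸ-0 as)

    ∑ᴸ-minus : ∀ as (F G : A → V) → ∑ᴸ as (λ a → F a - G a) ≋ ∑ᴸ as F - ∑ᴸ as G
    ∑ᴸ-minus []       F G = sym (-‿inverseʳ 0#)
    ∑ᴸ-minus (a ∷ as) F G = trans (+-congˡ (∑ᴸ-minus as F G))
      (solve 4 (λ a b c d → (a :- b) :+ (c :- d) := (a :+ c) :- (b :+ d)) refl _ _ _ _)

    ∑ᴸ-* : ∀ c as (F : A → V) → ∑ᴸ as (λ a → c * F a) ≋ c * ∑ᴸ as F
    ∑ᴸ-* c []       F = sym (zeroʳ c)
    ∑ᴸ-* c (a ∷ as) F = trans (+-congˡ (∑ᴸ-* c as F)) (sym (distribˡ _ _ _))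

    ∑ᴸ-++ : ∀ as bs (F : A → V) → ∑ᴸ (as ++ bs) F ≋ ∑ᴸ as F + ∑ᴸ bs F
    ∑ᴸ-++ []       bs F = sym (+-identityˡ _)
    ∑ᴸ-++ (a ∷ as) bs F = trans (+-congˡ (∑ᴸ-++ as bs F)) (sym (+-assoc _ _ _))

  ∑ᴸ-map : ∀ {A B : Set} (g : A → B) as F → ∑ᴸ (map g as) F ≡ ∑ᴸ as (F ∘ g)
  ∑ᴸ-map g []       F = ≡.refl
  ∑ᴸ-map g (a ∷ as) F = ≡.cong (F (g a) +_) (∑ᴸ-map g as F)

  ∑ᴸ-concatMap : ∀ {A B : Set} (g : A → List B) as F →
    ∑ᴸ (concatMap g as) F ≋ ∑ᴸ as (λ a → ∑ᴸ (g a) F)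
  ∑ᴸ-concatMap g []       F = refl
  ∑ᴸ-concatMap g (a ∷ as) F = trans (∑ᴸ-++ (g a) _ F) (+-congˡ (∑ᴸ-concatMap g as F))

  ∑ᴸ-swap : ∀ {A B : Set} (as : List A) (bs : List B) (F : A → B → V) →
    ∑ᴸ as (λ a → ∑ᴸ bs (F a)) ≋ ∑ᴸ bs (λ b → ∑ᴸ as (λ a → F a b))
  ∑ᴸ-swap []       bs F = sym (∑ᴸ-0 bs)
  ∑ᴸ-swap (a ∷ as) bs F = trans (+-congˡ (∑ᴸ-swap as bs F)) (sym (∑ᴸ-+ bs _ _))

  guard : Bool → V → V
  guard b v = if b then v else 0#

  guard-∧ : ∀ a b v → guard (a ∧ b) v ≡ guard a (guard b v)
  guard-∧ true  b v = ≡.refl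
  guard-∧ false b v = ≡.refl

  guard-cong : ∀ b {u v} → u ≋ v → guard b u ≋ guard b v
  guard-cong true  e = e
  guard-cong false e = refl

  ∑ᴸ-guard : ∀ {A : Set} b (as : List A) F → ∑ᴸ as (λ a → guard b (F a)) ≋ guard b (∑ᴸ as F)
  ∑ᴸ-guard true  as F = refl
  ∑ᴸ-guard false as F = ∑ᴸ-0 as

-- Translation of the formal series into the abstract algebra.

Positive : List ℕ → Set
Positive = All NonZero

reverse-positive : ∀ {ks} → Positive ks → Positive (reverse ks)
reverse-positive {ks} = All-resp-↭ (↭-sym (↭-reverse ks))

-- Compatibility of a map out of formal series with each operation that occurs in the two sides of
-- the theorem. Only `⟦w⋆⟧` concerns 2-posets.
record Interpretation : Set₁ where
  field
    algebra : Shuffle⟦t⟧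
  open Core algebra public
  field
    ⟦_⟧       : ℍ⟦t⟧ → R
    ⟦⟧-⊕      : ∀ f g → ⟦ f ⊕ᵗ g ⟧ ≋ ⟦ f ⟧ + ⟦ g ⟧
    ⟦⟧-⊖      : ∀ f g → ⟦ f ⊖ᵗ g ⟧ ≋ ⟦ f ⟧ - ⟦ g ⟧
    ⟦⟧-sign   : ∀ m f → ⟦ sign m ⊛ᵗ f ⟧ ≋ sgn m ⟦ f ⟧
    ⟦⟧-fromℕ  : ∀ m f → ⟦ fromℕ m ⊛ᵗ f ⟧ ≋ m ∙ ⟦ f ⟧
    ⟦⟧-sh     : ∀ f g → ⟦ f shᵗ g ⟧ ≋ ⟦ f ⟧ * ⟦ g ⟧
    ⟦⟧-∑-[]   : {A : Set} (f : A → ℍ⟦t⟧) → ⟦ ∑ᵗ [] f ⟧ ≋ 0#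
    ⟦⟧-∑-∷    : {A : Set} (a : A) (as : List A) (f : A → ℍ⟦t⟧) →
      ⟦ ∑ᵗ (a ∷ as) f ⟧ ≋ ⟦ f a ⟧ + ⟦ ∑ᵗ as f ⟧
    ⟦⟧-∑t     : ∀ f → ⟦ ∑tʲ f ⟧ ≋ 𝕋 (λ j → ⟦ f j ⟧)
    ⟦⟧-∑tˡ    : ∀ ks (p : List ℕ → ℍ) →
      ⟦ ∑tˡ[ ls ∈ℕ^ length ks ] fromℕ (binomials ks ls) ⊛ p (ks +ⁱ ls) ⟧ ≋ E ks (λ v → ⟦ const (p v) ⟧)
    ⟦⟧-const-⊖     : ∀ p q → ⟦ const (p ⊖ q) ⟧ ≋ ⟦ const p ⟧ - ⟦ const q ⟧
    ⟦⟧-const-fromℕ : ∀ m p → ⟦ const (fromℕ m ⊛ p) ⟧ ≋ m ∙ ⟦ const p ⟧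
    ⟦⟧-const-∑-[]  : {A : Set} (f : A → ℍ) → ⟦ const (∑ [] f) ⟧ ≋ 0#
    ⟦⟧-const-∑-∷   : {A : Set} (a : A) (as : List A) (f : A → ℍ) →
      ⟦ const (∑ (a ∷ as) f) ⟧ ≋ ⟦ const (f a) ⟧ + ⟦ const (∑ as f) ⟧
    ⟦w⋆⟧ : ∀ ks → All NonZero ks → ⟦ const (w⋆ ks) ⟧ ≋ star ks

module Interpreted (I : Interpretation) where
  open Interpretation I

  ∑ᴿ : {A : Set} → List A → (A → R) → R
  ∑ᴿ = ListSums.∑ᴸ commutativeRing

  ∑ᴿ-cong : ∀ {A : Set} (as : List A) {f g : A → R} → (∀ a → f a ≋ g a) → ∑ᴿ as f ≋ ∑ᴿ as g
  ∑ᴿ-cong = ListSums.∑ᴸ-cong commutativeRing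

  ∑ᴿ-applyUpTo : ∀ (h : ℕ → ℕ) k f → ∑ᴿ (applyUpTo h k) f ≋ ∑< k (f ∘ h)
  ∑ᴿ-applyUpTo h zero    f = refl
  ∑ᴿ-applyUpTo h (suc k) f = +-congˡ {f (h 0)} (∑ᴿ-applyUpTo (h ∘ suc) k f)

  ∑ᴿ-upTo : ∀ k f → ∑ᴿ (upTo k) f ≋ ∑< k f
  ∑ᴿ-upTo = ∑ᴿ-applyUpTo id

  ∑ᴿ-tabulate : ∀ {n} {A : Set} (h : Fin n → A) f → ∑ᴿ (tabulate h) f ≋ ∑ᴿ (allFin n) (f ∘ h)
  ∑ᴿ-tabulate {zero}  h f = refl
  ∑ᴿ-tabulate {suc n} h f = +-congˡ {f (h Fin.zero)}
    (trans (∑ᴿ-tabulate (h ∘ Fin.suc) f) (sym (∑ᴿ-tabulate Fin.suc (f ∘ h))))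

  ∑ᴿ-Holes : ∀ ks φ →
    ∑ᴿ (allFin (length ks)) (λ i → φ (take (toℕ i) ks) (lookup ks i) (drop (suc (toℕ i)) ks)) ≋ Holes ks φ
  ∑ᴿ-Holes []       φ = refl
  ∑ᴿ-Holes (k ∷ ks) φ = +-congˡ {φ [] k ks} (trans (∑ᴿ-tabulate {length ks} Fin.suc _) (∑ᴿ-Holes ks (λ p → φ (k ∷ p))))

  ∑ᴿ-Splits : ∀ ks φ →
    ∑ᴿ (upTo (suc (length ks))) (λ i → φ (take i ks) (drop i ks)) ≋ Splits ks φ
  ∑ᴿ-Splits []       φ = +-identityʳ _
  ∑ᴿ-Splits (k ∷ ks) φ = +-congˡ {φ [] (k ∷ ks)} (trans
    (∑ᴿ-applyUpTo suc (suc (length ks)) _)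
    (trans (sym (∑ᴿ-upTo (suc (length ks)) _)) (∑ᴿ-Splits ks (λ p → φ (k ∷ p)))))

  -- The shifted entries k + l stay positive, which matters because `⟦w⋆⟧` is available for positive
  -- indices.
  E-cong⁺ : ∀ ks → Positive ks → ∀ {f g} → (∀ v → Positive v → f v ≋ g v) → E ks f ≋ E ks g
  E-cong⁺ []           _         e = e [] []
  E-cong⁺ (suc m ∷ ks) (_ ∷ pos) {f} {g} e =
    L-cong⁺ m {λ a → E ks (λ v → f (a ∷ v))} {λ a → E ks (λ v → g (a ∷ v))}
      (λ i → E-cong⁺ ks pos (λ v pv → e (suc i ∷ v) (_ ∷ pv)))

  Holes-congᴾ : ∀ ks → Positive ks → ∀ {φ ψ} →
    (∀ p m q → Positive p → NonZero m → Positive q → φ p m q ≋ ψ p m q) → Holes ks φ ≋ Holes ks ψ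
  Holes-congᴾ []       _         e = refl
  Holes-congᴾ (k ∷ ks) (pk ∷ pos) e = +-cong (e [] k ks [] pk pos)
    (Holes-congᴾ ks pos (λ p m q pp → e (k ∷ p) m q (pk ∷ pp)))

  Splits-congᴾ : ∀ ks → Positive ks → ∀ {φ ψ} →
    (∀ p q → Positive p → Positive q → φ p q ≋ ψ p q) → Splits ks φ ≋ Splits ks ψ
  Splits-congᴾ []       _          e = e [] [] [] []
  Splits-congᴾ (k ∷ ks) (pk ∷ pos) e = +-cong (e [] (k ∷ ks) [] (pk ∷ pos))
    (Splits-congᴾ ks pos (λ p q pp → e (k ∷ p) q (pk ∷ pp)))

  ⟦⟧-∑ : ∀ {A : Set} (as : List A) f → ⟦ ∑ᵗ as f ⟧ ≋ ∑ᴿ as (λ a → ⟦ f a ⟧)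
  ⟦⟧-∑ []       f = ⟦⟧-∑-[] f
  ⟦⟧-∑ (a ∷ as) f = trans (⟦⟧-∑-∷ a as f) (+-congˡ (⟦⟧-∑ as f))

  ⟦⟧-const-∑ : ∀ {A : Set} (as : List A) f → ⟦ const (∑ as f) ⟧ ≋ ∑ᴿ as (λ a → ⟦ const (f a) ⟧)
  ⟦⟧-const-∑ []       f = ⟦⟧-const-∑-[] f
  ⟦⟧-const-∑ (a ∷ as) f = trans (⟦⟧-const-∑-∷ a as f) (+-congˡ (⟦⟧-const-∑ as f))

  ⟦w⋆Ŝ⟧ : ∀ ks → Positive ks → ⟦ w⋆Ŝ ks ⟧ ≋ starŜ ks
  ⟦w⋆Ŝ⟧ ks pos = begin
    ⟦ w⋆Ŝ ks ⟧
      ≈⟨ ⟦⟧-∑ (upTo (suc (length ks))) _ ⟩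
    ∑ᴿ (upTo (suc (length ks))) (λ i → ⟦ term (take i ks) (drop i ks) ⟧)
      ≈⟨ ∑ᴿ-Splits ks (λ p q → ⟦ term p q ⟧) ⟩
    Splits ks (λ p q → ⟦ term p q ⟧)
      ≈⟨ Splits-congᴾ ks pos (λ p q pp pq → trans (⟦⟧-sign (wt q) _) (sgn-cong (wt q) (trans
           (⟦⟧-sh (const (w⋆ p)) (second q)) (*-cong (⟦w⋆⟧ p pp) (trans (⟦⟧-∑tˡ q (w⋆ ∘ reverse))
             (trans (E-cong⁺ q pq (λ v pv → ⟦w⋆⟧ (reverse v) (reverse-positive pv)))
               (trans (E-reverse q star) (E-star (reverse q))))))))) ⟩
    starŜ ks ∎
    where
    second : List ℕ → ℍ⟦t⟧
    second q = ∑tˡ[ ls ∈ℕ^ length q ] fromℕ (binomials q ls) ⊛ w⋆ (reverse (q +ⁱ ls))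
    term : List ℕ → List ℕ → ℍ⟦t⟧
    term p q = sign (wt q) ⊛ᵗ (const (w⋆ p) shᵗ second q)

  ∑ᴿ-cuts : ∀ {F f : List ℕ → R} → (∀ v → Positive v → F v ≋ f v) → ∀ p m q →
    Positive p → NonZero m → Positive q →
    ∑ᴿ (upTo (m ℕ.∸ 1)) (λ j → F (suc j ∷ q ++ p ++ [ m ℕ.∸ j ])) ≋ cuts f m (q ++ p)
  ∑ᴿ-cuts {F} {f} e p (suc n) q pp _ pq = trans (∑ᴿ-upTo n _) (∑<-cong-< n (λ j j<n → trans
    (e _ (_ ∷ All.++⁺ pq (All.++⁺ pp (ℕ.>-nonZero (ℕ.m<n⇒0<n∸m (ℕ.m<n⇒m<1+n j<n)) ∷ []))))
    (reflexive≡ (≡.cong (λ u → f (suc j ∷ u)) (≡.sym (List.++-assoc q p [ suc n ℕ.∸ j ]))))))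

  module _ (w : Index → ℍ) (⟦w⟧ : ∀ v → Positive v → ⟦ const (w v) ⟧ ≋ star v) where

    CSF-cuts : (ks : Index) → Fin (length ks) → ℍ
    CSF-cuts ks i = ∑[ j ∈ upTo (lookup ks i ℕ.∸ 1) ]
      w (suc j ∷ after ks i ++ before ks i ++ [ lookup ks i ℕ.∸ j ])

    ⟦CSF⟧ : ∀ ks → Positive ks →
      ⟦ const ((∑[ i ∈ allFin (length ks) ] CSF-cuts ks i) ⊖ fromℕ (wt ks) ⊛ w [ suc (wt ks) ]) ⟧ ≋ cyclic ks
    ⟦CSF⟧ ks pos = trans (⟦⟧-const-⊖ (∑ (allFin (length ks)) (CSF-cuts ks)) (fromℕ (wt ks) ⊛ w [ suc (wt ks) ])) (+-cong
      (trans (⟦⟧-const-∑ (allFin (length ks)) (CSF-cuts ks)) (trans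
        (∑ᴿ-cong (allFin (length ks)) (λ i → ⟦⟧-const-∑ (upTo (lookup ks i ℕ.∸ 1)) _))
        (trans (∑ᴿ-Holes ks (λ p m q → ∑ᴿ (upTo (m ℕ.∸ 1)) (λ j → ⟦ const (w (suc j ∷ q ++ p ++ [ m ℕ.∸ j ])) ⟧)))
          (Holes-congᴾ ks pos (∑ᴿ-cuts {λ v → ⟦ const (w v) ⟧} {star} ⟦w⟧)))))
      (-‿cong (trans (⟦⟧-const-fromℕ (wt ks) (w [ suc (wt ks) ])) (×-congʳ (wt ks) (⟦w⟧ [ suc (wt ks) ] (_ ∷ []))))))

  module _ (w : Index → ℍ⟦t⟧) (⟦w⟧ : ∀ v → Positive v → ⟦ w v ⟧ ≋ starŜ v) where

    CSFŜ-cuts CSFŜ-tails : (ks : Index) → Fin (length ks) → ℍ⟦t⟧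
    CSFŜ-cuts ks i = ∑ᵗ[ j ∈ upTo (lookup ks i ℕ.∸ 1) ]
      w (suc j ∷ after ks i ++ before ks i ++ [ lookup ks i ℕ.∸ j ])
    CSFŜ-tails ks i = ∑tʲ[ j ] w (suc j ∷ after ks i ++ through ks i)

    ⟦CSFŜ-cuts⟧ : ∀ ks → Positive ks → ⟦ ∑ᵗ (allFin (length ks)) (CSFŜ-cuts ks) ⟧ ≋
      Holes ks (λ p m q → cuts starŜ m (q ++ p))
    ⟦CSFŜ-cuts⟧ ks pos = trans (⟦⟧-∑ (allFin (length ks)) (CSFŜ-cuts ks)) (trans
      (∑ᴿ-cong (allFin (length ks)) (λ i → ⟦⟧-∑ (upTo (lookup ks i ℕ.∸ 1))
        (λ j → w (suc j ∷ after ks i ++ before ks i ++ [ lookup ks i ℕ.∸ j ]))))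
      (trans (∑ᴿ-Holes ks (λ p m q → ∑ᴿ (upTo (m ℕ.∸ 1)) (λ j → ⟦ w (suc j ∷ q ++ p ++ [ m ℕ.∸ j ]) ⟧)))
        (Holes-congᴾ ks pos (∑ᴿ-cuts {λ v → ⟦ w v ⟧} {starŜ} ⟦w⟧))))

    ⟦CSFŜ-tails⟧ : ∀ ks → Positive ks → ⟦ ∑ᵗ (allFin (length ks)) (CSFŜ-tails ks) ⟧ ≋
      Holes ks (λ p m q → 𝕋 (λ j → starŜ (suc j ∷ q ++ p ++ [ m ])))
    ⟦CSFŜ-tails⟧ ks pos = trans (⟦⟧-∑ (allFin (length ks)) (CSFŜ-tails ks)) (trans
      (∑ᴿ-cong (allFin (length ks)) (λ i → trans (⟦⟧-∑t (λ j → w (suc j ∷ after ks i ++ through ks i)))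
        (𝕋-cong (λ j → reflexive≡ (≡.cong (λ u → ⟦ w (suc j ∷ after ks i ++ u) ⟧) (List.take-suc ks i))))))
      (trans (∑ᴿ-Holes ks (λ p m q → 𝕋 (λ j → ⟦ w (suc j ∷ q ++ p ++ [ m ]) ⟧)))
        (Holes-congᴾ ks pos (λ p m q pp pm pq → 𝕋-cong (λ j →
          ⟦w⟧ (suc j ∷ q ++ p ++ [ m ]) (_ ∷ All.++⁺ pq (All.++⁺ pp (pm ∷ []))))))))

    ⟦CSFŜ⟧ : ∀ ks → Positive ks →
      ⟦ ∑ᵗ (allFin (length ks)) (CSFŜ-cuts ks) ⊖ᵗ ∑ᵗ (allFin (length ks)) (CSFŜ-tails ks)
        ⊖ᵗ fromℕ (wt ks) ⊛ᵗ w [ suc (wt ks) ] ⟧ ≋ cyclicŜ ks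
    ⟦CSFŜ⟧ ks pos = trans (⟦⟧-⊖ (first ⊖ᵗ second) (fromℕ (wt ks) ⊛ᵗ w [ suc (wt ks) ])) (+-cong
      (trans (⟦⟧-⊖ first second) (trans (+-cong (⟦CSFŜ-cuts⟧ ks pos) (-‿cong (⟦CSFŜ-tails⟧ ks pos)))
        (sym (Linear.-homo (Holes-linear ks) (λ (p , m , q) → cuts starŜ m (q ++ p))
          (λ (p , m , q) → 𝕋 (λ j → starŜ (suc j ∷ q ++ p ++ [ m ])))))))
      (-‿cong (trans (⟦⟧-fromℕ (wt ks) (w [ suc (wt ks) ])) (×-congʳ (wt ks) (⟦w⟧ [ suc (wt ks) ] (_ ∷ []))))))
      where
      first second : ℍ⟦t⟧
      first = ∑ᵗ (allFin (length ks)) (CSFŜ-cuts ks)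
      second = ∑ᵗ (allFin (length ks)) (CSFŜ-tails ks)

  ⟦w⋆CSF⟧ : ∀ ks → Positive ks → ⟦ const (w⋆CSF ks) ⟧ ≋ cyclic ks
  ⟦w⋆CSF⟧ = ⟦CSF⟧ w⋆ ⟦w⋆⟧

  ⟦w⋆CSFŜ⟧ : ∀ ks → Positive ks → ⟦ w⋆CSFŜ ks ⟧ ≋ cyclicŜ ks
  ⟦w⋆CSFŜ⟧ = ⟦CSFŜ⟧ w⋆Ŝ ⟦w⋆Ŝ⟧

  ⟦w⋆CSFŜ⟧-sum : ∀ ks → Positive ks → ks ≢ [] →
    ⟦ w⋆CSFŜ ks ⟧ ≋ cyclic ks + sgn (suc (wt ks)) (E ks (λ v → cyclic (reverse v)))
  ⟦w⋆CSFŜ⟧-sum ks pos ne = trans (⟦w⋆CSFŜ⟧ ks pos) (cyclic-sum ks pos ne)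

  ⟦dual⟧-sum : ∀ ks → Positive ks →
    ⟦ const (w⋆CSF ks) ⊕ᵗ sign (suc (wt ks)) ⊛ᵗ
      (∑tˡ[ ls ∈ℕ^ length ks ] fromℕ (binomials ks ls) ⊛ w⋆CSF (reverse (ks +ⁱ ls))) ⟧ ≋
    cyclic ks + sgn (suc (wt ks)) (E ks (λ v → cyclic (reverse v)))
  ⟦dual⟧-sum ks pos = trans (⟦⟧-⊕ (const (w⋆CSF ks)) (sign (suc (wt ks)) ⊛ᵗ dual)) (+-cong (⟦w⋆CSF⟧ ks pos)
    (trans (⟦⟧-sign (suc (wt ks)) dual) (sgn-cong (suc (wt ks)) (trans (⟦⟧-∑tˡ ks (w⋆CSF ∘ reverse))
      (E-cong⁺ ks pos (λ v pv → ⟦w⋆CSF⟧ (reverse v) (reverse-positive pv)))))))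
    where
    dual : ℍ⟦t⟧
    dual = ∑tˡ[ ls ∈ℕ^ length ks ] fromℕ (binomials ks ls) ⊛ w⋆CSF (reverse (ks +ⁱ ls))

-- Interleavings and orderings.

module _ {A : Set} where
  interleavings : List A → List A → List (List A)
  interleavings []      q       = [ q ]
  interleavings (a ∷ p) []      = [ a ∷ p ]
  interleavings (a ∷ p) (b ∷ q) =
    map (a ∷_) (interleavings p (b ∷ q)) ++ map (b ∷_) (interleavings (a ∷ p) q)

  insertions≡interleavings : ∀ a ps → insertions a ps ≡ interleavings [ a ] ps
  insertions≡interleavings a []       = ≡.refl
  insertions≡interleavings a (b ∷ ps) =
    ≡.cong ((a ∷ b ∷ ps) ∷_) (≡.cong (map (b ∷_)) (insertions≡interleavings a ps))

  insertions-↭ : ∀ (a : A) ps → All (_↭ a ∷ ps) (insertions a ps)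
  insertions-↭ a []       = ↭-refl ∷ []
  insertions-↭ a (b ∷ ps) = ↭-refl ∷ All.map⁺ (All.map
    (λ r → ↭-trans (prep b r) (swap b a ↭-refl)) (insertions-↭ a ps))

  orderings-↭ : ∀ as → All (_↭ as) (orderings as)
  orderings-↭ []       = ↭-refl ∷ []
  orderings-↭ (a ∷ as) = All.concat⁺ (All.map⁺ (All.map
    (λ {ps} r → All.map (λ s → ↭-trans s (prep a r)) (insertions-↭ a ps)) (orderings-↭ as)))

module Sums (S : CommutativeRing 0ℓ 0ℓ) (A : Set) where
  open CommutativeRing S hiding (zero) renaming (_≈_ to _≋_; Carrier to V)
  open RingSolver S using (solve; _:=_; _:+_; _:-_; :-_)
  open import Relation.Binary.Reasoning.Setoid setoid
  open ListSums S

  I : List A → List A → (List A → V) → V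
  I p q = ∑ᴸ (interleavings p q)

  O : List A → (List A → V) → V
  O as = ∑ᴸ (orderings as)

  I-[]ˡ : ∀ q F → I [] q F ≋ F q
  I-[]ˡ q F = +-identityʳ _

  I-[]ʳ : ∀ p F → I p [] F ≋ F p
  I-[]ʳ []      F = +-identityʳ _
  I-[]ʳ (a ∷ p) F = +-identityʳ _

  I-∷ : ∀ a p b q F → I (a ∷ p) (b ∷ q) F ≋ I p (b ∷ q) (F ∘ (a ∷_)) + I (a ∷ p) q (F ∘ (b ∷_))
  I-∷ a p b q F = trans (∑ᴸ-++ (map (a ∷_) (interleavings p (b ∷ q))) _ F)
    (reflexive (≡.cong₂ _+_ (∑ᴸ-map (a ∷_) (interleavings p (b ∷ q)) F)
      (∑ᴸ-map (b ∷_) (interleavings (a ∷ p) q) F)))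

  I-cong : ∀ p q {F G} → (∀ r → F r ≋ G r) → I p q F ≋ I p q G
  I-cong p q = ∑ᴸ-cong (interleavings p q)

  I-+ : ∀ p q F G → I p q (λ r → F r + G r) ≋ I p q F + I p q G
  I-+ p q = ∑ᴸ-+ (interleavings p q)

  I-comm : ∀ p q F → I p q F ≋ I q p F
  I-comm []      q       F = trans (I-[]ˡ q F) (sym (I-[]ʳ q F))
  I-comm (a ∷ p) []      F = refl
  I-comm (a ∷ p) (b ∷ q) F = begin
    I (a ∷ p) (b ∷ q) F                                      ≈⟨ I-∷ a p b q F ⟩
    I p (b ∷ q) (F ∘ (a ∷_)) + I (a ∷ p) q (F ∘ (b ∷_))      ≈⟨ +-cong (I-comm p (b ∷ q) _) (I-comm (a ∷ p) q _) ⟩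
    I (b ∷ q) p (F ∘ (a ∷_)) + I q (a ∷ p) (F ∘ (b ∷_))      ≈⟨ +-comm _ _ ⟩
    I q (a ∷ p) (F ∘ (b ∷_)) + I (b ∷ q) p (F ∘ (a ∷_))      ≈⟨ I-∷ b q a p F ⟨
    I (b ∷ q) (a ∷ p) F                                      ∎

  -- Both sides range over the interleavings of three listings; the induction distinguishes which of
  -- the three supplies the first element.
  I-assoc : ∀ o p q F → I p q (λ r → I o r F) ≋ I o p (λ r → I r q F)
  I-assoc []      p       q       F = trans (I-cong p q (λ r → I-[]ˡ r F)) (sym (I-[]ˡ p (λ r → I r q F)))
  I-assoc (a ∷ o) []      q       F = trans (I-[]ˡ q (λ r → I (a ∷ o) r F)) (sym (I-[]ʳ (a ∷ o) (λ r → I r q F)))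
  I-assoc (a ∷ o) (b ∷ p) []      F =
    trans (I-[]ʳ (b ∷ p) (λ r → I (a ∷ o) r F)) (sym (I-cong (a ∷ o) (b ∷ p) (λ r → I-[]ʳ r F)))
  I-assoc (a ∷ o) (b ∷ p) (c ∷ q) F = begin
    I (b ∷ p) (c ∷ q) (λ r → I (a ∷ o) r F)
      ≈⟨ I-∷ b p c q _ ⟩
    I p (c ∷ q) (λ r → I (a ∷ o) (b ∷ r) F) + I (b ∷ p) q (λ r → I (a ∷ o) (c ∷ r) F)
      ≈⟨ +-cong (trans (I-cong p (c ∷ q) (λ r → I-∷ a o b r F)) (I-+ p (c ∷ q) _ _))
                (trans (I-cong (b ∷ p) q (λ r → I-∷ a o c r F)) (I-+ (b ∷ p) q _ _)) ⟩
    (I p (c ∷ q) (λ r → I o (b ∷ r) Fa) + I p (c ∷ q) (λ r → I (a ∷ o) r Fb)) +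
    (I (b ∷ p) q (λ r → I o (c ∷ r) Fa) + I (b ∷ p) q (λ r → I (a ∷ o) r Fc))
      ≈⟨ solve 4 (λ s t u v → (s :+ t) :+ (u :+ v) := (s :+ u) :+ (t :+ v)) refl _ _ _ _ ⟩
    (I p (c ∷ q) (λ r → I o (b ∷ r) Fa) + I (b ∷ p) q (λ r → I o (c ∷ r) Fa)) +
    (I p (c ∷ q) (λ r → I (a ∷ o) r Fb) + I (b ∷ p) q (λ r → I (a ∷ o) r Fc))
      ≈⟨ +-cong (trans (sym (I-∷ b p c q (λ r → I o r Fa))) (I-assoc o (b ∷ p) (c ∷ q) Fa))
           (+-cong (I-assoc (a ∷ o) p (c ∷ q) Fb) (I-assoc (a ∷ o) (b ∷ p) q Fc)) ⟩
    I o (b ∷ p) (λ r → I r (c ∷ q) Fa) +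
      (I (a ∷ o) p (λ r → I r (c ∷ q) Fb) + I (a ∷ o) (b ∷ p) (λ r → I r q Fc))
      ≈⟨ +-congˡ (+-congˡ (I-∷ a o b p (λ r → I r q Fc))) ⟩
    I o (b ∷ p) (λ r → I r (c ∷ q) Fa) + (I (a ∷ o) p (λ r → I r (c ∷ q) Fb) +
      (I o (b ∷ p) (λ r → I (a ∷ r) q Fc) + I (a ∷ o) p (λ r → I (b ∷ r) q Fc)))
      ≈⟨ solve 4 (λ s t u v → s :+ (t :+ (u :+ v)) := (s :+ u) :+ (t :+ v)) refl _ _ _ _ ⟩
    (I o (b ∷ p) (λ r → I r (c ∷ q) Fa) + I o (b ∷ p) (λ r → I (a ∷ r) q Fc)) +
    (I (a ∷ o) p (λ r → I r (c ∷ q) Fb) + I (a ∷ o) p (λ r → I (b ∷ r) q Fc))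
      ≈⟨ +-cong (trans (sym (I-+ o (b ∷ p) _ _)) (I-cong o (b ∷ p) (λ r → sym (I-∷ a r c q F))))
                (trans (sym (I-+ (a ∷ o) p _ _)) (I-cong (a ∷ o) p (λ r → sym (I-∷ b r c q F)))) ⟩
    I o (b ∷ p) (λ r → I (a ∷ r) (c ∷ q) F) + I (a ∷ o) p (λ r → I (b ∷ r) (c ∷ q) F)
      ≈⟨ I-∷ a o b p _ ⟨
    I (a ∷ o) (b ∷ p) (λ r → I r (c ∷ q) F) ∎
    where
    Fa Fb Fc : List A → V
    Fa = F ∘ (a ∷_)
    Fb = F ∘ (b ∷_)
    Fc = F ∘ (c ∷_)

  O-∷ : ∀ a as F → O (a ∷ as) F ≋ O as (λ ps → I [ a ] ps F)
  O-∷ a as F = trans (∑ᴸ-concatMap (insertions a) (orderings as) F)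
    (∑ᴸ-cong (orderings as) (λ ps → reflexive (≡.cong (λ rs → ∑ᴸ rs F) (insertions≡interleavings a ps))))

  -- Inserting one element is interleaving with a singleton, so the induction on as is the
  -- associativity of interleaving.
  O-++ : ∀ as bs F → O (as ++ bs) F ≋ O as (λ p → O bs (λ q → I p q F))
  O-++ []       bs F = sym (trans (+-identityʳ _) (∑ᴸ-cong (orderings bs) (λ q → I-[]ˡ q F)))
  O-++ (a ∷ as) bs F = begin
    O (a ∷ as ++ bs) F
      ≈⟨ O-∷ a (as ++ bs) F ⟩
    O (as ++ bs) (λ ps → I [ a ] ps F)
      ≈⟨ O-++ as bs _ ⟩
    O as (λ p → O bs (λ q → I p q (λ ps → I [ a ] ps F)))
      ≈⟨ ∑ᴸ-cong (orderings as) (λ p → trans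
           (∑ᴸ-cong (orderings bs) (λ q → I-assoc [ a ] p q F))
           (∑ᴸ-swap (orderings bs) (interleavings [ a ] p) _)) ⟩
    O as (λ p → I [ a ] p (λ r → O bs (λ q → I r q F)))
      ≈⟨ O-∷ a as _ ⟨
    O (a ∷ as) (λ p → O bs (λ q → I p q F)) ∎

  O-++-comm : ∀ as bs F → O (as ++ bs) F ≋ O (bs ++ as) F
  O-++-comm as bs F = begin
    O (as ++ bs) F                            ≈⟨ O-++ as bs F ⟩
    O as (λ p → O bs (λ q → I p q F))         ≈⟨ ∑ᴸ-swap (orderings as) (orderings bs) _ ⟩
    O bs (λ q → O as (λ p → I p q F))         ≈⟨ ∑ᴸ-cong (orderings bs) (λ q → ∑ᴸ-cong (orderings as) (λ p → I-comm p q F)) ⟩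
    O bs (λ q → O as (λ p → I q p F))         ≈⟨ O-++ bs as F ⟨
    O (bs ++ as) F                            ∎

  O-exchange : ∀ as bs cs F → O (as ++ bs ++ cs) F ≋ O ((bs ++ as) ++ cs) F
  O-exchange as bs cs F = begin
    O (as ++ bs ++ cs) F
      ≈⟨ reflexive (≡.cong (λ es → O es F) (List.++-assoc as bs cs)) ⟨
    O ((as ++ bs) ++ cs) F
      ≈⟨ trans (O-++ (as ++ bs) cs F) (O-++-comm as bs _) ⟩
    O (bs ++ as) (λ p → O cs (λ q → I p q F))
      ≈⟨ O-++ (bs ++ as) cs F ⟨
    O ((bs ++ as) ++ cs) F ∎

-- Order conditions on a listing.

module Before {A : Set} (_≟_ : DecidableEquality A) where

  before? : A → A → List A → Bool
  before? a b []       = false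
  before? a b (c ∷ cs) = if does (a ≟ c) then true else if does (b ≟ c) then false else before? a b cs

  before?-∷ : ∀ {a b c} r → c ≢ a → c ≢ b → before? a b (c ∷ r) ≡ before? a b r
  before?-∷ {a} {b} {c} r c≢a c≢b with a ≟ c | b ≟ c
  ... | yes e | _     = contradiction (≡.sym e) c≢a
  ... | no _  | yes e = contradiction (≡.sym e) c≢b
  ... | no _  | no _  = ≡.refl

  before?-cong-∷ : ∀ {a b r s} c → before? a b r ≡ before? a b s →
    before? a b (c ∷ r) ≡ before? a b (c ∷ s)
  before?-cong-∷ {a} {b} c e with a ≟ c | b ≟ c
  ... | yes _ | _     = ≡.refl
  ... | no _  | yes _ = ≡.refl
  ... | no _  | no _  = e

  before?-second : ∀ {a b} r → a ≢ b → before? a b (b ∷ r) ≡ false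
  before?-second {a} {b} r a≢b with a ≟ b | b ≟ b
  ... | yes e | _     = contradiction e a≢b
  ... | no _  | yes _ = ≡.refl
  ... | no _  | no ne = contradiction ≡.refl ne

  -- Membership excludes the default value false, taken when neither element is listed; otherwise
  -- whichever is met first decides both tests.
  before?-swap : ∀ {a b} r → a ≢ b → a ∈ r → before? b a r ≡ not (before? a b r)
  before?-swap {a} {b} (c ∷ r) a≢b a∈ with a ≟ c | b ≟ c
  ... | yes e | yes e′ = contradiction (≡.trans e (≡.sym e′)) a≢b
  ... | yes e | no _   = ≡.refl
  ... | no _  | yes _  = ≡.refl
  before?-swap {a} {b} (c ∷ r) a≢b (here e)   | no ne | no _ = contradiction e ne
  before?-swap {a} {b} (c ∷ r) a≢b (there a∈) | no _  | no _ = before?-swap r a≢b a∈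

  -- Order conditions on the elements of c see a listing only through the order it induces on c, and
  -- interleaving with foreign elements leaves that order unchanged.
  record AgreeOn (c r s : List A) : Set where
    constructor agreeOn
    field agrees : ∀ {a b} → a ∈ c → b ∈ c → before? a b r ≡ before? a b s
  open AgreeOn

  AgreeOn-⊆ : ∀ {c d r s} → (∀ {a} → a ∈ c → a ∈ d) → AgreeOn d r s → AgreeOn c r s
  AgreeOn-⊆ sub agree = agreeOn λ a∈ b∈ → agrees agree (sub a∈) (sub b∈)

  AgreeOn-∷ : ∀ {c r s} e → AgreeOn c r s → AgreeOn c (e ∷ r) (e ∷ s)
  AgreeOn-∷ {r = r} {s} e agree = agreeOn λ a∈ b∈ → before?-cong-∷ {r = r} {s} e (agrees agree a∈ b∈)

  AgreeOn-skip : ∀ {c r s} e → (∀ {a} → a ∈ c → e ≢ a) → AgreeOn c r s → AgreeOn c (e ∷ r) s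
  AgreeOn-skip {r = r} e ne agree = agreeOn λ a∈ b∈ →
    ≡.trans (before?-∷ r (ne a∈) (ne b∈)) (agrees agree a∈ b∈)

  interleavings-agreeʳ : ∀ {c} p q → (∀ {a} → a ∈ c → a ∉ p) →
    All (λ r → AgreeOn c r q) (interleavings p q)
  interleavings-agreeʳ []      q       out = agreeOn (λ _ _ → ≡.refl) ∷ []
  interleavings-agreeʳ {c} (e ∷ p) []  out = agree (e ∷ p) out ∷ []
    where
    agree : ∀ p → (∀ {a} → a ∈ c → a ∉ p) → AgreeOn c p []
    agree []      out = agreeOn λ _ _ → ≡.refl
    agree (e ∷ p) out = AgreeOn-skip e (λ { a∈ ≡.refl → out a∈ (here ≡.refl) })
      (agree p (λ a∈ a∈p → out a∈ (there a∈p)))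
  interleavings-agreeʳ (e ∷ p) (d ∷ q) out = All.++⁺
    (All.map⁺ (All.map (AgreeOn-skip e (λ { a∈ ≡.refl → out a∈ (here ≡.refl) }))
      (interleavings-agreeʳ p (d ∷ q) (λ a∈ a∈p → out a∈ (there a∈p)))))
    (All.map⁺ (All.map (AgreeOn-∷ d) (interleavings-agreeʳ (e ∷ p) q out)))

  interleavings-agreeˡ : ∀ {c} p q → (∀ {a} → a ∈ c → a ∉ q) →
    All (λ r → AgreeOn c r p) (interleavings p q)
  interleavings-agreeˡ {c} [] q out = agree q out ∷ []
    where
    agree : ∀ q → (∀ {a} → a ∈ c → a ∉ q) → AgreeOn c q []
    agree []      out = agreeOn λ _ _ → ≡.refl
    agree (e ∷ q) out = AgreeOn-skip e (λ { a∈ ≡.refl → out a∈ (here ≡.refl) })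
      (agree q (λ a∈ a∈q → out a∈ (there a∈q)))
  interleavings-agreeˡ (e ∷ p) []      out = agreeOn (λ _ _ → ≡.refl) ∷ []
  interleavings-agreeˡ (e ∷ p) (d ∷ q) out = All.++⁺
    (All.map⁺ (All.map (AgreeOn-∷ e) (interleavings-agreeˡ p (d ∷ q) out)))
    (All.map⁺ (All.map (AgreeOn-skip d (λ { a∈ ≡.refl → out a∈ (here ≡.refl) }))
      (interleavings-agreeˡ (e ∷ p) q (λ a∈ a∈q → out a∈ (there a∈q)))))

  increasing? : List A → List A → Bool
  increasing? []          r = true
  increasing? (a ∷ [])    r = true
  increasing? (a ∷ b ∷ c) r = before? a b r ∧ increasing? (b ∷ c) r

  -- An empty column has no bottom or top and imposes no relation.
  linked? : Maybe A → Maybe A → List A → Bool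
  linked? (just a) (just b) r = before? a b r
  linked? _        _        r = true

  -- Columns are listed from the bottom up; the bottom of each column lies
  -- below the top of the next one.
  zigzag? : List (List A) → List A → Bool
  zigzag? []           r = true
  zigzag? (c ∷ [])     r = increasing? c r
  zigzag? (c ∷ d ∷ cs) r = increasing? c r ∧ (linked? (head c) (last d) r ∧ zigzag? (d ∷ cs) r)

  increasing?-agree : ∀ c {r s} → AgreeOn c r s → increasing? c r ≡ increasing? c s
  increasing?-agree []          agree = ≡.refl
  increasing?-agree (a ∷ [])    agree = ≡.refl
  increasing?-agree (a ∷ b ∷ c) agree = ≡.cong₂ _∧_
    (agrees agree (here ≡.refl) (there (here ≡.refl)))
    (increasing?-agree (b ∷ c) (AgreeOn-⊆ there agree))

  head∈ : ∀ {a : A} c → head c ≡ just a → a ∈ c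
  head∈ (_ ∷ _) ≡.refl = here ≡.refl

  last∈ : ∀ {a : A} c → last c ≡ just a → a ∈ c
  last∈ (_ ∷ [])        ≡.refl = here ≡.refl
  last∈ (_ ∷ c@(_ ∷ _)) e      = there (last∈ c e)

  linked?-agree : ∀ u v {c r s} → (∀ {a} → u ≡ just a → a ∈ c) → (∀ {a} → v ≡ just a → a ∈ c) →
    AgreeOn c r s → linked? u v r ≡ linked? u v s
  linked?-agree (just _) (just _) u∈ v∈ agree = agrees agree (u∈ ≡.refl) (v∈ ≡.refl)
  linked?-agree (just _) nothing  u∈ v∈ agree = ≡.refl
  linked?-agree nothing  v        u∈ v∈ agree = ≡.refl

  zigzag?-agree : ∀ cs {r s} → AgreeOn (concat cs) r s → zigzag? cs r ≡ zigzag? cs s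
  zigzag?-agree []           agree = ≡.refl
  zigzag?-agree (c ∷ [])     agree = increasing?-agree c (AgreeOn-⊆ ∈-++⁺ˡ agree)
  zigzag?-agree (c ∷ d ∷ cs) agree = ≡.cong₂ _∧_
    (increasing?-agree c (AgreeOn-⊆ ∈-++⁺ˡ agree))
    (≡.cong₂ _∧_
      (linked?-agree (head c) (last d)
        (λ e → ∈-++⁺ˡ (head∈ c e)) (λ e → ∈-++⁺ʳ c (∈-++⁺ˡ {xs = d} (last∈ d e))) agree)
      (zigzag?-agree (d ∷ cs) (AgreeOn-⊆ (∈-++⁺ʳ c) agree)))

  increasing?-++ : ∀ d c r →
    increasing? (d ++ c) r ≡ increasing? d r ∧ (linked? (last d) (head c) r ∧ increasing? c r)
  increasing?-++ []              c       r = ≡.refl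
  increasing?-++ (b ∷ [])        []      r = ≡.refl
  increasing?-++ (b ∷ [])        (a ∷ c) r = ≡.refl
  increasing?-++ (b ∷ d@(b′ ∷ _)) c      r = ≡.trans
    (≡.cong (before? b b′ r ∧_) (increasing?-++ d c r))
    (≡.sym (∧-assoc (before? b b′ r) (increasing? d r) _))
    where open import Data.Bool.Properties using (∧-assoc)

-- Breaking the links of a zigzag.

module ZigzagSums (S : CommutativeRing 0ℓ 0ℓ) {A : Set} (_≟_ : DecidableEquality A) where
  open CommutativeRing S hiding (zero) renaming (_≈_ to _≋_; Carrier to V)
  open RingProperties ring using (-0#≈0#)
  open import Relation.Binary.Reasoning.Setoid setoid
  open ListSums S
  open Sums S A
  open Before _≟_

  -- Only c itself survives: by induction the tail keeps its own order, and then the new element has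
  -- to be inserted in front of b, that is at the very beginning.
  O-increasing : ∀ c → Unique c → ∀ (F : List A → V) → O c (λ q → guard (increasing? c q) (F q)) ≋ F c
  O-increasing []          _            F = +-identityʳ _
  O-increasing (a ∷ [])    _            F = +-identityʳ _
  O-increasing (a ∷ b ∷ c) (a∉ ∷ uniq) F = begin
    O (a ∷ b ∷ c) (λ q → guard (before? a b q ∧ increasing? (b ∷ c) q) (F q))
      ≈⟨ O-∷ a (b ∷ c) _ ⟩
    O (b ∷ c) (λ q → I [ a ] q (λ r → guard (before? a b r ∧ increasing? (b ∷ c) r) (F r)))
      ≈⟨ ∑ᴸ-cong (orderings (b ∷ c)) restrict ⟩
    O (b ∷ c) (λ q → guard (increasing? (b ∷ c) q) (I [ a ] q (λ r → guard (before? a b r) (F r))))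
      ≈⟨ O-increasing (b ∷ c) uniq _ ⟩
    I [ a ] (b ∷ c) (λ r → guard (before? a b r) (F r))
      ≈⟨ I-∷ a [] b c (λ r → guard (before? a b r) (F r)) ⟩
    I [] (b ∷ c) (λ r → guard (before? a b (a ∷ r)) (F (a ∷ r))) +
    I [ a ] c (λ r → guard (before? a b (b ∷ r)) (F (b ∷ r)))
      ≈⟨ +-cong (trans (I-[]ˡ (b ∷ c) (λ r → guard (before? a b (a ∷ r)) (F (a ∷ r)))) (reflexive first))
           (trans (I-cong [ a ] c (λ r → reflexive (≡.cong (λ z → guard z (F (b ∷ r))) (before?-second r (All.head a∉)))))
             (∑ᴸ-0 (interleavings [ a ] c))) ⟩
    F (a ∷ b ∷ c) + 0#
      ≈⟨ +-identityʳ _ ⟩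
    F (a ∷ b ∷ c) ∎
    where
    first : guard (before? a b (a ∷ b ∷ c)) (F (a ∷ b ∷ c)) ≡ F (a ∷ b ∷ c)
    first with a ≟ a
    ... | yes _ = ≡.refl
    ... | no ne = contradiction ≡.refl ne

    restrict : ∀ q → I [ a ] q (λ r → guard (before? a b r ∧ increasing? (b ∷ c) r) (F r)) ≋
      guard (increasing? (b ∷ c) q) (I [ a ] q (λ r → guard (before? a b r) (F r)))
    restrict q = trans
      (∑ᴸ-cong-All (All.map
        (λ {r} agree → reflexive (≡.trans
          (≡.cong (λ z → guard (before? a b r ∧ z) (F r)) (increasing?-agree (b ∷ c) agree))
          (≡.trans (≡.cong (λ z → guard z (F r)) (∧-comm (before? a b r) _)) (guard-∧ _ (before? a b r) (F r)))))
        (interleavings-agreeʳ {b ∷ c} [ a ] q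
          (λ { e∈ (here ≡.refl) → All.lookup a∉ e∈ ≡.refl }))))
      (∑ᴸ-guard (increasing? (b ∷ c) q) (interleavings [ a ] q) _)
      where open import Data.Bool.Properties using (∧-comm)

  Z : (List A → V) → List (List A) → V
  Z F cs = O (concat cs) (λ r → guard (zigzag? cs r) (F r))

  -- Two elements of a linear order are comparable, so a link between
  -- consecutive columns is "no relation" minus the reversed link; the latter
  -- stacks the two columns into one.
  Z-break : ∀ F c d cs → c ≢ [] → d ≢ [] → Unique (concat (c ∷ d ∷ cs)) →
    Z F (c ∷ d ∷ cs) ≋ Z (λ r → I c r F) (d ∷ cs) - Z F ((d ++ c) ∷ cs)
  Z-break F c d cs c≢[] d≢[] uniq = begin
    O (c ++ E) (λ r → guard (zigzag? (c ∷ d ∷ cs) r) (F r))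
      ≈⟨ ∑ᴸ-cong-All (All.map (λ {r} perm → trans (split r perm)
           (+-congˡ (-‿cong (reflexive (≡.cong (λ z → guard z (F r)) (≡.sym (stack r)))))))
           (orderings-↭ (c ++ E))) ⟩
    O (c ++ E) (λ r → guard (increasing? c r ∧ zigzag? (d ∷ cs) r) (F r) -
      guard (zigzag? ((d ++ c) ∷ cs) r) (F r))
      ≈⟨ ∑ᴸ-minus (orderings (c ++ E)) _ _ ⟩
    O (c ++ E) (λ r → guard (increasing? c r ∧ zigzag? (d ∷ cs) r) (F r)) -
      O (c ++ E) (λ r → guard (zigzag? ((d ++ c) ∷ cs) r) (F r))
      ≈⟨ +-cong unlinked (-‿cong (O-exchange c d (concat cs) _)) ⟩
    Z (λ r → I c r F) (d ∷ cs) - Z F ((d ++ c) ∷ cs) ∎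
    where
    open import Data.Bool.Properties using (∧-assoc; ∧-comm)

    E : List A
    E = concat (d ∷ cs)

    disjoint : ∀ {e} c → Unique (c ++ E) → e ∈ c → e ∉ E
    disjoint (_ ∷ c) (e∉ ∷ _) (here ≡.refl) e∈ = All.lookup (All.++⁻ʳ c e∉) e∈ ≡.refl
    disjoint (_ ∷ c) (_ ∷ u)  (there e∈c)   e∈ = disjoint c u e∈c e∈

    -- The columns are disjoint, so in an interleaving each condition depends on one of the two
    -- listings alone.
    separate : ∀ p q → p ↭ c → q ↭ E →
      I p q (λ r → guard (increasing? c r ∧ zigzag? (d ∷ cs) r) (F r)) ≋
      guard (increasing? c p) (guard (zigzag? (d ∷ cs) q) (I p q F))
    separate p q p↭c q↭E = begin
      I p q (λ r → guard (increasing? c r ∧ zigzag? (d ∷ cs) r) (F r))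
        ≈⟨ ∑ᴸ-cong-All (All.zipWith
             (λ {r} (agreeˡ , agreeʳ) → reflexive (≡.trans
               (≡.cong₂ (λ u v → guard (u ∧ v) (F r)) (increasing?-agree c agreeˡ) (zigzag?-agree (d ∷ cs) agreeʳ))
               (guard-∧ (increasing? c p) (zigzag? (d ∷ cs) q) (F r))))
             ( interleavings-agreeˡ {c} p q (λ e∈c e∈q → disjoint c uniq e∈c (∈-resp-↭ q↭E e∈q))
             , interleavings-agreeʳ {E} p q (λ e∈E e∈p → disjoint c uniq (∈-resp-↭ p↭c e∈p) e∈E) )) ⟩
      I p q (λ r → guard (increasing? c p) (guard (zigzag? (d ∷ cs) q) (F r)))
        ≈⟨ ∑ᴸ-guard (increasing? c p) (interleavings p q) _ ⟩
      guard (increasing? c p) (I p q (λ r → guard (zigzag? (d ∷ cs) q) (F r)))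
        ≈⟨ guard-cong (increasing? c p) (∑ᴸ-guard (zigzag? (d ∷ cs) q) (interleavings p q) F) ⟩
      guard (increasing? c p) (guard (zigzag? (d ∷ cs) q) (I p q F)) ∎

    unlinked : O (c ++ E) (λ r → guard (increasing? c r ∧ zigzag? (d ∷ cs) r) (F r)) ≋
      Z (λ r → I c r F) (d ∷ cs)
    unlinked = begin
      O (c ++ E) (λ r → guard (increasing? c r ∧ zigzag? (d ∷ cs) r) (F r))
        ≈⟨ O-++ c E _ ⟩
      O c (λ p → O E (λ q → I p q (λ r → guard (increasing? c r ∧ zigzag? (d ∷ cs) r) (F r))))
        ≈⟨ ∑ᴸ-cong-All (All.map (λ {p} p↭c → trans
             (∑ᴸ-cong-All (All.map (λ {q} q↭E → separate p q p↭c q↭E) (orderings-↭ E)))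
             (∑ᴸ-guard (increasing? c p) (orderings E) _)) (orderings-↭ c)) ⟩
      O c (λ p → guard (increasing? c p) (O E (λ q → guard (zigzag? (d ∷ cs) q) (I p q F))))
        ≈⟨ O-increasing c (All-unique c uniq) _ ⟩
      O E (λ q → guard (zigzag? (d ∷ cs) q) (I c q F)) ∎
      where
      All-unique : ∀ c → Unique (c ++ E) → Unique c
      All-unique []      _        = []
      All-unique (_ ∷ c) (a ∷ u) = All.++⁻ˡ c a ∷ All-unique c u

    stack : ∀ r → zigzag? ((d ++ c) ∷ cs) r ≡
      increasing? c r ∧ (linked? (last d) (head c) r ∧ zigzag? (d ∷ cs) r)
    stack r = ≡.trans (outer cs)
      (rotate (increasing? c r) (linked? (last d) (head c) r) (zigzag? (d ∷ cs) r))
      where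
      rotate : ∀ p q s → s ∧ (q ∧ p) ≡ p ∧ (q ∧ s)
      rotate p q s = ≡.trans (∧-comm s (q ∧ p)) (≡.trans (≡.cong (_∧ s) (∧-comm q p)) (∧-assoc p q s))

      outer : ∀ cs → zigzag? ((d ++ c) ∷ cs) r ≡
        zigzag? (d ∷ cs) r ∧ (linked? (last d) (head c) r ∧ increasing? c r)
      outer []       = increasing?-++ d c r
      outer (e ∷ cs) = ≡.trans
        (≡.cong₂ (λ u v → u ∧ (linked? v (last e) r ∧ zigzag? (e ∷ cs) r)) (increasing?-++ d c r) (head-++ d d≢[]))
        (move (increasing? d r) _ _)
        where
        -- The stacked column d ++ c has the bottom of d, so the link from d to the following column
        -- survives the stacking.
        head-++ : ∀ d → d ≢ [] → head (d ++ c) ≡ head d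
        head-++ []      ne = contradiction ≡.refl ne
        head-++ (_ ∷ _) ne = ≡.refl
        move : ∀ p q s → (p ∧ q) ∧ s ≡ (p ∧ s) ∧ q
        move p q s = ≡.trans (∧-assoc p q s) (≡.trans (≡.cong (p ∧_) (∧-comm q s)) (≡.sym (∧-assoc p s q)))

    -- Both columns are non-empty and share no element, so the link joins two distinct listed
    -- elements, of which one comes first.
    complement : ∀ r → r ↭ c ++ E → linked? (last d) (head c) r ≡ not (linked? (head c) (last d) r)
    complement r perm with head c in eqc | last d in eqd
    ... | just a  | just b  = before?-swap r a≢b (∈-resp-↭ (↭-sym perm) (∈-++⁺ˡ (head∈ c eqc)))
      where
      a≢b : a ≢ b
      a≢b ≡.refl = disjoint c uniq (head∈ c eqc) (∈-++⁺ˡ (last∈ d eqd))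
    ... | nothing | _       = contradiction (head-nothing c eqc) c≢[]
      where
      head-nothing : ∀ c → head c ≡ nothing → c ≡ []
      head-nothing [] _ = ≡.refl
    ... | just _  | nothing = contradiction (last-nothing d eqd) d≢[]
      where
      last-nothing : ∀ d → last d ≡ nothing → d ≡ []
      last-nothing []            _ = ≡.refl
      last-nothing (_ ∷ (b ∷ d)) e = contradiction (last-nothing (b ∷ d) e) λ ()

    split : ∀ r → r ↭ c ++ E → guard (zigzag? (c ∷ d ∷ cs) r) (F r) ≋
      guard (increasing? c r ∧ zigzag? (d ∷ cs) r) (F r) -
      guard (increasing? c r ∧ (linked? (last d) (head c) r ∧ zigzag? (d ∷ cs) r)) (F r)
    split r perm rewrite complement r perm =
      cases (increasing? c r) (linked? (head c) (last d) r) (zigzag? (d ∷ cs) r)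
      where
      cases : ∀ p q s → guard (p ∧ (q ∧ s)) (F r) ≋ guard (p ∧ s) (F r) - guard (p ∧ (not q ∧ s)) (F r)
      cases true  true  true  = sym (trans (+-congˡ -0#≈0#) (+-identityʳ _))
      cases true  true  false = sym (-‿inverseʳ 0#)
      cases true  false true  = sym (-‿inverseʳ _)
      cases true  false false = sym (-‿inverseʳ 0#)
      cases false q     s     = sym (-‿inverseʳ 0#)

-- Linear extensions of the 2-poset as zigzag listings.

module _ {a b : Bool} where
  open Equivalence (T-∧ {a} {b}) public renaming (to to T-∧⁻; from to T-∧⁺)

module ZigzagTabulate {A : Set} (_≟_ : DecidableEquality A) where
  open Before _≟_

  Before : List A → A → A → Set
  Before r a b = T (before? a b r)

  increasing⁺ : ∀ {k} (f : Fin k → A) r →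
    (∀ i j → toℕ j ≡ suc (toℕ i) → Before r (f i) (f j)) → T (increasing? (tabulate f) r)
  increasing⁺ {zero}        f r h = _
  increasing⁺ {suc zero}    f r h = _
  increasing⁺ {suc (suc k)} f r h = T-∧⁺
    (h zero (suc zero) ≡.refl , increasing⁺ (f ∘ suc) r (λ i j e → h (suc i) (suc j) (≡.cong suc e)))

  increasing⁻ : ∀ {k} (f : Fin k → A) r → T (increasing? (tabulate f) r) →
    ∀ i j → toℕ j ≡ suc (toℕ i) → Before r (f i) (f j)
  increasing⁻ {suc (suc k)} f r t zero    (suc zero)    e = proj₁ (T-∧⁻ t)
  increasing⁻ {suc (suc k)} f r t (suc i) (suc j)       e =
    increasing⁻ (f ∘ suc) r (proj₂ (T-∧⁻ {before? (f zero) (f (suc zero)) r} t)) i j (ℕ.suc-injective e)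
  increasing⁻ {suc zero}    f r t zero    (suc ())      e

  linked⁺ : ∀ {k l} (f : Fin k → A) (g : Fin l → A) r →
    (∀ i j → toℕ i ≡ 0 → suc (toℕ j) ≡ l → Before r (f i) (g j)) →
    T (linked? (head (tabulate f)) (last (tabulate g)) r)
  linked⁺ {zero}  {l}           f g r h = _
  linked⁺ {suc k} {zero}        f g r h = _
  linked⁺ {suc k} {suc zero}    f g r h = h zero zero ≡.refl ≡.refl
  linked⁺ {suc k} {suc (suc l)} f g r h =
    linked⁺ {suc k} {suc l} f (g ∘ suc) r (λ i j e e′ → h i (suc j) e (≡.cong suc e′))

  linked⁻ : ∀ {k l} (f : Fin k → A) (g : Fin l → A) r →
    T (linked? (head (tabulate f)) (last (tabulate g)) r) →
    ∀ i j → toℕ i ≡ 0 → suc (toℕ j) ≡ l → Before r (f i) (g j)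
  linked⁻ {suc k} {suc zero}    f g r t zero zero    e e′ = t
  linked⁻ {suc k} {suc (suc l)} f g r t zero (suc j) e e′ =
    linked⁻ {suc k} {suc l} f (g ∘ suc) r t zero j e (ℕ.suc-injective e′)

  zigzag⁺ : ∀ {n} (f : Fin n → List A) r → (∀ i → T (increasing? (f i) r)) →
    (∀ i j → toℕ j ≡ suc (toℕ i) → T (linked? (head (f i)) (last (f j)) r)) →
    T (zigzag? (tabulate f) r)
  zigzag⁺ {zero}        f r h l = _
  zigzag⁺ {suc zero}    f r h l = h zero
  zigzag⁺ {suc (suc n)} f r h l = T-∧⁺ (h zero , T-∧⁺ (l zero (suc zero) ≡.refl ,
    zigzag⁺ (f ∘ suc) r (h ∘ suc) (λ i j e → l (suc i) (suc j) (≡.cong suc e))))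

  zigzag⁻-increasing : ∀ {n} (f : Fin n → List A) r → T (zigzag? (tabulate f) r) →
    ∀ i → T (increasing? (f i) r)
  zigzag⁻-increasing {suc zero}    f r t zero    = t
  zigzag⁻-increasing {suc (suc n)} f r t zero    = proj₁ (T-∧⁻ t)
  zigzag⁻-increasing {suc (suc n)} f r t (suc i) = zigzag⁻-increasing (f ∘ suc) r
    (proj₂ (T-∧⁻ {linked? (head (f zero)) (last (f (suc zero))) r}
      (proj₂ (T-∧⁻ {increasing? (f zero) r} t)))) i

  zigzag⁻-linked : ∀ {n} (f : Fin n → List A) r → T (zigzag? (tabulate f) r) →
    ∀ i j → toℕ j ≡ suc (toℕ i) → T (linked? (head (f i)) (last (f j)) r)
  zigzag⁻-linked {suc zero}    f r t zero    (suc ())   e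
  zigzag⁻-linked {suc (suc n)} f r t zero    (suc zero) e =
    proj₁ (T-∧⁻ (proj₂ (T-∧⁻ {increasing? (f zero) r} t)))
  zigzag⁻-linked {suc (suc n)} f r t (suc i) (suc j)    e = zigzag⁻-linked (f ∘ suc) r
    (proj₂ (T-∧⁻ {linked? (head (f zero)) (last (f (suc zero))) r}
      (proj₂ (T-∧⁻ {increasing? (f zero) r} t)))) i j (ℕ.suc-injective e)

  before⁺ : ∀ r → Unique r → ∀ (i j : Fin (length r)) → i Fin.< j → Before r (lookup r i) (lookup r j)
  before⁺ (c ∷ r) (c∉ ∷ u) zero (suc j) i<j with c ≟ c
  ... | yes _ = _
  ... | no ne = contradiction ≡.refl ne
  before⁺ (c ∷ r) (c∉ ∷ u) (suc i) (suc j) (ℕ.s≤s i<j) = ≡.subst T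
    (≡.sym (before?-∷ r (All.lookup c∉ (∈-lookup i)) (All.lookup c∉ (∈-lookup j))))
    (before⁺ r u i j i<j)

  before⁻ : ∀ r → Unique r → ∀ (i j : Fin (length r)) → lookup r i ≢ lookup r j →
    Before r (lookup r i) (lookup r j) → i Fin.< j
  before⁻ (c ∷ r) u        zero    zero    ne t = contradiction ≡.refl ne
  before⁻ (c ∷ r) u        zero    (suc j) ne t = ℕ.z<s
  before⁻ (c ∷ r) u        (suc i) zero    ne t = contradiction (≡.subst T (before?-second r ne) t) λ ()
  before⁻ (c ∷ r) (c∉ ∷ u) (suc i) (suc j) ne t = ℕ.s<s (before⁻ r u i j ne (≡.subst T
    (before?-∷ r (All.lookup c∉ (∈-lookup i)) (All.lookup c∉ (∈-lookup j))) t))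

unique-resp-↭ : {A : Set} {as bs : List A} → as ↭ bs → Unique as → Unique bs
unique-resp-↭ {A} r = PermutationSetoid.Unique-resp-↭ (≡.setoid A) (↭⇒↭ₛ r)

module _ (ks : Index) where
  open Before (_≟⋆_ ks)
  open ZigzagTabulate (_≟⋆_ ks)

  rows : List (List (Point ks))
  rows = map (row ks) (allFin (length ks))

  column-points : ∀ i → Fin (lookup ks i) → Point ks
  column-points i m = i , m

  rows≡tabulate : rows ≡ tabulate (λ i → tabulate (column-points i))
  rows≡tabulate = ≡.trans (List.map-tabulate id (row ks))
    (List.tabulate-cong (λ i → List.map-tabulate id (i ,_)))

  -- The zigzag test sees only the generating relations. Positions in a listing are linearly
  -- ordered, so the relations of the transitive closure follow by composing steps.
  orderPreserving≡zigzag : ∀ ps → ps ↭ points ks →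
    does (orderPreserving? (X⋆ ks) ps) ≡ zigzag? rows ps
  orderPreserving≡zigzag ps ps↭ = does-⇔ (mk⇔ to from) (orderPreserving? (X⋆ ks) ps) (T? (zigzag? rows ps))
    where
    unique : Unique ps
    unique = unique-resp-↭ (↭-sym ps↭) (points-unique ks)

    complete : ∀ p → p ∈ ps
    complete p = ∈-resp-↭ (↭-sym ps↭) (points-complete ks p)

    covers⁺ : OrderPreserving (X⋆ ks) ps → ∀ {p q} → _⋖_ ks p q → Before ps p q
    covers⁺ op {p} {q} p⋖q = ≡.subst₂ (Before ps) (≡.sym ep) (≡.sym eq)
      (before⁺ ps unique _ _ (op (Any.index (complete p)) (Any.index (complete q))
        (≡.subst₂ (_<⋆_ ks) ep eq ⁺.[ p⋖q ])))
      where
      ep = lookup-index (complete p)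
      eq = lookup-index (complete q)

    cover⁻ : (∀ {p q} → _⋖_ ks p q → Before ps p q) →
      ∀ {p q} → _⋖_ ks p q → ∀ i j → lookup ps i ≡ p → lookup ps j ≡ q → i Fin.< j
    cover⁻ h r i j ≡.refl ≡.refl =
      before⁻ ps unique i j (λ e → <⋆-irrefl ks e ⁺.[ r ]) (h r)

    covers⁻ : (∀ {p q} → _⋖_ ks p q → Before ps p q) →
      ∀ {p q} → _<⋆_ ks p q → ∀ i j → lookup ps i ≡ p → lookup ps j ≡ q → i Fin.< j
    covers⁻ h ⁺.[ r ]            i j ei ej = cover⁻ h r i j ei ej
    covers⁻ h (_∷_ {y = s} r r⁺) i j ei ej = Fin.<-trans
      (cover⁻ h r i k ei (≡.sym ek)) (covers⁻ h r⁺ k j (≡.sym ek) ej)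
      where
      k  = Any.index (complete s)
      ek = lookup-index (complete s)

    to : OrderPreserving (X⋆ ks) ps → T (zigzag? rows ps)
    to op = ≡.subst (λ cs → T (zigzag? cs ps)) (≡.sym rows≡tabulate) (zigzag⁺ _ ps
      (λ i → increasing⁺ (column-points i) ps (λ m m′ e → covers⁺ op (chain e)))
      (λ i i′ e → linked⁺ (column-points i) (column-points i′) ps (λ m m′ z l → covers⁺ op (link e z l))))

    from : T (zigzag? rows ps) → OrderPreserving (X⋆ ks) ps
    from t a b a<b = covers⁻ covers a<b a b ≡.refl ≡.refl
      where
      spec : T (zigzag? (tabulate (λ i → tabulate (column-points i))) ps)
      spec = ≡.subst (λ cs → T (zigzag? cs ps)) rows≡tabulate t
      covers : ∀ {p q} → _⋖_ ks p q → Before ps p q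
      covers (chain {i} {m} {m′} e)       = increasing⁻ (column-points i) ps (zigzag⁻-increasing _ ps spec i) m m′ e
      covers (link {i} {i′} {m} {m′} e z l) =
        linked⁻ (column-points i) (column-points i′) ps (zigzag⁻-linked _ ps spec i i′ e) m m′ z l

-- From listings of points to shuffles of words.

-- Read from the bottom up, unlike column.
columnᵘ : ℕ → Word
columnᵘ zero    = []
columnᵘ (suc j) = y ∷ replicate j x

map-label-rows : ∀ ks → map (map (label ks)) (rows ks) ≡ map columnᵘ ks
map-label-rows ks = ≡.trans (≡.sym (List.map-∘ (allFin (length ks))))
  (≡.trans (List.map-tabulate id _) (≡.trans
    (List.tabulate-cong (λ i → ≡.trans (≡.sym (List.map-∘ (allFin (lookup ks i))))
      (≡.trans (List.map-tabulate id _) (labels (lookup ks i)))))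
    (≡.trans (≡.sym (List.map-tabulate (lookup ks) columnᵘ)) (≡.cong (map columnᵘ) (List.tabulate-lookup ks)))))
  where
  labels : ∀ k → tabulate {n = k} (λ m → if toℕ m ≡ᵇ 0 then y else x) ≡ columnᵘ k
  labels zero    = ≡.refl
  labels (suc j) = ≡.cong (y ∷_) (xs j)
    where
    xs : ∀ j → tabulate {n = j} (λ _ → x) ≡ replicate j x
    xs zero    = ≡.refl
    xs (suc j) = ≡.cong (x ∷_) (xs j)

ℚring : CommutativeRing _ _
ℚring = ℚ.+-*-commutativeRing

module 𝕊 = ShuffleAlgebra ℚring
open 𝕊 using (_⧢_; _≐_; ε; snoc)

δʷ : Word → 𝕊.Coeffs
δʷ []      = ε
δʷ (u ∷ w) = snoc u (δʷ w)

-- The recursion of `Z-break` on labels. The word v is the column stacked so far; the reversed link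
-- puts the next column c underneath, hence `c ++ v` when reading upwards.
zigzagᵘ : Word → List Word → 𝕊.Coeffs
zigzagᵘ v []       = δʷ v
zigzagᵘ v (c ∷ cs) w = (δʷ v ⧢ zigzagᵘ c cs) w ℚ.- zigzagᵘ (c ++ v) cs w

module _ {A : Set} (_≟_ : DecidableEquality A) (lab : A → Letter) where
  private module S = CommutativeRing 𝕊.commutativeRing
  open ListSums 𝕊.commutativeRing
  open Sums 𝕊.commutativeRing A
  open Before _≟_
  open ZigzagSums 𝕊.commutativeRing _≟_

  labelled : List A → 𝕊.Coeffs
  labelled r = δʷ (map lab r)

  -- Interleaving removes bottom elements whereas the shuffle recursion removes last letters. Here
  -- the labels are read with the bottom letter last, so words come out reversed; `⧢-reverse`
  -- repairs this later.
  I-labelled : ∀ p q → I p q labelled ≐ labelled p ⧢ labelled q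
  I-labelled []      q       = S.trans (I-[]ˡ q labelled) (S.sym (S.*-identityˡ (labelled q)))
  I-labelled (a ∷ p) []      = S.trans (I-[]ʳ (a ∷ p) labelled) (S.sym (S.*-identityʳ (labelled (a ∷ p))))
  I-labelled (a ∷ p) (b ∷ q) = S.trans (I-∷ a p b q labelled) (S.trans
    (S.+-cong (S.trans (∑ᴸ-snoc (lab a) (interleavings p (b ∷ q))) (𝕊.snoc-cong (lab a) (I-labelled p (b ∷ q))))
              (S.trans (∑ᴸ-snoc (lab b) (interleavings (a ∷ p) q)) (𝕊.snoc-cong (lab b) (I-labelled (a ∷ p) q))))
    (S.sym (𝕊.snoc-⧢-snoc (lab a) (lab b) (labelled p) (labelled q))))
    where
    ∑ᴸ-snoc : ∀ u (rs : List (List A)) → ∑ᴸ rs (λ r → snoc u (labelled r)) ≐ snoc u (∑ᴸ rs labelled)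
    ∑ᴸ-snoc u []       = S.sym (𝕊.snoc-𝟘 u)
    ∑ᴸ-snoc u (r ∷ rs) = S.trans (S.+-congˡ {snoc u (labelled r)} (∑ᴸ-snoc u rs)) (S.sym (𝕊.snoc-⊞ u (labelled r) _))

  Z-labelled : ∀ c cs → All (_≢ []) (c ∷ cs) → Unique (concat (c ∷ cs)) →
    Z labelled (c ∷ cs) ≐ zigzagᵘ (map lab c) (map (map lab) cs)
  Z-labelled c []       _ uniq = S.trans
    (S.reflexive (≡.cong (λ es → O es (λ r → guard (increasing? c r) (labelled r))) (List.++-identityʳ c)))
    (O-increasing c (≡.subst Unique (List.++-identityʳ c) uniq) labelled)
  Z-labelled c (d ∷ cs) (c≢ ∷ d≢ ∷ cs≢) uniq = S.trans
    (Z-break labelled c d cs c≢ d≢ uniq)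
    (S.+-cong
      (S.trans (∑ᴸ-cong (orderings (concat (d ∷ cs))) (λ r → S.trans
          (guard-cong (zigzag? (d ∷ cs) r) (I-labelled c r)) (guard-* (zigzag? (d ∷ cs) r) r)))
        (S.trans (∑ᴸ-* (labelled c) (orderings (concat (d ∷ cs))) _)
          (S.*-congˡ {labelled c} (Z-labelled d cs (d≢ ∷ cs≢) (unique-drop c uniq)))))
      (S.-‿cong (S.trans (Z-labelled (d ++ c) cs (++-≢[] d d≢ ∷ cs≢)
          (≡.subst Unique (≡.sym (List.++-assoc d c (concat cs))) (unique-resp-↭ exchange uniq)))
        (S.reflexive (≡.cong (λ v → zigzagᵘ v (map (map lab) cs)) (List.map-++ lab d c))))))
    where
    guard-* : ∀ b r → guard b (labelled c ⧢ labelled r) ≐ labelled c ⧢ guard b (labelled r)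
    guard-* true  r = S.refl {labelled c ⧢ labelled r}
    guard-* false r = S.sym (S.zeroʳ (labelled c))

    ++-≢[] : ∀ (d : List A) → d ≢ [] → d ++ c ≢ []
    ++-≢[] []      ne e = ne ≡.refl

    unique-drop : ∀ {bs : List A} as → Unique (as ++ bs) → Unique bs
    unique-drop []       u       = u
    unique-drop (_ ∷ as) (_ ∷ u) = unique-drop as u

    exchange : c ++ d ++ concat cs ↭ d ++ c ++ concat cs
    exchange = ≡.subst₂ _↭_ (List.++-assoc c d (concat cs)) (List.++-assoc d c (concat cs))
      (++⁺ʳ (concat cs) (++-comm c d))

-- Coefficients of formal linear combinations.

fromℕ-suc : ∀ n → fromℕ (suc n) ≡ 1ℚ ℚ.+ fromℕ n
fromℕ-suc n = ℚ.toℚᵘ-injective (begin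
  ℚ.toℚᵘ (fromℕ (suc n))                 ≈⟨ ℚ.toℚᵘ-fromℚᵘ (mkℚᵘ (ℤ.+ suc n) 0) ⟩
  mkℚᵘ (ℤ.+ suc n) 0                       ≈⟨ *≡* (≡.trans (ℤ.*-identityʳ _) (≡.sym (≡.trans (ℤ.*-identityʳ _) (≡.cong (λ i → ℤ.+ 1 ℤ.+ i) (ℤ.*-identityʳ (ℤ.+ n)))))) ⟩
  mkℚᵘ (ℤ.+ 1) 0 ℚᵘ.+ mkℚᵘ (ℤ.+ n) 0         ≈⟨ ℚᵘ.+-congʳ (mkℚᵘ (ℤ.+ 1) 0) (ℚ.toℚᵘ-fromℚᵘ (mkℚᵘ (ℤ.+ n) 0)) ⟨
  ℚ.toℚᵘ 1ℚ ℚᵘ.+ ℚ.toℚᵘ (fromℕ n)        ≈⟨ ℚ.toℚᵘ-homo-+ 1ℚ (fromℕ n) ⟨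
  ℚ.toℚᵘ (1ℚ ℚ.+ fromℕ n)                ∎)
  where open ℚᵘ.≃-Reasoning

-- A power of -1 is 1 or -1, and for these two values negation in ℚ is a computation.
sign-suc : ∀ n → sign (suc n) ≡ ℚ.- sign n
sign-suc n with parity n
  where
  parity : ∀ n → (-1ℤ ℤ.^ n ≡ 1ℤ) ⊎ (-1ℤ ℤ.^ n ≡ -1ℤ)
  parity zero    = inj₁ ≡.refl
  parity (suc n) with parity n
  ... | inj₁ e = inj₂ (≡.cong (-1ℤ ℤ.*_) e)
  ... | inj₂ e = inj₁ (≡.cong (-1ℤ ℤ.*_) e)
... | inj₁ e rewrite e = ≡.refl
... | inj₂ e rewrite e = ≡.refl

open ListSums ℚring using (∑ᴸ; ∑ᴸ-map; ∑ᴸ-concatMap; ∑ᴸ-cong; ∑ᴸ-cong-All; ∑ᴸ-*; ∑ᴸ-0)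

private
  module ℚR = CommutativeRing ℚring
  module ℚP = RingProperties ℚR.ring

coeff-++ : ∀ p q w → coeff (p ++ q) w ≡ coeff p w ℚ.+ coeff q w
coeff-++ []            q w = ≡.sym (ℚ.+-identityˡ _)
coeff-++ ((c , v) ∷ p) q w = ≡.trans (≡.cong (first ℚ.+_) (coeff-++ p q w))
  (≡.sym (ℚ.+-assoc first (coeff p w) (coeff q w)))
  where
  first : ℚ
  first = if does (v ≟ᵂ w) then c else 0ℚ

coeff-⊛ : ∀ c p w → coeff (c ⊛ p) w ≡ c ℚ.* coeff p w
coeff-⊛ c []            w = ≡.sym (ℚ.*-zeroʳ c)
coeff-⊛ c ((d , v) ∷ p) w = ≡.trans
  (≡.cong₂ ℚ._+_ (scale (does (v ≟ᵂ w))) (coeff-⊛ c p w)) (≡.sym (ℚ.*-distribˡ-+ c _ _))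
  where
  scale : ∀ b → (if b then c ℚ.* d else 0ℚ) ≡ c ℚ.* (if b then d else 0ℚ)
  scale true  = ≡.refl
  scale false = ≡.sym (ℚ.*-zeroʳ c)

coeff-⊖ : ∀ p q w → coeff (p ⊖ q) w ≡ coeff p w ℚ.- coeff q w
coeff-⊖ p q w = ≡.trans (coeff-++ p _ w) (≡.cong (coeff p w ℚ.+_)
  (≡.trans (coeff-⊛ (ℚ.- 1ℚ) q w) (ℚP.-1*x≈-x (coeff q w))))

coeff-∑ : ∀ {A : Set} (as : List A) f w → coeff (∑ as f) w ≡ ∑ᴸ as (λ a → coeff (f a) w)
coeff-∑ []       f w = ≡.refl
coeff-∑ (a ∷ as) f w = ≡.trans (coeff-++ (f a) _ w) (≡.cong (coeff (f a) w ℚ.+_) (coeff-∑ as f w))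

coeff-· : ∀ p u → coeff (p ·ℍ u) ≐ snoc u (coeff p)
coeff-· []            u w       = ≡.sym (𝕊.snoc-𝟘 u w)
coeff-· ((c , v) ∷ p) u []      = ≡.trans (ℚ.+-identityˡ _) (coeff-· p u [])
coeff-· ((c , v) ∷ p) u (u′ ∷ w) with does (u ≟ᴸ u′) | coeff-· p u (u′ ∷ w)
... | true  | e = ≡.cong ((if does (v ≟ᵂ w) then c else 0ℚ) ℚ.+_) e
... | false | e = ≡.trans (ℚ.+-identityˡ _) e

coeff-word : ∀ v → coeff (word v) ≐ δʷ v
coeff-word []      []      = ≡.refl
coeff-word []      (_ ∷ _) = ≡.refl
coeff-word (u ∷ v) w       = ≡.trans (coeff-· (word v) u w) (𝕊.snoc-cong u (coeff-word v) w)

coeff-shʷ : ∀ v w → coeff (v shʷ w) ≐ δʷ v ⧢ δʷ w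
coeff-shʷ []       w        z = ≡.trans (coeff-word w z) (≡.sym (𝕊.⧢-identityˡ (δʷ w) z))
coeff-shʷ (u ∷ v)  []       z = ≡.trans (coeff-word (u ∷ v) z)
  (≡.sym (≡.trans (𝕊.⧢-comm (δʷ (u ∷ v)) ε z) (𝕊.⧢-identityˡ (δʷ (u ∷ v)) z)))
coeff-shʷ (u ∷ v) (u′ ∷ w) z = ≡.trans (coeff-++ ((v shʷ (u′ ∷ w)) ·ℍ u) _ z) (≡.trans
  (≡.cong₂ ℚ._+_
    (≡.trans (coeff-· (v shʷ (u′ ∷ w)) u z) (𝕊.snoc-cong u (coeff-shʷ v (u′ ∷ w)) z))
    (≡.trans (coeff-· ((u ∷ v) shʷ w) u′ z) (𝕊.snoc-cong u′ (coeff-shʷ (u ∷ v) w) z)))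
  (≡.sym (𝕊.snoc-⧢-snoc u u′ (δʷ v) (δʷ w) z)))

scale : ℚ → 𝕊.Coeffs → 𝕊.Coeffs
scale c f w = c ℚ.* f w

⧢-scaleˡ : ∀ c f g → scale c f ⧢ g ≐ scale c (f ⧢ g)
⧢-scaleˡ c f g []      = ℚ.*-assoc c _ _
⧢-scaleˡ c f g (u ∷ w) = ≡.trans
  (≡.cong₂ ℚ._+_ (⧢-scaleˡ c _ g w) (⧢-scaleˡ c f _ w)) (≡.sym (ℚ.*-distribˡ-+ c _ _))

coeff-∷ : ∀ c v p → coeff ((c , v) ∷ p) ≐ scale c (δʷ v) 𝕊.⊞ coeff p
coeff-∷ c v p w = ≡.cong (ℚ._+ coeff p w) (≡.trans (≡.sym (single (does (v ≟ᵂ w))))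
  (≡.cong (c ℚ.*_) (coeff-word v w)))
  where
  single : ∀ b → c ℚ.* ((if b then 1ℚ else 0ℚ) ℚ.+ 0ℚ) ≡ (if b then c else 0ℚ)
  single true  = ℚ.*-identityʳ c
  single false = ℚ.*-zeroʳ c

coeff-sh : ∀ p q → coeff (p sh q) ≐ coeff p ⧢ coeff q
coeff-sh []            q z = ≡.sym (𝕊.⧢-zeroˡ (coeff q) z)
coeff-sh ((c , v) ∷ p) q z = begin
  coeff (row-by q ++ (p sh q)) z
    ≡⟨ coeff-++ (row-by q) (p sh q) z ⟩
  coeff (row-by q) z ℚ.+ coeff (p sh q) z
    ≡⟨ ≡.cong₂ ℚ._+_ (first q z) (coeff-sh p q z) ⟩
  (scale c (δʷ v) ⧢ coeff q) z ℚ.+ (coeff p ⧢ coeff q) z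
    ≡⟨ 𝕊.⧢-distribʳ (coeff q) (scale c (δʷ v)) (coeff p) z ⟨
  ((scale c (δʷ v) 𝕊.⊞ coeff p) ⧢ coeff q) z
    ≡⟨ 𝕊.⧢-cong (coeff-∷ c v p) (λ _ → ≡.refl) z ⟨
  (coeff ((c , v) ∷ p) ⧢ coeff q) z ∎
  where
  open ≡.≡-Reasoning
  row-by : ℍ → ℍ
  row-by q = ∑[ (d , w) ∈ q ] ((c ℚ.* d) ⊛ (v shʷ w))

  first : ∀ q → coeff (row-by q) ≐ scale c (δʷ v) ⧢ coeff q
  first []            z = ≡.sym (≡.trans (𝕊.⧢-comm (scale c (δʷ v)) 𝕊.𝟘 z) (𝕊.⧢-zeroˡ (scale c (δʷ v)) z))
  first ((d , w) ∷ q) z = begin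
    coeff ((c ℚ.* d) ⊛ (v shʷ w) ++ row-by q) z
      ≡⟨ coeff-++ ((c ℚ.* d) ⊛ (v shʷ w)) (row-by q) z ⟩
    coeff ((c ℚ.* d) ⊛ (v shʷ w)) z ℚ.+ coeff (row-by q) z
      ≡⟨ ≡.cong₂ ℚ._+_ (≡.trans (coeff-⊛ (c ℚ.* d) (v shʷ w) z) (≡.trans
           (≡.cong ((c ℚ.* d) ℚ.*_) (coeff-shʷ v w z)) bilinear)) (first q z) ⟩
    (scale c (δʷ v) ⧢ scale d (δʷ w)) z ℚ.+ (scale c (δʷ v) ⧢ coeff q) z
      ≡⟨ 𝕊.⧢-distribˡ (scale c (δʷ v)) (scale d (δʷ w)) (coeff q) z ⟨
    (scale c (δʷ v) ⧢ (scale d (δʷ w) 𝕊.⊞ coeff q)) z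
      ≡⟨ 𝕊.⧢-cong {scale c (δʷ v)} (λ _ → ≡.refl) (coeff-∷ d w q) z ⟨
    (scale c (δʷ v) ⧢ coeff ((d , w) ∷ q)) z ∎
    where
    bilinear : (c ℚ.* d) ℚ.* (δʷ v ⧢ δʷ w) z ≡ (scale c (δʷ v) ⧢ scale d (δʷ w)) z
    bilinear = begin
      (c ℚ.* d) ℚ.* (δʷ v ⧢ δʷ w) z                ≡⟨ ℚ.*-assoc c d _ ⟩
      c ℚ.* (d ℚ.* (δʷ v ⧢ δʷ w) z)                ≡⟨ ≡.cong (λ s → c ℚ.* (d ℚ.* s)) (𝕊.⧢-comm (δʷ v) (δʷ w) z) ⟩
      c ℚ.* (d ℚ.* (δʷ w ⧢ δʷ v) z)                ≡⟨ ≡.cong (c ℚ.*_) (⧢-scaleˡ d (δʷ w) (δʷ v) z) ⟨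
      c ℚ.* (scale d (δʷ w) ⧢ δʷ v) z              ≡⟨ ≡.cong (c ℚ.*_) (𝕊.⧢-comm (scale d (δʷ w)) (δʷ v) z) ⟩
      c ℚ.* (δʷ v ⧢ scale d (δʷ w)) z              ≡⟨ ⧢-scaleˡ c (δʷ v) (scale d (δʷ w)) z ⟨
      (scale c (δʷ v) ⧢ scale d (δʷ w)) z          ∎

-- Reversal exchanges deletion of the last letter with deletion of the first, and both are
-- derivations of the shuffle product.
⧢-reverse : ∀ f g w → (f ⧢ g) (reverse w) ≡ ((f ∘ reverse) ⧢ (g ∘ reverse)) w
⧢-reverse f g []      = ≡.refl
⧢-reverse f g (u ∷ w) = begin
  (f ⧢ g) (reverse (u ∷ w))
    ≡⟨ ≡.cong (f ⧢ g) (List.unfold-reverse u w) ⟩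
  (f ⧢ g) (reverse w ++ [ u ])
    ≡⟨ 𝕊.⧢-first u f g (reverse w) ⟩
  ((λ v → f (v ++ [ u ])) ⧢ g) (reverse w) ℚ.+ (f ⧢ (λ v → g (v ++ [ u ]))) (reverse w)
    ≡⟨ ≡.cong₂ ℚ._+_ (⧢-reverse (λ v → f (v ++ [ u ])) g w) (⧢-reverse f (λ v → g (v ++ [ u ])) w) ⟩
  ((λ v → f (reverse v ++ [ u ])) ⧢ (g ∘ reverse)) w ℚ.+ ((f ∘ reverse) ⧢ (λ v → g (reverse v ++ [ u ]))) w
    ≡⟨ ≡.cong₂ ℚ._+_
         (𝕊.⧢-cong {g = g ∘ reverse} (λ v → ≡.cong f (≡.sym (List.unfold-reverse u v))) (λ _ → ≡.refl) w)
         (𝕊.⧢-cong {f ∘ reverse} (λ _ → ≡.refl) (λ v → ≡.cong g (≡.sym (List.unfold-reverse u v))) w) ⟩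
  ((f ∘ reverse) ⧢ (g ∘ reverse)) (u ∷ w) ∎
  where open ≡.≡-Reasoning

δʷ-reverse : ∀ v w → δʷ v (reverse w) ≡ δʷ (reverse v) w
δʷ-reverse v w = begin
  δʷ v (reverse w)                                        ≡⟨ coeff-word v (reverse w) ⟨
  (if does (v ≟ᵂ reverse w) then 1ℚ else 0ℚ) ℚ.+ 0ℚ       ≡⟨ ≡.cong (λ b → (if b then 1ℚ else 0ℚ) ℚ.+ 0ℚ) same ⟩
  (if does (reverse v ≟ᵂ w) then 1ℚ else 0ℚ) ℚ.+ 0ℚ       ≡⟨ coeff-word (reverse v) w ⟩
  δʷ (reverse v) w                                        ∎
  where
  open ≡.≡-Reasoning
  same : does (v ≟ᵂ reverse w) ≡ does (reverse v ≟ᵂ w)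
  same = does-⇔ (mk⇔ (λ e → ≡.trans (≡.cong reverse e) (List.reverse-involutive w))
    (λ e → ≡.trans (≡.sym (List.reverse-involutive v)) (≡.cong reverse e))) (v ≟ᵂ reverse w) (reverse v ≟ᵂ w)

∑ᴸ-eval : ∀ {A : Set} (as : List A) (F : A → 𝕊.Coeffs) w →
  ListSums.∑ᴸ 𝕊.commutativeRing as F w ≡ ∑ᴸ as (λ a → F a w)
∑ᴸ-eval []       F w = ≡.refl
∑ᴸ-eval (a ∷ as) F w = ≡.cong (F a w ℚ.+_) (∑ᴸ-eval as F w)

∑ᴸ-filter : ∀ {A : Set} {P : A → Set} (P? : Decidable P) (as : List A) (F : A → ℚ) →
  ∑ᴸ (filter P? as) F ≡ ∑ᴸ as (λ a → if does (P? a) then F a else 0ℚ)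
∑ᴸ-filter P? []       F = ≡.refl
∑ᴸ-filter P? (a ∷ as) F with does (P? a)
... | true  = ≡.cong (F a ℚ.+_) (∑ᴸ-filter P? as F)
... | false = ≡.trans (∑ᴸ-filter P? as F) (≡.sym (ℚ.+-identityˡ _))

-- The argument is reversed because listings run from the bottom up, whereas words are stored from
-- the last letter.
coeff-w⋆ : ∀ k ks → All NonZero (k ∷ ks) → ∀ w →
  coeff (w⋆ (k ∷ ks)) w ≡ zigzagᵘ (columnᵘ k) (map columnᵘ ks) (reverse w)
coeff-w⋆ k ks pos w = begin
  coeff (w⋆ K) w
    ≡⟨ coeff-∑ (filter (orderPreserving? (X⋆ K)) (orderings (points K))) _ w ⟩
  ∑ᴸ (filter (orderPreserving? (X⋆ K)) (orderings (points K))) (λ ps → coeff (word (reverse (map (label K) ps))) w)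
    ≡⟨ ∑ᴸ-filter (orderPreserving? (X⋆ K)) (orderings (points K)) _ ⟩
  ∑ᴸ (orderings (points K)) (λ ps → if does (orderPreserving? (X⋆ K) ps) then coeff (word (reverse (map (label K) ps))) w else 0ℚ)
    ≡⟨ ∑ᴸ-cong-All (All.map (λ {ps} ps↭ → ≡.cong₂ (λ b c → if b then c else 0ℚ)
         (orderPreserving≡zigzag K ps ps↭)
         (≡.trans (coeff-word (reverse (map (label K) ps)) w) (≡.sym (δʷ-reverse (map (label K) ps) w))))
         (orderings-↭ (points K))) ⟩
  ∑ᴸ (orderings (points K)) (λ ps → if zigzag? (rows K) ps then labelled (_≟⋆_ K) (label K) ps (reverse w) else 0ℚ)
    ≡⟨ ∑ᴸ-cong (orderings (points K)) (λ ps → if-eval (zigzag? (rows K) ps) (labelled (_≟⋆_ K) (label K) ps)) ⟩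
  ∑ᴸ (orderings (points K)) (λ ps → ListSums.guard 𝕊.commutativeRing (zigzag? (rows K) ps) (labelled (_≟⋆_ K) (label K) ps) (reverse w))
    ≡⟨ ∑ᴸ-eval (orderings (points K)) _ (reverse w) ⟨
  ZigzagSums.Z 𝕊.commutativeRing (_≟⋆_ K) (labelled (_≟⋆_ K) (label K)) (rows K) (reverse w)
    ≡⟨ Z-labelled (_≟⋆_ K) (label K) _ _ nonempty (points-unique K) (reverse w) ⟩
  zigzagᵘ* (map (map (label K)) (rows K)) (reverse w)
    ≡⟨ ≡.cong (λ cs → zigzagᵘ* cs (reverse w)) (map-label-rows K) ⟩
  zigzagᵘ (columnᵘ k) (map columnᵘ ks) (reverse w) ∎
  where
  open ≡.≡-Reasoning
  K : Index
  K = k ∷ ks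
  open Before (_≟⋆_ K)

  zigzagᵘ* : List Word → 𝕊.Coeffs
  zigzagᵘ* []       = ε
  zigzagᵘ* (c ∷ cs) = zigzagᵘ c cs

  if-eval : ∀ b (f : 𝕊.Coeffs) →
    (if b then f (reverse w) else 0ℚ) ≡ ListSums.guard 𝕊.commutativeRing b f (reverse w)
  if-eval true  f = ≡.refl
  if-eval false f = ≡.refl

  nonempty : All (_≢ []) (rows K)
  nonempty = All.map⁺ (All.universal (λ i → row-nonempty i) (allFin (length K)))
    where
    map-nonempty : ∀ {A : Set} {n} → NonZero n → (f : Fin n → A) → map f (allFin n) ≢ []
    map-nonempty {n = suc n} _ f ()
    row-nonempty : ∀ i → row K i ≢ []
    row-nonempty i = map-nonempty (All.lookup pos (∈-lookup i)) (i ,_)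
      where open import Data.List.Membership.Propositional.Properties using (∈-lookup)

-- The interpretation over ℚ.

open Core (shuffle⟦t⟧ ℚring)

embed : 𝕊.Coeffs → R
embed f zero    = f
embed f (suc _) = 𝕊.𝟘

embed-cong : ∀ {f g} → f ≐ g → embed f ≋ embed g
embed-cong e zero    = e
embed-cong e (suc _) = λ _ → ≡.refl

embed-⧢ : ∀ f g → embed (f ⧢ g) ≋ embed f * embed g
embed-⧢ f g zero    = λ _ → ≡.refl
embed-⧢ f g (suc n) w = ≡.sym (≡.trans
  (≡.cong₂ ℚ._+_ (≡.trans (𝕊.⧢-comm f 𝕊.𝟘 w) (𝕊.⧢-zeroˡ f w)) (zeros n))
  (ℚ.+-identityˡ 0ℚ))
  where
  zeros : ∀ n → ((embed f ∘ suc) * embed g) n w ≡ 0ℚ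
  zeros n = PowerSeries.⊠-zeroˡ 𝕊.commutativeRing (embed g) n w

embed-minus : ∀ f g → embed (λ w → f w ℚ.- g w) ≋ embed f - embed g
embed-minus f g zero    w = ≡.refl
embed-minus f g (suc n) w = ≡.refl

embed-ε : embed ε ≋ 1#
embed-ε zero    w = ≡.refl
embed-ε (suc n) w = ≡.refl

embed-snoc : ∀ u f → embed (snoc u f) ≋ op u (embed f)
embed-snoc u f zero    w = ≡.refl
embed-snoc u f (suc n) w = ≡.sym (𝕊.snoc-𝟘 u w)

embed-δʷ : ∀ v → embed (δʷ v) ≋ append v 1#
embed-δʷ []      = embed-ε
embed-δʷ (u ∷ v) = trans (embed-snoc u (δʷ v)) (op-cong u (embed-δʷ v))

-- After reversal, stacking c ++ v becomes the composition of the two `append` operators, so the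
-- recursion of `zigzagᵘ` becomes that of `G`.
embed-zigzag : ∀ v cs → embed (zigzagᵘ v cs ∘ reverse) ≋ G (append (reverse v)) (map (append ∘ reverse) cs)
embed-zigzag v []       = trans (embed-cong (δʷ-reverse v)) (embed-δʷ (reverse v))
embed-zigzag v (c ∷ cs) = begin
  embed (zigzagᵘ v (c ∷ cs) ∘ reverse)
    ≈⟨ embed-minus ((δʷ v ⧢ zigzagᵘ c cs) ∘ reverse) (zigzagᵘ (c ++ v) cs ∘ reverse) ⟩
  embed ((δʷ v ⧢ zigzagᵘ c cs) ∘ reverse) - embed (zigzagᵘ (c ++ v) cs ∘ reverse)
    ≈⟨ +-cong
         (trans (embed-cong (⧢-reverse (δʷ v) (zigzagᵘ c cs)))
           (trans (embed-⧢ (δʷ v ∘ reverse) (zigzagᵘ c cs ∘ reverse))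
             (*-cong (trans (embed-cong (δʷ-reverse v)) (embed-δʷ (reverse v))) (embed-zigzag c cs))))
         (-‿cong (trans (embed-zigzag (c ++ v) cs)
           (G-cong (map (append ∘ reverse) cs) (λ f → trans
             (reflexive≡ (≡.cong (λ w → append w f) (List.reverse-++ c v)))
             (append-++ (reverse v) (reverse c) f))))) ⟩
  G (append (reverse v)) (map (append ∘ reverse) (c ∷ cs)) ∎

reverse-columnᵘ : ∀ k → reverse (columnᵘ k) ≡ column k
reverse-columnᵘ zero    = ≡.refl
reverse-columnᵘ (suc j) = ≡.trans (List.unfold-reverse y (replicate j x)) (≡.cong (_++ [ y ]) (reverse-xs j))
  where
  replicate-∷ʳ : ∀ j → replicate j x ++ [ x ] ≡ x ∷ replicate j x
  replicate-∷ʳ zero    = ≡.refl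
  replicate-∷ʳ (suc j) = ≡.cong (x ∷_) (replicate-∷ʳ j)
  reverse-xs : ∀ j → reverse (replicate j x) ≡ replicate j x
  reverse-xs zero    = ≡.refl
  reverse-xs (suc j) = ≡.trans (List.unfold-reverse x (replicate j x))
    (≡.trans (≡.cong (_++ [ x ]) (reverse-xs j)) (replicate-∷ʳ j))

⟦_⟧ : ℍ⟦t⟧ → R
⟦ f ⟧ n = coeff (f n)

⟦const⟧ : ∀ p → ⟦ const p ⟧ ≋ embed (coeff p)
⟦const⟧ p zero    w = ≡.refl
⟦const⟧ p (suc n) w = ≡.refl

⟦w⋆⟧ : ∀ ks → All NonZero ks → ⟦ const (w⋆ ks) ⟧ ≋ star ks
⟦w⋆⟧ []       _   = trans (⟦const⟧ (w⋆ [])) (trans (embed-cong unit) embed-ε)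
  where
  unit : coeff (w⋆ []) ≐ ε
  unit = coeff-word []
⟦w⋆⟧ (k ∷ ks) pos = begin
  ⟦ const (w⋆ (k ∷ ks)) ⟧
    ≈⟨ ⟦const⟧ (w⋆ (k ∷ ks)) ⟩
  embed (coeff (w⋆ (k ∷ ks)))
    ≈⟨ embed-cong (coeff-w⋆ k ks pos) ⟩
  embed (zigzagᵘ (columnᵘ k) (map columnᵘ ks) ∘ reverse)
    ≈⟨ embed-zigzag (columnᵘ k) (map columnᵘ ks) ⟩
  G (append (reverse (columnᵘ k))) (map (append ∘ reverse) (map columnᵘ ks))
    ≈⟨ reflexive≡ (≡.cong₂ (λ v → G (append v)) (reverse-columnᵘ k)
         (≡.trans (≡.sym (List.map-∘ ks)) (List.map-cong (λ k → ≡.cong append (reverse-columnᵘ k)) ks))) ⟩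
  star (k ∷ ks) ∎

∑ᴸ-applyUpTo : ∀ (h : ℕ → ℕ) k (F : ℕ → ℚ) → ∑ᴸ (applyUpTo h k) F ≡ ∑ᴸ (upTo k) (F ∘ h)
∑ᴸ-applyUpTo h zero    F = ≡.refl
∑ᴸ-applyUpTo h (suc k) F = ≡.cong (F (h 0) ℚ.+_)
  (≡.trans (∑ᴸ-applyUpTo (h ∘ suc) k F) (≡.sym (∑ᴸ-applyUpTo suc k (F ∘ h))))

fromℕ-+ : ∀ m n → fromℕ (m ℕ.+ n) ≡ fromℕ m ℚ.+ fromℕ n
fromℕ-+ zero    n = ≡.sym (ℚ.+-identityˡ _)
fromℕ-+ (suc m) n = ≡.trans (fromℕ-suc (m ℕ.+ n)) (≡.trans (≡.cong (1ℚ ℚ.+_) (fromℕ-+ m n))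
  (≡.trans (≡.sym (ℚ.+-assoc 1ℚ (fromℕ m) (fromℕ n))) (≡.cong (ℚ._+ fromℕ n) (≡.sym (fromℕ-suc m)))))

fromℕ-* : ∀ m n → fromℕ (m ℕ.* n) ≡ fromℕ m ℚ.* fromℕ n
fromℕ-* zero    n = ≡.sym (ℚ.*-zeroˡ (fromℕ n))
fromℕ-* (suc m) n = ≡.trans (fromℕ-+ n (m ℕ.* n)) (≡.trans
  (≡.cong₂ ℚ._+_ (≡.sym (ℚ.*-identityˡ (fromℕ n))) (fromℕ-* m n))
  (≡.trans (≡.sym (ℚ.*-distribʳ-+ (fromℕ n) 1ℚ (fromℕ m))) (≡.cong (ℚ._* fromℕ n) (≡.sym (fromℕ-suc m)))))

∙-eval : ∀ m f n w → (m ∙ f) n w ≡ fromℕ m ℚ.* f n w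
∙-eval zero    f n w = ≡.sym (ℚ.*-zeroˡ (f n w))
∙-eval (suc m) f n w = ≡.trans
  (≡.cong₂ ℚ._+_ (≡.sym (ℚ.*-identityˡ (f n w))) (∙-eval m f n w))
  (≡.trans (≡.sym (ℚ.*-distribʳ-+ (f n w) 1ℚ (fromℕ m))) (≡.cong (ℚ._* f n w) (≡.sym (fromℕ-suc m))))

𝕋-eval : ∀ F n w → 𝕋 F n w ≡ ∑ᴸ (upTo (suc n)) (λ j → F j (n ℕ.∸ j) w)
𝕋-eval F zero    w = ≡.sym (ℚ.+-identityʳ _)
𝕋-eval F (suc n) w = ≡.cong (F 0 (suc n) w ℚ.+_) (≡.trans (𝕋-eval (F ∘ suc) n w)
  (≡.sym (∑ᴸ-applyUpTo suc (suc n) (λ j → F j (suc n ℕ.∸ j) w))))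

*-eval : ∀ f g n w → (f * g) n w ≡ ∑ᴸ (upTo (suc n)) (λ j → (f j ⧢ g (n ℕ.∸ j)) w)
*-eval f g zero    w = ≡.sym (ℚ.+-identityʳ _)
*-eval f g (suc n) w = ≡.cong ((f 0 ⧢ g (suc n)) w ℚ.+_) (≡.trans (*-eval (f ∘ suc) g n w)
  (≡.sym (∑ᴸ-applyUpTo suc (suc n) (λ j → (f j ⧢ g (suc n ℕ.∸ j)) w))))

⟦⟧-⊕ : ∀ f g → ⟦ f ⊕ᵗ g ⟧ ≋ ⟦ f ⟧ + ⟦ g ⟧
⟦⟧-⊕ f g n w = coeff-++ (f n) (g n) w

⟦⟧-⊖ : ∀ f g → ⟦ f ⊖ᵗ g ⟧ ≋ ⟦ f ⟧ - ⟦ g ⟧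
⟦⟧-⊖ f g n w = coeff-⊖ (f n) (g n) w

⟦⟧-sign : ∀ m f → ⟦ sign m ⊛ᵗ f ⟧ ≋ sgn m ⟦ f ⟧
⟦⟧-sign m f n w = ≡.trans (coeff-⊛ (sign m) (f n) w) (go m)
  where
  go : ∀ m → sign m ℚ.* coeff (f n) w ≡ sgn m ⟦ f ⟧ n w
  go zero    = ℚ.*-identityˡ _
  go (suc m) = ≡.trans (≡.cong (ℚ._* coeff (f n) w) (sign-suc m))
    (≡.trans (≡.sym (ℚ.neg-distribˡ-* (sign m) (coeff (f n) w))) (≡.cong ℚ.-_ (go m)))

⟦⟧-fromℕ : ∀ m f → ⟦ fromℕ m ⊛ᵗ f ⟧ ≋ m ∙ ⟦ f ⟧
⟦⟧-fromℕ m f n w = ≡.trans (coeff-⊛ (fromℕ m) (f n) w) (≡.sym (∙-eval m ⟦ f ⟧ n w))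

⟦⟧-sh : ∀ f g → ⟦ f shᵗ g ⟧ ≋ ⟦ f ⟧ * ⟦ g ⟧
⟦⟧-sh f g n w = ≡.trans (coeff-∑ (upTo (suc n)) (λ j → f j sh g (n ℕ.∸ j)) w) (≡.trans
  (∑ᴸ-cong (upTo (suc n)) (λ j → coeff-sh (f j) (g (n ℕ.∸ j)) w)) (≡.sym (*-eval ⟦ f ⟧ ⟦ g ⟧ n w)))

⟦⟧-∑t : ∀ f → ⟦ ∑tʲ f ⟧ ≋ 𝕋 (λ j → ⟦ f j ⟧)
⟦⟧-∑t f n w = ≡.trans (coeff-∑ (upTo (suc n)) (λ j → f j (n ℕ.∸ j)) w) (≡.sym (𝕋-eval (λ j → ⟦ f j ⟧) n w))

⟦⟧-const-⊖ : ∀ p q → ⟦ const (p ⊖ q) ⟧ ≋ ⟦ const p ⟧ - ⟦ const q ⟧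
⟦⟧-const-⊖ p q zero    w = coeff-⊖ p q w
⟦⟧-const-⊖ p q (suc n) w = ≡.refl

⟦⟧-const-fromℕ : ∀ m p → ⟦ const (fromℕ m ⊛ p) ⟧ ≋ m ∙ ⟦ const p ⟧
⟦⟧-const-fromℕ m p zero    w = ⟦⟧-fromℕ m (const p) zero w
⟦⟧-const-fromℕ m p (suc n) w = ⟦⟧-fromℕ m (const p) (suc n) w

opaque
  unfolding L

  L-eval : ∀ k f n w → L k f n w ≡
    ∑ᴸ (upTo (suc n)) (λ l → fromℕ ((k ℕ.+ l ℕ.∸ 1) C l) ℚ.* f (k ℕ.+ l) (n ℕ.∸ l) w)
  L-eval k f n w = ≡.trans (𝕋-eval (λ l → ((k ℕ.+ l ℕ.∸ 1) C l) ∙ f (k ℕ.+ l)) n w)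
    (∑ᴸ-cong (upTo (suc n)) (λ l → ∙-eval ((k ℕ.+ l ℕ.∸ 1) C l) (f (k ℕ.+ l)) (n ℕ.∸ l) w))

⟦⟧-∑tˡ : ∀ ks (p : List ℕ → ℍ) →
  ⟦ ∑tˡ[ ls ∈ℕ^ length ks ] fromℕ (binomials ks ls) ⊛ p (ks +ⁱ ls) ⟧ ≋ E ks (λ v → ⟦ const (p v) ⟧)
⟦⟧-∑tˡ ks p n w = ≡.trans (coeff-∑ (tuplesOfSum (length ks) n) (λ ls → fromℕ (binomials ks ls) ⊛ p (ks +ⁱ ls)) w) (≡.trans
  (∑ᴸ-cong (tuplesOfSum (length ks) n) (λ ls → coeff-⊛ (fromℕ (binomials ks ls)) (p (ks +ⁱ ls)) w))
  (go ks p n))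
  where
  go : ∀ ks (p : List ℕ → ℍ) n →
    ∑ᴸ (tuplesOfSum (length ks) n) (λ ls → fromℕ (binomials ks ls) ℚ.* coeff (p (ks +ⁱ ls)) w) ≡
    E ks (λ v → ⟦ const (p v) ⟧) n w
  go []       p zero    = ≡.trans (ℚ.+-identityʳ _) (ℚ.*-identityˡ _)
  go []       p (suc n) = ≡.refl
  go (k ∷ ks) p n = ≡.trans
    (∑ᴸ-concatMap (λ l → map (l ∷_) (tuplesOfSum (length ks) (n ℕ.∸ l))) (upTo (suc n)) _)
    (≡.trans (∑ᴸ-cong (upTo (suc n)) (λ l → first l (tuplesOfSum (length ks) (n ℕ.∸ l)) (go ks (λ v → p (k ℕ.+ l ∷ v)) (n ℕ.∸ l))))
      (≡.sym (L-eval k (λ a → E ks (λ v → ⟦ const (p (a ∷ v)) ⟧)) n w)))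
    where
    c : ℕ → ℕ
    c l = (k ℕ.+ l ℕ.∸ 1) C l

    first : ∀ l ts {s} →
      ∑ᴸ ts (λ ls → fromℕ (binomials ks ls) ℚ.* coeff (p (k ℕ.+ l ∷ ks +ⁱ ls)) w) ≡ s →
      ∑ᴸ (map (l ∷_) ts) (λ ls → fromℕ (binomials (k ∷ ks) ls) ℚ.* coeff (p ((k ∷ ks) +ⁱ ls)) w) ≡
      fromℕ (c l) ℚ.* s
    first l ts e = ≡.trans (∑ᴸ-map (l ∷_) ts _) (≡.trans
      (∑ᴸ-cong ts (λ ls → ≡.trans
        (≡.cong (ℚ._* coeff (p (k ℕ.+ l ∷ ks +ⁱ ls)) w) (fromℕ-* (c l) (binomials ks ls)))
        (ℚ.*-assoc (fromℕ (c l)) (fromℕ (binomials ks ls)) _)))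
      (≡.trans (∑ᴸ-* (fromℕ (c l)) ts _) (≡.cong (fromℕ (c l) ℚ.*_) e)))

-- Membership in ℍ¹ and the conclusion.

-- Words are stored last letter first, so this says that f lies in ℍ¹⟦t⟧.
StartsWithY : R → Set
StartsWithY f = ∀ n w → f n (w ++ [ x ]) ≡ 0ℚ

StartsWithY-resp : ∀ {f g} → f ≋ g → StartsWithY f → StartsWithY g
StartsWithY-resp e h n w = ≡.trans (≡.sym (e n (w ++ [ x ]))) (h n w)

*-startsWithY : ∀ f g → StartsWithY f → StartsWithY g → StartsWithY (f * g)
*-startsWithY f g h k n w = ≡.trans (*-eval f g n (w ++ [ x ])) (≡.trans
  (∑ᴸ-cong (upTo (suc n)) (λ j → ≡.trans (𝕊.⧢-first x (f j) (g (n ℕ.∸ j)) w) (≡.cong₂ ℚ._+_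
    (≡.trans (𝕊.⧢-cong {g = g (n ℕ.∸ j)} (h j) (λ _ → ≡.refl) w) (𝕊.⧢-zeroˡ (g (n ℕ.∸ j)) w))
    (≡.trans (𝕊.⧢-cong {f j} (λ _ → ≡.refl) (k (n ℕ.∸ j)) w)
      (≡.trans (𝕊.⧢-comm (f j) 𝕊.𝟘 w) (𝕊.⧢-zeroˡ (f j) w))))))
  (∑ᴸ-0 (upTo (suc n))))

𝕋-startsWithY : ∀ F → (∀ j → StartsWithY (F j)) → StartsWithY (𝕋 F)
𝕋-startsWithY F h zero    w = h 0 0 w
𝕋-startsWithY F h (suc n) w = ≡.cong₂ ℚ._+_ (h 0 (suc n) w) (𝕋-startsWithY (F ∘ suc) (h ∘ suc) n w)

Z-startsWithY : ∀ k f → StartsWithY f → StartsWithY (Z k f)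
Z-startsWithY zero    f h = h
Z-startsWithY (suc j) f h = proj₁ (go j)
  where
  -- The coefficient of the empty word has to vanish too, since `op x` moves it to the word x.
  go : ∀ j → StartsWithY (Z (suc j) f) × (∀ n → Z (suc j) f n [] ≡ 0ℚ)
  go zero = base , (λ n → ≡.refl)
    where
    base : StartsWithY (op y f)
    base n []      = ≡.refl
    base n (x ∷ w) = ≡.refl
    base n (y ∷ w) = h n w
  go (suc j) = step , (λ n → ≡.refl)
    where
    step : StartsWithY (op x (Z (suc j) f))
    step n []      = proj₂ (go j) n
    step n (x ∷ w) = proj₁ (go j) n w
    step n (y ∷ w) = ≡.refl

startsWithY-subalgebra : Subalgebra StartsWithY
startsWithY-subalgebra = record
  { 0∈   = λ n w → ≡.refl
  ; 1∈   = λ { zero [] → ≡.refl ; zero (_ ∷ _) → ≡.refl ; (suc n) w → ≡.refl }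
  ; +∈   = λ h k n w → ≡.cong₂ ℚ._+_ (h n w) (k n w)
  ; neg∈ = λ h n w → ≡.cong ℚ.-_ (h n w)
  ; *∈   = λ {f} {g} → *-startsWithY f g
  ; 𝕋∈   = λ {F} → 𝕋-startsWithY F
  ; Z∈   = λ k {f} → Z-startsWithY k f
  }

interpretation : Interpretation
interpretation = record
  { algebra        = shuffle⟦t⟧ ℚring
  ; ⟦_⟧            = ⟦_⟧
  ; ⟦⟧-⊕           = ⟦⟧-⊕
  ; ⟦⟧-⊖           = ⟦⟧-⊖
  ; ⟦⟧-sign        = ⟦⟧-sign
  ; ⟦⟧-fromℕ       = ⟦⟧-fromℕ
  ; ⟦⟧-sh          = ⟦⟧-sh
  ; ⟦⟧-∑-[]        = λ f n w → ≡.refl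
  ; ⟦⟧-∑-∷         = λ a as f n w → coeff-++ (f a n) (∑ᵗ as f n) w
  ; ⟦⟧-∑t          = ⟦⟧-∑t
  ; ⟦⟧-∑tˡ         = ⟦⟧-∑tˡ
  ; ⟦⟧-const-⊖     = ⟦⟧-const-⊖
  ; ⟦⟧-const-fromℕ = ⟦⟧-const-fromℕ
  ; ⟦⟧-const-∑-[]  = λ { f zero w → ≡.refl ; f (suc n) w → ≡.refl }
  ; ⟦⟧-const-∑-∷   = λ { a as f zero w → coeff-++ (f a) (∑ as f) w ; a as f (suc n) w → ≡.refl }
  ; ⟦w⋆⟧           = ⟦w⋆⟧
  }

open Interpreted interpretation using (⟦w⋆CSFŜ⟧-sum; ⟦dual⟧-sum)

theorem2p7 : (ks : Index) → All NonZero ks → ks ≢ [] →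
    w⋆CSFŜ ks ≈ℍ¹⟦t⟧
    (const (w⋆CSF ks) ⊕ᵗ
    sign (suc (wt ks)) ⊛ᵗ
    (∑tˡ[ ls ∈ℕ^ length ks ]
    fromℕ (binomials ks ls) ⊛ w⋆CSF (reverse (ks +ⁱ ls))))
theorem2p7 ks pos ne = StartsWithY-resp {sum} (sym lhs≋) sum∈ , StartsWithY-resp {sum} (sym rhs≋) sum∈ , trans lhs≋ (sym rhs≋)
  where
  sum : R
  sum = cyclic ks + sgn (suc (wt ks)) (E ks (λ v → cyclic (reverse v)))

  lhs≋ : ⟦ w⋆CSFŜ ks ⟧ ≋ sum
  lhs≋ = ⟦w⋆CSFŜ⟧-sum ks pos ne

  rhs≋ : ⟦ const (w⋆CSF ks) ⊕ᵗ sign (suc (wt ks)) ⊛ᵗ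
    (∑tˡ[ ls ∈ℕ^ length ks ] fromℕ (binomials ks ls) ⊛ w⋆CSF (reverse (ks +ⁱ ls))) ⟧ ≋ sum
  rhs≋ = ⟦dual⟧-sum ks pos

  -- Both sides inherit membership in ℍ¹ from their common value, which is built from columns by
  -- operations preserving it.
  sum∈ : StartsWithY sum
  sum∈ = cyclic-sum∈ startsWithY-subalgebra ks
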